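{- Let $n\ge 2$ and let $T_n$ denote the poset $T_n(\{r,b,g,o,y,s\})$ (all six colors). Then \[|J(T_n)|=\prod_{1\le i\le j\le n-1}\frac{i+j+n-2}{i+2j-2}=\prod_{1\le i\le j\le k\le n-1}\frac{i+j+k-1}{i+j+k-2}.\]
   Context: Let $T_n$ be the set of triples $(c_1,c_2,c_3)$ of nonnegative integers with $c_1+c_2+c_3\le n-2$. To the colors $r,g,y,b,o,s$ associate $v_r=(1,0,0)$, $v_g=(0,1,0)$, $v_y=(0,0,1)$, $v_b=(-1,1,0)$, $v_o=(-1,0,1)$, $v_s=(0,1,-1)$. For a set $S$ of colors, $T_n(S)$ is the poset on this set whose order is the reflexive–transitive closure of $p<p+v_x$ for $x\in S$ and $p,p+v_x$ in the set. $J(P)$ is the set of order ideals (down-closed subsets, including $\emptyset$) of $P$. -}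

module Defs where

open import Data.Nat using (ℕ; zero; suc; _+_; _*_; _∸_; _≤_; _≤ᵇ_)
open import Data.Integer as ℤ using (ℤ; +_; -[1+_])
open import Data.Product using (_×_; _,_; ∃; Σ)
open import Data.List using (List; []; _∷_; length; map; concatMap; filterᵇ; upTo; lookup)
open import Data.Nat.ListAction using (product)
open import Data.List.Membership.Propositional using (_∈_)
open import Data.List.Relation.Unary.Unique.Propositional using (Unique)
open import Data.Fin using (Fin)
open import Data.Fin.Subset using (Subset) renaming (_∈_ to _∈ˢ_)
open import Relation.Binary.PropositionalEquality using (_≡_)
open import Relation.Binary.Construct.Closure.ReflexiveTransitive using (Star)
open import Function.Bundles using (_⇔_)

data Color : Set where
  r g y b o s : Color

allColors : List Color
allColors = r ∷ b ∷ g ∷ o ∷ y ∷ s ∷ []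

ℤ³ : Set
ℤ³ = ℤ × ℤ × ℤ

vec : Color → ℤ³
vec r = (+ 1 , + 0 , + 0)
vec g = (+ 0 , + 1 , + 0)
vec y = (+ 0 , + 0 , + 1)
vec b = (-[1+ 0 ] , + 1 , + 0)
vec o = (-[1+ 0 ] , + 0 , + 1)
vec s = (+ 0 , + 1 , -[1+ 0 ])

Pt : Set
Pt = ℕ × ℕ × ℕ

embed : Pt → ℤ³
embed (a , b′ , c) = (+ a , + b′ , + c)

_⊕_ : ℤ³ → ℤ³ → ℤ³
(a , b′ , c) ⊕ (a′ , b″ , c′) = (a ℤ.+ a′ , b′ ℤ.+ b″ , c ℤ.+ c′)

-- Enumeration of T_n = {(c1,c2,c3) ∈ ℕ³ | c1+c2+c3 ≤ n-2} (each point listed once)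
pts : ℕ → List Pt
pts n =
  filterᵇ (λ { (a , b′ , c) → (a + b′ + c) ≤ᵇ (n ∸ 2) })
    (concatMap (λ a → concatMap (λ b′ → map (λ c → (a , b′ , c)) (upTo (suc n)))
                                (upTo (suc n)))
               (upTo (suc n)))

El : ℕ → Set
El n = Fin (length (pts n))

pt : (n : ℕ) → El n → Pt
pt n = lookup (pts n)

Cover : List Color → (n : ℕ) → El n → El n → Set
Cover S n i j = ∃ λ x → x ∈ S × (embed (pt n j) ≡ embed (pt n i) ⊕ vec x)

Leq : List Color → (n : ℕ) → El n → El n → Set
Leq S n = Star (Cover S n)

IsOrderIdeal : List Color → (n : ℕ) → Subset (length (pts n)) → Set
IsOrderIdeal S n I = ∀ i j → Leq S n i j → j ∈ˢ I → i ∈ˢ I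

HasCard : {A : Set} → (A → Set) → ℕ → Set
HasCard {A} P N = Σ (List A) λ L → Unique L × (∀ x → (x ∈ L) ⇔ P x) × (length L ≡ N)

NumIdeals : List Color → ℕ → ℕ → Set
NumIdeals S n N = HasCard (IsOrderIdeal S n) N

range1 : ℕ → List ℕ
range1 m = map suc (upTo m)

prod2 : ℕ → (ℕ → ℕ → ℕ) → ℕ
prod2 m f = product (concatMap (λ j → map (λ i → f i j) (range1 j)) (range1 m))

prod3 : ℕ → (ℕ → ℕ → ℕ → ℕ) → ℕ
prod3 m f = product (concatMap (λ k → concatMap (λ j → map (λ i → f i j k) (range1 j)) (range1 k)) (range1 m))

{-# OPTIONS --safe #-}
module Submission where

-- An order ideal is recorded by the heights e_k(j) = #{c₃ : (k, j, c₃) in the ideal}. Reading the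
-- slices k = n - 2, …, 0, the nonzero heights are particles that stay or move one step to the right
-- without colliding, while a new particle may enter at each step. Hence the number N_m of ideals,
-- m = n - 1, is the number of families of nonintersecting lattice paths whose starting points form an
-- arbitrary subset of m given ones and whose end points are free. For fixed starting points this
-- number is a Pfaffian, and by the addition formula for Pfaffians the sum over all subsets is the
-- Pfaffian of one skew form B on the polynomials of degree < m, extended by one or two further vectors.
--
-- With w = x (1 + x), the form B pairs the span of the wⁱ, which is even under x ↦ - 1 - x, only with
-- the odd span of the (1 + 2x) wʲ. In each degree there is a polynomial with hypergeometric
-- coefficients that is B-orthogonal to everything of lower degree but one vector, which gives N_{m+2} as
-- a multiple of N_m. Orthogonality is proved by creative telescoping. Evaluating the pairing of the
-- polynomials of two consecutive degrees in two ways relates these multiples: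
--   4 (2m+1) (2m+3) N_{m+2} N_{m-1} = 3 (3m+1) (3m+5) N_{m+1} N_m,
-- and both product formulas follow by induction.

open import Data.Bool.Base using (T; Bool; true; false)
open import Data.Empty using (⊥-elim; ⊥)
open import Data.List.Base using (List; []; _∷_; _++_; length; map; concatMap; lookup; upTo; filterᵇ)
open import Data.List.Membership.Propositional using (_∈_; find)
open import Data.List.Membership.Propositional.Properties using (∈-++⁺ˡ; ∈-++⁺ʳ; ∈-++⁻; ∈-map⁺; ∈-map⁻; ∈-concatMap⁺; ∈-concatMap⁻; ∈-filter⁺; ∈-filter⁻; ∈-upTo⁺; ∈-lookup)
open import Data.List.Properties using (length-++; length-map; ++-assoc; ∷-injectiveˡ; ∷-injectiveʳ; ++-identityʳ; upTo-∷ʳ; map-++; concatMap-++)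
open import Data.List.Relation.Binary.Sublist.Propositional using (_⊆_; []; _∷_; _∷ʳ_; ⊆-refl)
open import Data.List.Relation.Binary.Sublist.Propositional.Properties using (All-resp-⊆)
open import Data.List.Relation.Unary.All as All using ([]; _∷_; All)
open import Data.List.Relation.Unary.AllPairs using ([]; _∷_; AllPairs)
open import Data.List.Relation.Unary.Any as Any using (here; there; Any)
open import Data.List.Relation.Unary.Any.Properties using (lookup-index)
open import Data.List.Relation.Unary.Unique.Propositional using (Unique)
import Data.List.Relation.Unary.Unique.Propositional.Properties as Unique
open import Data.Product using (_,_; ∃; _×_; proj₁; proj₂)
open import Data.Product.Properties using (≡-dec; ,-injectiveˡ; ,-injectiveʳ)
open import Data.Sum using (inj₁; inj₂; _⊎_)
open import Data.Unit.Base using (⊤; tt)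
open import Function.Bundles using (mk⇔)
open import Relation.Binary.Construct.Closure.ReflexiveTransitive using (ε; _◅_)
open import Relation.Binary.PropositionalEquality hiding ([_])
open import Relation.Nullary using (Dec; yes; no; does)
open import Relation.Nullary.Decidable using (_×-dec_; dec-true; dec-false)
open ≡-Reasoning

-- A path at position a with b steps left is the polynomial x^a (1+x)^b, the generating function of
-- its end points. For free end points the form is `Q`, where Q(x^a, x^c) is the sign of a - c;
-- `inf`, evaluation at 1, takes care of an odd number of paths. The sum over subsets needs a second
-- form that is ±1, with alternating signs, on the starting vectors (1+x)^k. The substitution p*(x)
-- = p(-1-x) turns these into (-x)^k, so K(p, q) = -Q(p*, q*) is such a form. This choice of `K` is
-- the source of the parity: B(p, q) = Q(p, q) - Q(p*, q*) vanishes if p and q are both even or both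
-- odd. When m is even, a vector `om` seen only by `K` makes the number of vectors even.
--
-- The values that relate N_{m+2} to N_m are never computed. The pairing of two consecutive
-- polynomials expresses one such value through the next, up to leading coefficients and rational
-- factors; hence a relation between four consecutive N. In `Odd`, `Even`, `OddStep`, `EvenStep` the
-- parity is that of m: the polynomial itself is even for odd m and odd for even m.

-- Binomial coefficients with integer lower index and their signed tail sums.

module Binomials where
  open import Data.Nat.Base as ℕ using (ℕ; zero; suc)
  import Data.Nat.Properties as ℕ
  open import Data.Integer.Base using (ℤ; +_; -[1+_]; 0ℤ; 1ℤ; -1ℤ; _+_; _*_; _-_; -_)
  open import Data.Integer.Properties
  open import Data.Integer.Tactic.RingSolver using (solve-∀)

  -- C(N, r) for every integer r, zero outside 0 ≤ r ≤ N, so that Pascal's rule and the identities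
  -- below hold for all r.
  bin : ℕ → ℤ → ℤ
  bin zero (+ zero)   = 1ℤ
  bin zero (+ suc _)  = 0ℤ
  bin zero -[1+ _ ]   = 0ℤ
  bin (suc N) r = bin N r + bin N (r - 1ℤ)

  -- binDiff N r is the sum of the C(N,s) with s > r minus the sum of those with s < r.
  binDiff : ℕ → ℤ → ℤ
  binDiff zero (+ zero)  = 0ℤ
  binDiff zero (+ suc _) = -1ℤ
  binDiff zero -[1+ _ ]  = 1ℤ
  binDiff (suc N) r = binDiff N r + binDiff N (r - 1ℤ)

  -- Lowering r by one moves C(N, r) into the upper tail and C(N, r - 1) out of the lower one.
  binDiff-pred : ∀ N r → binDiff N (r - 1ℤ) - binDiff N r ≡ bin (suc N) r
  binDiff-pred zero (+ zero)        = refl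
  binDiff-pred zero (+ suc zero)    = refl
  binDiff-pred zero (+ suc (suc _)) = refl
  binDiff-pred zero -[1+ _ ]        = refl
  binDiff-pred (suc N) r = begin
    (binDiff N (r - 1ℤ) + binDiff N (r - 1ℤ - 1ℤ)) - (binDiff N r + binDiff N (r - 1ℤ))
      ≡⟨ regroup (binDiff N r) (binDiff N (r - 1ℤ)) (binDiff N (r - 1ℤ - 1ℤ)) ⟩
    (binDiff N (r - 1ℤ) - binDiff N r) + (binDiff N (r - 1ℤ - 1ℤ) - binDiff N (r - 1ℤ))
      ≡⟨ cong₂ _+_ (binDiff-pred N r) (binDiff-pred N (r - 1ℤ)) ⟩
    bin (suc N) r + bin (suc N) (r - 1ℤ) ∎
    where
    regroup : ∀ a b c → (b + c) - (a + b) ≡ (b - a) + (c - b)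
    regroup = solve-∀

  -- The symmetry C(N, s) = C(N, N - s) exchanges the two tails. This becomes the skew symmetry of
  -- `Q`.
  binDiff-reflect : ∀ N r → binDiff N (+ N - r) ≡ - binDiff N r
  binDiff-reflect zero (+ zero)  = refl
  binDiff-reflect zero (+ suc _) = refl
  binDiff-reflect zero -[1+ _ ]  = refl
  binDiff-reflect (suc N) r = begin
    binDiff N (+ suc N - r) + binDiff N (+ suc N - r - 1ℤ)
      ≡⟨ cong₂ (λ a b → binDiff N a + binDiff N b) (shift₁ (+ N) r) (shift₂ (+ N) r) ⟩
    binDiff N (+ N - (r - 1ℤ)) + binDiff N (+ N - r)
      ≡⟨ cong₂ _+_ (binDiff-reflect N (r - 1ℤ)) (binDiff-reflect N r) ⟩
    - binDiff N (r - 1ℤ) + - binDiff N r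
      ≡⟨ regroup (binDiff N r) (binDiff N (r - 1ℤ)) ⟩
    - (binDiff N r + binDiff N (r - 1ℤ)) ∎
    where
    shift₁ : ∀ n r → (1ℤ + n) - r ≡ n - (r - 1ℤ)
    shift₁ = solve-∀
    shift₂ : ∀ n r → (1ℤ + n) - r - 1ℤ ≡ n - r
    shift₂ = solve-∀
    regroup : ∀ a b → - b + - a ≡ - (a + b)
    regroup = solve-∀

  pow2 : ℕ → ℤ
  pow2 zero    = 1ℤ
  pow2 (suc n) = pow2 n + pow2 n

  binDiff-high : ∀ N k → binDiff N (+ (N ℕ.+ suc k)) ≡ - pow2 N
  binDiff-high zero    k = refl
  binDiff-high (suc N) k = begin
    binDiff N (+ suc (N ℕ.+ suc k)) + binDiff N (+ (N ℕ.+ suc k))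
      ≡⟨ cong₂ _+_ (trans (cong (λ x → binDiff N (+ x)) (sym (ℕ.+-suc N (suc k)))) (binDiff-high N (suc k))) (binDiff-high N k) ⟩
    - pow2 N + - pow2 N ≡⟨ sym (neg-distrib-+ (pow2 N) (pow2 N)) ⟩
    - (pow2 N + pow2 N) ∎

  bin-high : ∀ N k → bin N (+ (N ℕ.+ suc k)) ≡ 0ℤ
  bin-high zero    k = refl
  bin-high (suc N) k = cong₂ _+_
    (trans (cong (λ x → bin N (+ x)) (sym (ℕ.+-suc N (suc k)))) (bin-high N (suc k)))
    (bin-high N k)

  bin-low : ∀ N k → bin N -[1+ k ] ≡ 0ℤ
  bin-low zero    k = refl
  bin-low (suc N) k = cong₂ _+_ (bin-low N k) (bin-low N (suc (k ℕ.+ 0)))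

  bin-absorb : ∀ N r → r * bin N r ≡ (+ N - r + 1ℤ) * bin N (r - 1ℤ)
  bin-absorb zero (+ zero)        = refl
  bin-absorb zero (+ suc zero)    = refl
  bin-absorb zero (+ suc (suc n)) = trans (*-zeroʳ (+ suc (suc n))) (sym (*-zeroʳ (0ℤ - + suc (suc n) + 1ℤ)))
  bin-absorb zero -[1+ n ]        = trans (*-zeroʳ -[1+ n ]) (sym (*-zeroʳ (0ℤ - -[1+ n ] + 1ℤ)))
  bin-absorb (suc N) r = begin
    r * (b₀ + b₁)                       ≡⟨ *-distribˡ-+ r b₀ b₁ ⟩
    r * b₀ + r * b₁                     ≡⟨ cong (_+ r * b₁) (bin-absorb N r) ⟩
    (+ N - r + 1ℤ) * b₁ + r * b₁        ≡⟨ regroup (+ N) r b₁ ⟩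
    (1ℤ + + N - r + 1ℤ) * b₁ + (r - 1ℤ) * b₁
      ≡⟨ cong (λ x → (1ℤ + + N - r + 1ℤ) * b₁ + x) (trans (bin-absorb N (r - 1ℤ)) (shift (+ N) r b₂)) ⟩
    (1ℤ + + N - r + 1ℤ) * b₁ + (1ℤ + + N - r + 1ℤ) * b₂
      ≡⟨ sym (*-distribˡ-+ (1ℤ + + N - r + 1ℤ) b₁ b₂) ⟩
    (1ℤ + + N - r + 1ℤ) * (b₁ + b₂) ∎
    where
    b₀ = bin N r
    b₁ = bin N (r - 1ℤ)
    b₂ = bin N (r - 1ℤ - 1ℤ)
    regroup : ∀ n r b → (n - r + 1ℤ) * b + r * b ≡ (1ℤ + n - r + 1ℤ) * b + (r - 1ℤ) * b
    regroup = solve-∀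
    shift : ∀ n r b → (n - (r - 1ℤ) + 1ℤ) * b ≡ (1ℤ + n - r + 1ℤ) * b
    shift = solve-∀

  -- Together with `bin-lift₀` this raises neighbouring binomial coefficients to one common
  -- coefficient, which turns hypergeometric identities into polynomial ones.
  bin-lift₁ : ∀ N r → (1ℤ + + N) * bin N (r - 1ℤ) ≡ r * bin (suc N) r
  bin-lift₁ N r = begin
    (1ℤ + + N) * b₁                       ≡⟨ regroup (+ N) r b₁ ⟩
    (+ N - r + 1ℤ) * b₁ + r * b₁          ≡⟨ cong (_+ r * b₁) (sym (bin-absorb N r)) ⟩
    r * bin N r + r * b₁                  ≡⟨ sym (*-distribˡ-+ r (bin N r) b₁) ⟩
    r * (bin N r + b₁) ∎
    where
    b₁ = bin N (r - 1ℤ)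
    regroup : ∀ n r b → (1ℤ + n) * b ≡ (n - r + 1ℤ) * b + r * b
    regroup = solve-∀

  bin-lift₀ : ∀ N r → (1ℤ + + N) * bin N r ≡ (1ℤ + + N - r) * bin (suc N) r
  bin-lift₀ N r = begin
    (1ℤ + + N) * b₀                                    ≡⟨ regroup (+ N) r b₀ ⟩
    (1ℤ + + N - r) * b₀ + r * b₀                       ≡⟨ cong (λ x → (1ℤ + + N - r) * b₀ + x) (bin-absorb N r) ⟩
    (1ℤ + + N - r) * b₀ + (+ N - r + 1ℤ) * b₁          ≡⟨ regroup′ (+ N) r b₀ b₁ ⟩
    (1ℤ + + N - r) * (b₀ + b₁) ∎
    where
    b₀ = bin N r
    b₁ = bin N (r - 1ℤ)
    regroup : ∀ n r b → (1ℤ + n) * b ≡ (1ℤ + n - r) * b + r * b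
    regroup = solve-∀
    regroup′ : ∀ n r b c → (1ℤ + n - r) * b + (n - r + 1ℤ) * c ≡ (1ℤ + n - r) * (b + c)
    regroup′ = solve-∀

-- The pairing of even with odd polynomials as a hypergeometric kernel.

module Kernel where
  open import Data.Nat.Base as ℕ using (ℕ; suc)
  import Data.Nat.Properties as ℕ
  open import Data.Integer.Base using (ℤ; +_; 1ℤ; _+_; _*_; _-_; -_)
  open import Data.Integer.Properties
  open import Data.Integer.Tactic.RingSolver using (solve-∀)
  open Binomials

  centre : ℕ → ℕ → ℤ
  centre i j = + j + + suc j - + i

  -- The value of B(w^i, x^j (1+x)^{j+1}), see `B-cross`; by `B-cross′` it is half of B(w^i, (1 +
  -- 2x) w^j).
  cross : ℕ → ℕ → ℤ
  cross i j = binDiff (i ℕ.+ suc j) (centre i j) + binDiff (i ℕ.+ j) (+ suc j + + j - + i)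

  -- The same pairing for w^i (w - 2). The factor w - 2 vanishes at x = 1 and x = -2, which makes
  -- these vectors orthogonal to `inf`.
  kernel : ℕ → ℕ → ℤ
  kernel i j = cross (suc i) j - (cross i j + cross i j)

  cross′ : ∀ i j → cross i j ≡ binDiff (suc (i ℕ.+ j)) (centre i j) + binDiff (i ℕ.+ j) (centre i j)
  cross′ i j = cong₂ (λ a b → binDiff a (centre i j) + binDiff (i ℕ.+ j) b)
                     (ℕ.+-suc i j) (cong (_- + i) (+-comm (+ suc j) (+ j)))

  centre-suc : ∀ i j → centre (suc i) j ≡ centre i j - 1ℤ
  centre-suc i j = shift (+ j) (+ i)
    where
    shift : ∀ j i → j + (1ℤ + j) - (1ℤ + i) ≡ j + (1ℤ + j) - i - 1ℤ
    shift = solve-∀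

  -- In the tail sums `t₀`, ..., `t₃` at r, ..., r - 3 the kernel is t₃ + 3 t₂ - 4 t₀. The
  -- coefficients sum to zero, so only differences of neighbours remain, and these are binomial
  -- coefficients.
  kernel-bin : ∀ i j → let n = suc (i ℕ.+ j); r = centre i j in
    kernel i j ≡ bin n (r - 1ℤ - 1ℤ) + + 4 * bin n (r - 1ℤ) + + 4 * bin n r
  kernel-bin i j = begin
    kernel i j
      ≡⟨ cong₂ (λ a b → a - (b + b)) (trans (cross′ (suc i) j) (cong (λ r → binDiff (2 ℕ.+ N) r + binDiff (1 ℕ.+ N) r) (centre-suc i j))) (cross′ i j) ⟩
    ((t₁ + t₂) + (t₂ + t₃)) + (t₁ + t₂) - (((t₀ + t₁) + t₀) + ((t₀ + t₁) + t₀))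
      ≡⟨ regroup t₀ t₁ t₂ t₃ ⟩
    (t₃ - t₂) + + 4 * (t₂ - t₁) + + 4 * (t₁ - t₀)
      ≡⟨ cong₂ _+_ (cong₂ (λ a b → a + + 4 * b) (binDiff-pred N (r - 1ℤ - 1ℤ)) (binDiff-pred N (r - 1ℤ))) (cong (+ 4 *_) (binDiff-pred N r)) ⟩
    bin (suc N) (r - 1ℤ - 1ℤ) + + 4 * bin (suc N) (r - 1ℤ) + + 4 * bin (suc N) r ∎
    where
    N = i ℕ.+ j
    r = centre i j
    t₀ = binDiff N r
    t₁ = binDiff N (r - 1ℤ)
    t₂ = binDiff N (r - 1ℤ - 1ℤ)
    t₃ = binDiff N (r - 1ℤ - 1ℤ - 1ℤ)
    regroup : ∀ a b c d → ((b + c) + (c + d)) + (b + c) - (((a + b) + a) + ((a + b) + a))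
                        ≡ (d - c) + + 4 * (c - b) + + 4 * (b - a)
    regroup = solve-∀

  bin-lift₁₁ : ∀ N r → (+ 2 + + N) * ((1ℤ + + N) * bin N (r - 1ℤ - 1ℤ)) ≡ r * (r - 1ℤ) * bin (2 ℕ.+ N) r
  bin-lift₁₁ N r = begin
    (+ 2 + + N) * ((1ℤ + + N) * bin N (r - 1ℤ - 1ℤ)) ≡⟨ cong ((+ 2 + + N) *_) (bin-lift₁ N (r - 1ℤ)) ⟩
    (+ 2 + + N) * ((r - 1ℤ) * bin (suc N) (r - 1ℤ))  ≡⟨ swap (+ 2 + + N) (r - 1ℤ) _ ⟩
    (r - 1ℤ) * ((+ 2 + + N) * bin (suc N) (r - 1ℤ))  ≡⟨ cong ((r - 1ℤ) *_) (bin-lift₁ (suc N) r) ⟩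
    (r - 1ℤ) * (r * bin (2 ℕ.+ N) r)                  ≡⟨ swap′ (r - 1ℤ) r _ ⟩
    r * (r - 1ℤ) * bin (2 ℕ.+ N) r ∎
    where
    swap : ∀ a b c → a * (b * c) ≡ b * (a * c)
    swap = solve-∀
    swap′ : ∀ a b c → a * (b * c) ≡ b * a * c
    swap′ = solve-∀

  bin-lift₁₀ : ∀ N r → (+ 2 + + N) * ((1ℤ + + N) * bin N (r - 1ℤ)) ≡ r * (+ 2 + + N - r) * bin (2 ℕ.+ N) r
  bin-lift₁₀ N r = begin
    (+ 2 + + N) * ((1ℤ + + N) * bin N (r - 1ℤ)) ≡⟨ cong ((+ 2 + + N) *_) (bin-lift₁ N r) ⟩
    (+ 2 + + N) * (r * bin (suc N) r)            ≡⟨ swap (+ 2 + + N) r _ ⟩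
    r * ((+ 2 + + N) * bin (suc N) r)            ≡⟨ cong (r *_) (bin-lift₀ (suc N) r) ⟩
    r * ((+ 2 + + N - r) * bin (2 ℕ.+ N) r)      ≡⟨ sym (*-assoc r _ _) ⟩
    r * (+ 2 + + N - r) * bin (2 ℕ.+ N) r ∎
    where
    swap : ∀ a b c → a * (b * c) ≡ b * (a * c)
    swap = solve-∀

  bin-lift₀₀ : ∀ N r → (+ 2 + + N) * ((1ℤ + + N) * bin N r) ≡ (+ 2 + + N - r) * (1ℤ + + N - r) * bin (2 ℕ.+ N) r
  bin-lift₀₀ N r = begin
    (+ 2 + + N) * ((1ℤ + + N) * bin N r)                       ≡⟨ cong ((+ 2 + + N) *_) (bin-lift₀ N r) ⟩
    (+ 2 + + N) * ((1ℤ + + N - r) * bin (suc N) r)             ≡⟨ swap (+ 2 + + N) (1ℤ + + N - r) _ ⟩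
    (1ℤ + + N - r) * ((+ 2 + + N) * bin (suc N) r)             ≡⟨ cong ((1ℤ + + N - r) *_) (bin-lift₀ (suc N) r) ⟩
    (1ℤ + + N - r) * ((+ 2 + + N - r) * bin (2 ℕ.+ N) r)       ≡⟨ swap′ (1ℤ + + N - r) (+ 2 + + N - r) _ ⟩
    (+ 2 + + N - r) * (1ℤ + + N - r) * bin (2 ℕ.+ N) r ∎
    where
    swap : ∀ a b c → a * (b * c) ≡ b * (a * c)
    swap = solve-∀
    swap′ : ∀ a b c → a * (b * c) ≡ b * a * c
    swap′ = solve-∀

  -- All three binomial coefficients are raised to C(i + j + 3, r). The kernel is therefore
  -- hypergeometric in i and in j, as creative telescoping requires.
  kernel-closed : ∀ i j → (+ 3 + + (i ℕ.+ j)) * ((+ 2 + + (i ℕ.+ j)) * kernel i j)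
    ≡ ((+ i + 1ℤ) * (+ 9 * + i + + 14) + + 2 * (+ j + 1ℤ)) * bin (3 ℕ.+ (i ℕ.+ j)) (centre i j)
  kernel-closed i j = begin
    M * (L * kernel i j)
      ≡⟨ cong (λ k → M * (L * k)) (kernel-bin i j) ⟩
    M * (L * (b₂ + + 4 * b₁ + + 4 * b₀))
      ≡⟨ distribute M L b₀ b₁ b₂ ⟩
    M * (L * b₂) + + 4 * (M * (L * b₁)) + + 4 * (M * (L * b₀))
      ≡⟨ cong₂ _+_ (cong₂ (λ x y → x + + 4 * y) (bin-lift₁₁ (suc N) r) (bin-lift₁₀ (suc N) r)) (cong (+ 4 *_) (bin-lift₀₀ (suc N) r)) ⟩
    r * (r - 1ℤ) * W + + 4 * (r * (M - r) * W) + + 4 * ((M - r) * (L - r) * W)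
      ≡⟨ collect (+ i) (+ j) W ⟩
    ((+ i + 1ℤ) * (+ 9 * + i + + 14) + + 2 * (+ j + 1ℤ)) * W ∎
    where
    N = i ℕ.+ j
    r = centre i j
    M = + 3 + + N
    L = + 2 + + N
    W = bin (3 ℕ.+ N) r
    b₀ = bin (suc N) r
    b₁ = bin (suc N) (r - 1ℤ)
    b₂ = bin (suc N) (r - 1ℤ - 1ℤ)
    distribute : ∀ m l a b c → m * (l * (c + + 4 * b + + 4 * a)) ≡ m * (l * c) + + 4 * (m * (l * b)) + + 4 * (m * (l * a))
    distribute = solve-∀
    collect : ∀ i j w → let r = j + (1ℤ + j) - i; m = + 3 + (i + j); l = + 2 + (i + j) in
      r * (r - 1ℤ) * w + + 4 * (r * (m - r) * w) + + 4 * ((m - r) * (l - r) * w)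
      ≡ ((i + 1ℤ) * (+ 9 * i + + 14) + + 2 * (j + 1ℤ)) * w
    collect = solve-∀

-- Polynomial certificates, checked by comparing normal forms.

module Certificate where
  open import Data.Nat.Base as ℕ using (ℕ)
  open import Data.Fin.Base using (zero; suc)
  open import Data.Integer.Base using (ℤ; +_; 0ℤ; 1ℤ; _+_; _*_; _-_; -_)
  open import Data.Integer.Solver using (module +-*-Solver)
  open import Data.Maybe.Base using (is-just; just)
  open import Data.Vec.Base using ([]; _∷_)

  open +-*-Solver using (Polynomial; con; var; _:+_; _:*_; _:-_; ⟦_⟧; normalise; _≟N_; ⟦_⟧N-cong; correct)

  -- Closed normal forms are compared by evaluation; comparing their denotations at variables, as the
  -- solver of the library does, is far too slow for the certificates below.
  byNormalForm : ∀ {n} (p q : Polynomial n) → T (is-just (normalise p ≟N normalise q)) →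
                 ∀ ρ → ⟦ p ⟧ ρ ≡ ⟦ q ⟧ ρ
  byNormalForm p q _ ρ with normalise p ≟N normalise q
  ... | just eq = trans (sym (correct p ρ)) (trans (⟦ eq ⟧N-cong ρ) (correct q ρ))

  -- The formulas are stated once for integers and for their reifications.
  module Formulas (A : Set) (# : ℕ → A) (plus times minus : A → A → A) where
    infixl 6 _⊕_ _⊝_
    infixl 7 _⊗_
    _⊕_ _⊗_ _⊝_ : A → A → A
    _⊕_ = plus
    _⊗_ = times
    _⊝_ = minus

    #⁻ : ℕ → A
    #⁻ k = # 0 ⊝ # k

    kernelFactor : A → A → A
    kernelFactor i j = (i ⊕ # 1) ⊗ (# 9 ⊗ i ⊕ # 14) ⊕ # 2 ⊗ (j ⊕ # 1)

    -- num / den is the ratio of consecutive coefficients of the orthogonal polynomial of either parity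
    -- (up to the factor i + 1, resp. evenFactor).
    oddNum oddDen : A → A → A
    oddNum m i = # 2 ⊗ i ⊗ (# 2 ⊗ i ⊕ # 5) ⊝ m
    oddDen m i = m ⊝ i ⊗ (i ⊕ # 5)

    evenNum evenDen : A → A → A
    evenNum m j = (# 2 ⊗ j ⊕ # 2) ⊗ (# 2 ⊗ j ⊕ # 1) ⊝ m
    evenDen m j = m ⊝ (j ⊕ # 2) ⊗ (j ⊕ # 3)

    evenFactor : A → A → A
    evenFactor m j = (# 3 ⊗ j ⊕ # 4) ⊗ m ⊝ (j ⊕ # 1) ⊗ (# 9 ⊗ j ⊗ j ⊕ # 20 ⊗ j ⊕ # 8)

    -- The coefficients of the first-order recurrences α S = β S⁺ of the pairings, found by
    -- Zeilberger's algorithm; Y is the corresponding rational certificate.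
    oddQuadric oddα oddβ : A → A → A
    oddQuadric m j = # 2 ⊗ j ⊗ j ⊕ (# 3 ⊗ m ⊕ # 22) ⊗ j ⊕ # 5 ⊗ m ⊕ # 32
    oddα m j = (m ⊕ # 6 ⊝ j ⊗ (j ⊕ # 1)) ⊗ oddQuadric m (# 1 ⊕ j)
    oddβ m j = ((# 2 ⊗ j ⊕ # 2) ⊗ (# 2 ⊗ j ⊕ # 7) ⊝ m) ⊗ oddQuadric m j

    evenQuadric evenα evenβ : A → A → A
    evenQuadric m i = # 3 ⊗ (i ⊕ # 1) ⊗ (i ⊕ # 2) ⊝ m
    evenα m i = (m ⊝ i ⊗ (i ⊕ # 1)) ⊗ (# 3 ⊗ i ⊕ # 7) ⊗ evenQuadric m (# 1 ⊕ i)
    evenβ m i = ((# 2 ⊗ i ⊕ # 5) ⊗ (# 2 ⊗ i ⊕ # 6) ⊝ m) ⊗ (# 3 ⊗ i ⊕ # 4) ⊗ evenQuadric m i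

    oddY evenY : A → A → A → A
    oddY m i j =
      ((((#⁻ 6 ⊗ i ⊕ #⁻ 2) ⊗ j ⊕ (((#⁻ 27 ⊗ i ⊕ #⁻ 42) ⊗ i ⊕ #⁻ 29) ⊗ i ⊕ #⁻ 2)) ⊗ j ⊕ (((#⁻ 54 ⊗ i ⊕ #⁻
      90) ⊗ i ⊕ #⁻ 44) ⊗ i)) ⊗ m ⊕ ((((#⁻ 12 ⊗ i ⊕ #⁻ 4) ⊗ j ⊕ (((#⁻ 18 ⊗ i ⊕ #⁻ 20) ⊗ i ⊕ #⁻ 90) ⊗ i ⊕ #⁻
      24)) ⊗ j ⊕ (((#⁻ 206 ⊗ i ⊕ #⁻ 296) ⊗ i ⊕ #⁻ 246) ⊗ i ⊕ #⁻ 20)) ⊗ j ⊕ (((#⁻ 348 ⊗ i ⊕ #⁻ 564) ⊗ i ⊕ #⁻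
      296) ⊗ i)))
    evenY m i j =
      (((((# 18 ⊗ i ⊕ # 30) ⊗ j ⊕ (((# 81 ⊗ i ⊕ # 450) ⊗ i ⊕ # 807) ⊗ i ⊕ # 458)) ⊗ j ⊕ (((# 54 ⊗ i ⊕ #
      318) ⊗ i ⊕ # 608) ⊗ i ⊕ # 376)) ⊗ m ⊕ (((((#⁻ 54 ⊗ i ⊕ #⁻ 90) ⊗ j ⊕ (((#⁻ 243 ⊗ i ⊕ #⁻ 1350) ⊗ i ⊕ #⁻
      2511) ⊗ i ⊕ #⁻ 1524)) ⊗ j ⊕ (((#⁻ 513 ⊗ i ⊕ #⁻ 2904) ⊗ i ⊕ #⁻ 5385) ⊗ i ⊕ #⁻ 3222)) ⊗ j ⊕ (((((#⁻ 243
      ⊗ i ⊕ #⁻ 2403) ⊗ i ⊕ #⁻ 9699) ⊗ i ⊕ #⁻ 19843) ⊗ i ⊕ #⁻ 20348) ⊗ i ⊕ #⁻ 8236)) ⊗ j ⊕ (((((#⁻ 162 ⊗ i ⊕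
      #⁻ 1656) ⊗ i ⊕ #⁻ 6802) ⊗ i ⊕ #⁻ 14020) ⊗ i ⊕ #⁻ 14456) ⊗ i ⊕ #⁻ 5936))) ⊗ m ⊕ (((((((#⁻ 162 ⊗ i ⊕ #⁻
      900) ⊗ i ⊕ #⁻ 1518) ⊗ i ⊕ #⁻ 748) ⊗ j ⊕ (((((# 729 ⊗ i ⊕ # 7209) ⊗ i ⊕ # 27369) ⊗ i ⊕ # 49611) ⊗ i ⊕
      # 42746) ⊗ i ⊕ # 13960)) ⊗ j ⊕ (((((# 1377 ⊗ i ⊕ # 13635) ⊗ i ⊕ # 52347) ⊗ i ⊕ # 97089) ⊗ i ⊕ #
      86652) ⊗ i ⊕ # 29620)) ⊗ j ⊕ ((((((#⁻ 324 ⊗ i ⊕ #⁻ 3186) ⊗ i ⊕ #⁻ 12156) ⊗ i ⊕ #⁻ 22378) ⊗ i ⊕ #⁻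
      19572) ⊗ i ⊕ #⁻ 5992) ⊗ i ⊕ # 560)) ⊗ j ⊕ ((((((#⁻ 216 ⊗ i ⊕ #⁻ 2520) ⊗ i ⊕ #⁻ 12040) ⊗ i ⊕ #⁻ 30152)
      ⊗ i ⊕ #⁻ 41696) ⊗ i ⊕ #⁻ 30112) ⊗ i ⊕ #⁻ 8832)))

    -- The two sides of the telescoping equation after every binomial coefficient has been raised to
    -- C(i + j + 5, w) and divided out. Factors such as 5 + n - w stem from `bin-lift₀` and
    -- `bin-lift₁`.
    oddSide₁ oddSide₂ : A → A → A → A
    oddSide₁ m i j = let n = i ⊕ j; w = j ⊕ (# 1 ⊕ j) ⊝ i ⊕ # 2 in
      (# 2 ⊕ n) ⊗ (oddNum m i ⊗ oddY m (# 1 ⊕ i) j) ⊗ w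
    oddSide₂ m i j = let n = i ⊕ j; w = j ⊕ (# 1 ⊕ j) ⊝ i ⊕ # 2 in
      oddDen m (i ⊝ # 1) ⊗ oddY m i j ⊗ ((# 5 ⊕ n ⊝ w) ⊗ (# 4 ⊕ n ⊝ w))
      ⊕ (i ⊕ # 1) ⊗ (oddα m j ⊗ kernelFactor i j ⊗ (w ⊗ (w ⊝ # 1))
                       ⊝ oddβ m j ⊗ (# 2 ⊕ n) ⊗ kernelFactor i (# 1 ⊕ j) ⊗ (# 5 ⊕ n ⊝ w))

    evenSide₁ evenSide₂ : A → A → A → A
    evenSide₁ m i j = let n = i ⊕ j; w = j ⊕ (# 1 ⊕ j) ⊝ i in
      (# 2 ⊕ n) ⊗ (evenNum m j ⊗ evenY m i (# 1 ⊕ j)) ⊗ (# 5 ⊕ n ⊝ w)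
    evenSide₂ m i j = let n = i ⊕ j; w = j ⊕ (# 1 ⊕ j) ⊝ i in
      evenDen m (j ⊝ # 1) ⊗ evenY m i j ⊗ (w ⊗ (w ⊝ # 1))
      ⊕ evenFactor m j ⊗ (evenα m i ⊗ kernelFactor i j ⊗ ((# 5 ⊕ n ⊝ w) ⊗ (# 4 ⊕ n ⊝ w))
                           ⊝ evenβ m i ⊗ (# 2 ⊕ n) ⊗ kernelFactor (# 1 ⊕ i) j ⊗ w)

    -- The value of m for which `oddNum m n`, respectively `evenNum m n`, is zero; it makes the
    -- coefficient sequence stop after index n.
    oddParameter evenParameter : A → A
    oddParameter n = # 4 ⊗ n ⊗ n ⊕ # 10 ⊗ n
    evenParameter n = (# 2 ⊗ n ⊕ # 2) ⊗ (# 2 ⊗ n ⊕ # 1)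

    growth₁ growth₂ : A → A
    growth₁ x = # 4 ⊗ (# 2 ⊗ x ⊕ # 1) ⊗ (# 2 ⊗ x ⊕ # 3)
    growth₂ x = # 3 ⊗ (# 3 ⊗ x ⊕ # 1) ⊗ (# 3 ⊗ x ⊕ # 5)

    -- The coefficients of `related` in `oddToEven` and `evenToOdd`: what two evaluations of one
    -- pairing leave after the unknown values are eliminated.
    oddToEven₁ oddToEven₂ evenToOdd₁ evenToOdd₂ : A → A
    oddToEven₁ n = let μ = oddParameter n; κ = evenParameter (# 1 ⊕ n) in
      (# 0 ⊝ oddβ μ n) ⊗ evenNum κ n ⊗ evenFactor κ (# 1 ⊕ n)
    oddToEven₂ n = let μ = oddParameter n; κ = evenParameter (# 1 ⊕ n) in
      evenDen κ n ⊗ evenFactor κ n ⊗ oddβ μ n ⊕ evenNum κ n ⊗ evenFactor κ (# 1 ⊕ n) ⊗ oddα μ n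
    evenToOdd₁ k = let μ = oddParameter (# 1 ⊕ k); κ = evenParameter (# 1 ⊕ k) in
      oddNum μ k ⊗ evenβ κ k ⊗ (k ⊕ # 2)
    evenToOdd₂ k = let μ = oddParameter (# 1 ⊕ k); κ = evenParameter (# 1 ⊕ k) in
      # 0 ⊝ (oddDen μ k ⊗ (k ⊕ # 1) ⊗ evenβ κ k ⊕ oddNum μ k ⊗ (k ⊕ # 2) ⊗ evenα κ k)

  open Formulas ℤ (λ k → + k) _+_ _*_ _-_ public
  private
    module Reified = Formulas (Polynomial 3) (λ k → con (+ k)) _:+_ _:*_ _:-_
    v₀ v₁ v₂ : Polynomial 3
    v₀ = var zero
    v₁ = var (suc zero)
    v₂ = var (suc (suc zero))

  odd-certificate : ∀ m i j → oddSide₁ m i j ≡ oddSide₂ m i j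
  odd-certificate m i j =
    byNormalForm (Reified.oddSide₁ v₀ v₁ v₂) (Reified.oddSide₂ v₀ v₁ v₂) _ (m ∷ i ∷ j ∷ [])

  even-certificate : ∀ m i j → evenSide₁ m i j ≡ evenSide₂ m i j
  even-certificate m i j =
    byNormalForm (Reified.evenSide₁ v₀ v₁ v₂) (Reified.evenSide₂ v₀ v₁ v₂) _ (m ∷ i ∷ j ∷ [])

  oddY-0-0 : ∀ m → oddY m 0ℤ 0ℤ ≡ 0ℤ
  oddY-0-0 m = byNormalForm (Reified.oddY v₀ (con 0ℤ) (con 0ℤ)) (con 0ℤ) _ (m ∷ 0ℤ ∷ 0ℤ ∷ [])

  -- Here the constants of the recurrence for N arise: the quotient of two polynomials of high
  -- degree reduces to `growth₂` over `growth₁`.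
  oddToEven-certificate : ∀ n → growth₁ (+ 2 * n + + 2) * oddToEven₂ n ≡ growth₂ (+ 2 * n + + 2) * oddToEven₁ n
  oddToEven-certificate n = byNormalForm
    (Reified.growth₁ (con (+ 2) :* v₀ :+ con (+ 2)) :* Reified.oddToEven₂ v₀)
    (Reified.growth₂ (con (+ 2) :* v₀ :+ con (+ 2)) :* Reified.oddToEven₁ v₀) _ (n ∷ 0ℤ ∷ 0ℤ ∷ [])

  evenToOdd-certificate : ∀ k → growth₁ (+ 2 * k + + 3) * evenToOdd₂ k ≡ growth₂ (+ 2 * k + + 3) * evenToOdd₁ k
  evenToOdd-certificate k = byNormalForm
    (Reified.growth₁ (con (+ 2) :* v₀ :+ con (+ 3)) :* Reified.evenToOdd₂ v₀)
    (Reified.growth₂ (con (+ 2) :* v₀ :+ con (+ 3)) :* Reified.evenToOdd₁ v₀) _ (k ∷ 0ℤ ∷ 0ℤ ∷ [])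

  -- The inductive step of `gosper`, with p for t_0 and t for t_j 2^j.
  gosper-certificate : ∀ m j p t →
    + 2 * (m - + 2) * p - (+ 3 * j + + 2) * evenDen m (j - 1ℤ) * t + + 3 * (evenFactor m j * t)
    ≡ + 2 * (m - + 2) * p - (+ 3 * (1ℤ + j) + + 2) * + 2 * (evenNum m j * t)
  gosper-certificate m j p t = byNormalForm
    (con (+ 2) :* (m′ :- con (+ 2)) :* p′ :- (con (+ 3) :* j′ :+ con (+ 2)) :* F.evenDen m′ (j′ :- con 1ℤ) :* t′ :+ con (+ 3) :* (F.evenFactor m′ j′ :* t′))
    (con (+ 2) :* (m′ :- con (+ 2)) :* p′ :- (con (+ 3) :* (con 1ℤ :+ j′) :+ con (+ 2)) :* con (+ 2) :* (F.evenNum m′ j′ :* t′)) _ (m ∷ j ∷ p ∷ t ∷ [])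
    where
    module F = Formulas (Polynomial 4) (λ k → con (+ k)) _:+_ _:*_ _:-_
    m′ j′ p′ t′ : Polynomial 4
    m′ = var zero
    j′ = var (suc zero)
    p′ = var (suc (suc zero))
    t′ = var (suc (suc (suc zero)))

-- Finite sums and the telescoping induction.

module Telescoping where
  open import Data.Nat.Base as ℕ using (ℕ; zero; suc)
  import Data.Nat.Properties as ℕ
  open import Data.Integer.Base using (ℤ; +_; -[1+_]; 0ℤ; 1ℤ; -1ℤ; _+_; _*_; _-_; -_)
  open import Data.Integer.Properties
  open import Data.Integer.Tactic.RingSolver using (solve-∀)
  open Binomials
  open Kernel
  open Certificate

  ∑ : ℕ → (ℕ → ℤ) → ℤ
  ∑ zero    f = 0ℤ
  ∑ (suc n) f = ∑ n f + f n

  ∑-cong : ∀ n {f g : ℕ → ℤ} → (∀ i → i ℕ.< n → f i ≡ g i) → ∑ n f ≡ ∑ n g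
  ∑-cong zero    eq = refl
  ∑-cong (suc n) eq = cong₂ _+_ (∑-cong n (λ i i<n → eq i (ℕ.m≤n⇒m≤1+n i<n))) (eq n ℕ.≤-refl)

  ∑-zero : ∀ n {f : ℕ → ℤ} → (∀ i → i ℕ.< n → f i ≡ 0ℤ) → ∑ n f ≡ 0ℤ
  ∑-zero zero    eq = refl
  ∑-zero (suc n) eq = cong₂ _+_ (∑-zero n (λ i i<n → eq i (ℕ.m≤n⇒m≤1+n i<n))) (eq n ℕ.≤-refl)

  ∑-+ : ∀ n f g → ∑ n (λ i → f i + g i) ≡ ∑ n f + ∑ n g
  ∑-+ zero    f g = refl
  ∑-+ (suc n) f g = trans (cong (_+ (f n + g n)) (∑-+ n f g)) (regroup (∑ n f) (∑ n g) (f n) (g n))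
    where
    regroup : ∀ a b c d → a + b + (c + d) ≡ a + c + (b + d)
    regroup = solve-∀

  ∑-* : ∀ n c f → ∑ n (λ i → c * f i) ≡ c * ∑ n f
  ∑-* zero    c f = sym (*-zeroʳ c)
  ∑-* (suc n) c f = trans (cong (_+ c * f n) (∑-* n c f)) (sym (*-distribˡ-+ c (∑ n f) (f n)))

  ∑-swap : ∀ n k (f : ℕ → ℕ → ℤ) → ∑ n (λ i → ∑ k (f i)) ≡ ∑ k (λ j → ∑ n (λ i → f i j))
  ∑-swap zero    k f = sym (∑-zero k (λ _ _ → refl))
  ∑-swap (suc n) k f = trans (cong (_+ ∑ k (f n)) (∑-swap n k f)) (sym (∑-+ k (λ j → ∑ n (λ i → f i j)) (f n)))

  -- The induction step common to both parities. To a partial sum Σ one term u h (α A - β A′) is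
  -- added, where A and A′ are neighbouring kernel values. The binomial coefficients x, y, z, c are
  -- all expressed through C(N + 5, v), after which only the polynomial identity `cert` is left; the
  -- factor D L introduced for this is cancelled.
  telescope-step : ∀ N {Σ a z A A′ x y v α β p p′ cx cy cz cv u u′ h num den Y} →
    let D = + 5 + + N; E = + 4 + + N; M = + 3 + + N; L = + 2 + + N in
    M * (L * Σ) ≡ u * a * z →
    M * (L * A) ≡ p * x → E * (M * A′) ≡ p′ * y →
    D * (E * x) ≡ cx * bin (5 ℕ.+ N) v → D * y ≡ cy * bin (5 ℕ.+ N) v →
    D * (E * z) ≡ cz * bin (5 ℕ.+ N) v → ∀ {c} → D * c ≡ cv * bin (5 ℕ.+ N) v →
    den * u′ ≡ num * u →
    L * (num * Y) * cv ≡ a * cz + h * (α * p * cx - β * L * p′ * cy) →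
    E * (M * (Σ + u * h * (α * A - β * A′))) ≡ u′ * (den * Y) * c
  telescope-step N {Σ} {a} {z} {A} {A′} {x} {y} {v} {α} {β} {p} {p′} {cx} {cy} {cz} {cv} {u} {u′} {h} {num} {den} {Y}
    eΣ eA eA′ ex ey ez {c} ec eu cert =
    *-cancelˡ-≡ (+ suc (suc N)) _ _ (*-cancelˡ-≡ (+ suc (suc (suc (suc (suc N))))) _ _ (begin
      D * (L * (E * (M * (Σ + u * h * (α * A - β * A′)))))
        ≡⟨ expand D E M L Σ u h α A β A′ ⟩
      D * E * (M * (L * Σ)) + u * h * (α * D * E * (M * (L * A)) - β * L * D * (E * (M * A′)))
        ≡⟨ cong₂ (λ s t → D * E * s + u * h * t) eΣ (cong₂ (λ s t → α * D * E * s - β * L * D * t) eA eA′) ⟩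
      D * E * (u * a * z) + u * h * (α * D * E * (p * x) - β * L * D * (p′ * y))
        ≡⟨ expand′ D E L z u a h α p x β p′ y ⟩
      u * a * (D * (E * z)) + u * h * (α * p * (D * (E * x)) - β * L * p′ * (D * y))
        ≡⟨ cong₂ (λ s t → u * a * s + u * h * t) ez (cong₂ (λ s t → α * p * s - β * L * p′ * t) ex ey) ⟩
      u * a * (cz * W) + u * h * (α * p * (cx * W) - β * L * p′ * (cy * W))
        ≡⟨ collect L W u a cz h α p cx β p′ cy ⟩
      u * W * (a * cz + h * (α * p * cx - β * L * p′ * cy))
        ≡⟨ cong (u * W *_) (sym cert) ⟩
      u * W * (L * (num * Y) * cv)
        ≡⟨ permute u W L num Y cv ⟩
      num * u * (L * Y * (cv * W))
        ≡⟨ cong₂ (λ s t → s * (L * Y * t)) (sym eu) (sym ec) ⟩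
      den * u′ * (L * Y * (D * c))
        ≡⟨ permute′ den u′ L Y D c ⟩
      D * (L * (u′ * (den * Y) * c)) ∎))
    where
    D = + 5 + + N
    E = + 4 + + N
    M = + 3 + + N
    L = + 2 + + N
    W = bin (5 ℕ.+ N) v
    expand : ∀ D E M L Σ u h α A β A′ → D * (L * (E * (M * (Σ + u * h * (α * A - β * A′)))))
      ≡ D * E * (M * (L * Σ)) + u * h * (α * D * E * (M * (L * A)) - β * L * D * (E * (M * A′)))
    expand = solve-∀
    expand′ : ∀ D E L z u a h α p x β p′ y →
      D * E * (u * a * z) + u * h * (α * D * E * (p * x) - β * L * D * (p′ * y))
      ≡ u * a * (D * (E * z)) + u * h * (α * p * (D * (E * x)) - β * L * p′ * (D * y))
    expand′ = solve-∀
    collect : ∀ L W u a cz h α p cx β p′ cy →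
      u * a * (cz * W) + u * h * (α * p * (cx * W) - β * L * p′ * (cy * W))
      ≡ u * W * (a * cz + h * (α * p * cx - β * L * p′ * cy))
    collect = solve-∀
    permute : ∀ u W L num Y cv → u * W * (L * (num * Y) * cv) ≡ num * u * (L * Y * (cv * W))
    permute = solve-∀
    permute′ : ∀ den u′ L Y D c → den * u′ * (L * Y * (D * c)) ≡ D * (L * (u′ * (den * Y) * c))
    permute′ = solve-∀

  bin-cong : ∀ {N N′ r r′} → N ≡ N′ → r ≡ r′ → bin N r ≡ bin N′ r′
  bin-cong = cong₂ bin

  module OddSum (m : ℤ) (u : ℕ → ℤ) where

    summand : ℕ → ℕ → ℤ
    summand j i = u i * (+ i + 1ℤ) * (oddα m (+ j) * kernel i j - oddβ m (+ j) * kernel i (suc j))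

    -- Creative telescoping: the partial sums are u_n times a polynomial and a binomial coefficient,
    -- over two linear factors. Once u_n = 0 the whole sum vanishes.
    partial : ∀ n → (∀ i → i ℕ.< n → oddDen m (+ i) * u (suc i) ≡ oddNum m (+ i) * u i) → ∀ j →
      (+ 3 + + (n ℕ.+ j)) * ((+ 2 + + (n ℕ.+ j)) * ∑ n (summand j))
      ≡ u n * (oddDen m (+ n - 1ℤ) * oddY m (+ n) (+ j)) * bin (3 ℕ.+ (n ℕ.+ j)) (centre n j + + 2)
    -- The closed form has to vanish at n = 0: for j = 0 by `oddY-0-0`, for j > 0 because C(j + 3,
    -- 2j + 3) is zero.
    partial zero rec j = trans (trans (cong ((+ 3 + + j) *_) (*-zeroʳ (+ 2 + + j))) (*-zeroʳ (+ 3 + + j))) (sym (vanish j))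
      where
      vanish : ∀ j → u 0 * (oddDen m -1ℤ * oddY m 0ℤ (+ j)) * bin (3 ℕ.+ j) (centre 0 j + + 2) ≡ 0ℤ
      vanish zero = trans (cong (λ t → u 0 * (oddDen m -1ℤ * t) * bin 3 (+ 3)) (oddY-0-0 m)) (annihilate (u 0) (oddDen m -1ℤ) (bin 3 (+ 3)))
        where
        annihilate : ∀ a b c → a * (b * 0ℤ) * c ≡ 0ℤ
        annihilate = solve-∀
      vanish (suc k) = trans (cong (λ t → u 0 * (oddDen m -1ℤ * oddY m 0ℤ (+ suc k)) * t)
        (trans (bin-cong {3 ℕ.+ suc k} refl (shift (+ k))) (bin-high (3 ℕ.+ suc k) k))) (*-zeroʳ (u 0 * (oddDen m -1ℤ * oddY m 0ℤ (+ suc k))))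
        where
        shift : ∀ k → (1ℤ + k) + (1ℤ + (1ℤ + k)) - 0ℤ + + 2 ≡ + 3 + ((1ℤ + k) + (1ℤ + k))
        shift = solve-∀
    partial (suc n) rec j =
      telescope-step N {v = w} {α = oddα m (+ j)} {β = oddβ m (+ j)}
        {cx = w * (w - 1ℤ)} {cy = + 5 + + N - w} {cz = (+ 5 + + N - w) * (+ 4 + + N - w)} {cv = w}
        {num = oddNum m (+ n)} {den = oddDen m (+ n)} {Y = oddY m (+ suc n) (+ j)}
        (partial n (λ i i<n → rec i (ℕ.m≤n⇒m≤1+n i<n)) j)
        (kernel-closed n j)
        (subst (λ k → (+ 3 + + k) * ((+ 2 + + k) * kernel n (suc j)) ≡ kernelFactor (+ n) (+ suc j) * bin (3 ℕ.+ k) (centre n (suc j))) (ℕ.+-suc n j) (kernel-closed n (suc j)))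
        (trans (cong (λ r → (+ 5 + + N) * ((+ 4 + + N) * bin (3 ℕ.+ N) r)) (shift₁ (centre n j))) (bin-lift₁₁ (3 ℕ.+ N) w))
        (trans (cong (λ r → (+ 5 + + N) * bin (4 ℕ.+ N) r) (shift₂ (+ n) (+ j))) (bin-lift₀ (4 ℕ.+ N) w))
        (bin-lift₀₀ (3 ℕ.+ N) w)
        (trans (cong (λ r → (+ 5 + + N) * bin (4 ℕ.+ N) r) (shift₃ (+ n) (+ j))) (bin-lift₁ (4 ℕ.+ N) w))
        (rec n ℕ.≤-refl)
        (odd-certificate m (+ n) (+ j))
      where
      N = n ℕ.+ j
      w = centre n j + + 2
      shift₁ : ∀ c → c ≡ c + + 2 - 1ℤ - 1ℤ
      shift₁ = solve-∀
      shift₂ : ∀ i j → (1ℤ + j) + (1ℤ + (1ℤ + j)) - i ≡ j + (1ℤ + j) - i + + 2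
      shift₂ = solve-∀
      shift₃ : ∀ i j → j + (1ℤ + j) - (1ℤ + i) + + 2 ≡ j + (1ℤ + j) - i + + 2 - 1ℤ
      shift₃ = solve-∀

  module EvenSum (m : ℤ) (t : ℕ → ℤ) where

    summand : ℕ → ℕ → ℤ
    summand i j = t j * evenFactor m (+ j) * (evenα m (+ i) * kernel i j - evenβ m (+ i) * kernel (suc i) j)

    partial : ∀ n → (∀ j → j ℕ.< n → evenDen m (+ j) * t (suc j) ≡ evenNum m (+ j) * t j) → ∀ i →
      (+ 3 + + (i ℕ.+ n)) * ((+ 2 + + (i ℕ.+ n)) * ∑ n (summand i))
      ≡ t n * (evenDen m (+ n - 1ℤ) * evenY m (+ i) (+ n)) * bin (3 ℕ.+ (i ℕ.+ n)) (centre i n - 1ℤ - 1ℤ)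
    -- At n = 0 the binomial coefficient is C(i + 3, -1 - i), which is zero.
    partial zero rec i = trans (trans (cong ((+ 3 + + (i ℕ.+ 0)) *_) (*-zeroʳ (+ 2 + + (i ℕ.+ 0)))) (*-zeroʳ (+ 3 + + (i ℕ.+ 0))))
      (sym (trans (cong (λ b → t 0 * (evenDen m (0ℤ - 1ℤ) * evenY m (+ i) 0ℤ) * b)
             (trans (bin-cong {3 ℕ.+ (i ℕ.+ 0)} refl (low i)) (bin-low (3 ℕ.+ (i ℕ.+ 0)) i)))
           (*-zeroʳ (t 0 * (evenDen m (0ℤ - 1ℤ) * evenY m (+ i) 0ℤ)))))
      where
      low : ∀ i → centre i 0 - 1ℤ - 1ℤ ≡ -[1+ i ]
      low i = shift (+ i)
        where
        shift : ∀ i → 1ℤ - i - 1ℤ - 1ℤ ≡ - (1ℤ + i)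
        shift = solve-∀
    partial (suc n) rec i = subst (λ k → (+ 3 + + k) * ((+ 2 + + k) * ∑ (suc n) (summand i))
        ≡ t (suc n) * (evenDen m (+ suc n - 1ℤ) * evenY m (+ i) (+ suc n)) * bin (3 ℕ.+ k) (centre i (suc n) - 1ℤ - 1ℤ)) (sym (ℕ.+-suc i n))
      (telescope-step N {v = w} {α = evenα m (+ i)} {β = evenβ m (+ i)}
        {cx = (+ 5 + + N - w) * (+ 4 + + N - w)} {cy = w} {cz = w * (w - 1ℤ)} {cv = + 5 + + N - w}
        {num = evenNum m (+ n)} {den = evenDen m (+ n)} {Y = evenY m (+ i) (+ suc n)}
        (partial n (λ j j<n → rec j (ℕ.m≤n⇒m≤1+n j<n)) i)
        (kernel-closed i n)
        (kernel-closed (suc i) n)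
        (bin-lift₀₀ (3 ℕ.+ N) w)
        (trans (cong (λ r → (+ 5 + + N) * bin (4 ℕ.+ N) r) (centre-suc i n)) (bin-lift₁ (4 ℕ.+ N) w))
        (bin-lift₁₁ (3 ℕ.+ N) w)
        (trans (cong (λ r → (+ 5 + + N) * bin (4 ℕ.+ N) r) (shift (+ i) (+ n))) (bin-lift₀ (4 ℕ.+ N) w))
        (rec n ℕ.≤-refl)
        (even-certificate m (+ i) (+ n)))
      where
      N = i ℕ.+ n
      w = centre i n
      shift : ∀ i j → (1ℤ + j) + (1ℤ + (1ℤ + j)) - i - 1ℤ - 1ℤ ≡ j + (1ℤ + j) - i
      shift = solve-∀

-- Terminating coefficient sequences and the vanishing of their pairings.

module Orthogonality where
  open import Data.Nat.Base as ℕ using (ℕ; zero; suc; s≤s)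
  import Data.Nat.Properties as ℕ
  open import Data.Integer.Base using (ℤ; +_; 0ℤ; 1ℤ; _+_; _*_; _-_; -_)
  open import Data.Integer.Properties
  open import Data.Integer.Tactic.RingSolver using (solve-∀)
  open Binomials
  open Kernel
  open Certificate
  open Telescoping

  -- Signs are certified by writing a quantity, with n = i + d + 1 substituted, as a polynomial with
  -- natural coefficients; the combinators follow the shape of that polynomial.
  NonNeg Pos : ℤ → Set
  NonNeg x = ∃ λ k → x ≡ + k
  Pos x = ∃ λ k → x ≡ + suc k

  nat : ∀ n → NonNeg (+ n)
  nat n = n , refl

  infixl 6 _⊞_ _⊞₊_
  infixl 7 _⊠_ _⊠₊_

  _⊞_ : ∀ {x y} → NonNeg x → NonNeg y → NonNeg (x + y)
  (a , refl) ⊞ (b , refl) = a ℕ.+ b , refl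

  _⊠_ : ∀ {x y} → NonNeg x → NonNeg y → NonNeg (x * y)
  (a , refl) ⊠ (b , refl) = a ℕ.* b , sym (pos-* a b)

  _⊞₊_ : ∀ {x y} → NonNeg x → Pos y → Pos (x + y)
  (a , refl) ⊞₊ (b , refl) = a ℕ.+ b , cong +_ (ℕ.+-suc a b)

  _⊠₊_ : ∀ {x y} → Pos x → Pos y → Pos (x * y)
  (a , refl) ⊠₊ (b , refl) = b ℕ.+ a ℕ.* suc b , refl

  pos : ∀ n → Pos (+ suc n)
  pos n = n , refl

  Pos⇒≢0 : ∀ {x} y → x ≡ y → Pos y → x ≢ 0ℤ
  Pos⇒≢0 _ refl (_ , refl) ()

  Neg⇒≢0 : ∀ {x} y → x ≡ - y → Pos y → x ≢ 0ℤ
  Neg⇒≢0 _ refl (_ , refl) ()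

  *-≢0 : ∀ x y → x ≢ 0ℤ → y ≢ 0ℤ → x * y ≢ 0ℤ
  *-≢0 x y x≢0 y≢0 xy≡0 with i*j≡0⇒i≡0∨j≡0 x xy≡0
  ... | inj₁ x≡0 = x≢0 x≡0
  ... | inj₂ y≡0 = y≢0 y≡0

  cancel-zero : ∀ {x y} → x ≢ 0ℤ → x * y ≡ 0ℤ → y ≡ 0ℤ
  cancel-zero {x} x≢0 xy≡0 with i*j≡0⇒i≡0∨j≡0 x xy≡0
  ... | inj₁ x≡0 = ⊥-elim (x≢0 x≡0)
  ... | inj₂ y≡0 = y≡0

  cancel : ∀ {x y z} → x ≢ 0ℤ → x * y ≡ x * z → y ≡ z
  cancel {x} {y} {z} x≢0 e = i-j≡0⇒i≡j y z (cancel-zero x≢0 (trans (distrib x y z) (i≡j⇒i-j≡0 e)))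
    where
    distrib : ∀ x y z → x * (y - z) ≡ x * y - x * z
    distrib = solve-∀

  zero-times : ∀ {x} → x ≡ 0ℤ → ∀ a b → x * a * b ≡ 0ℤ
  zero-times refl a b = trans (cong (_* b) (*-zeroˡ a)) (*-zeroˡ b)

  -- An integer multiple of the sequence with ratios num i / den i, for i ≤ n.
  module Weights (num den : ℕ → ℤ) (n : ℕ) (num-n : num n ≡ 0ℤ) where

    initial : ℕ → ℤ
    initial zero    = 1ℤ
    initial (suc i) = initial i * num i

    final : ℕ → ℕ → ℤ
    final i zero    = 1ℤ
    final i (suc l) = den i * final (suc i) l

    weight : ℕ → ℤ
    weight i = initial i * final i (n ℕ.∸ i)

    weight-rec : ∀ i → i ℕ.< suc n → den i * weight (suc i) ≡ num i * weight i
    weight-rec i (s≤s i≤n) with ℕ.m≤n⇒m<n∨m≡n i≤n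
    ... | inj₁ i<n = trans (regroup (den i) (initial i) (num i) (final (suc i) (n ℕ.∸ suc i)))
                           (cong (λ l → num i * (initial i * final i l)) (sym (ℕ.+-∸-assoc 1 i<n)))
      where
      regroup : ∀ d p x f → d * (p * x * f) ≡ x * (p * (d * f))
      regroup = solve-∀
    -- At i = n both sides are zero, since `num n` is zero and is a factor of `weight (suc n)`.
    ... | inj₂ refl = trans (cong (λ x → den i * (initial i * x * final (suc i) (i ℕ.∸ suc i))) num-n)
                     (trans (zeros (den i) (initial i) (final (suc i) (i ℕ.∸ suc i)) (weight i)) (cong (_* weight i) (sym num-n)))
      where
      zeros : ∀ d p f w → d * (p * 0ℤ * f) ≡ 0ℤ * w
      zeros = solve-∀

    weight-end : weight (suc n) ≡ 0ℤ
    weight-end = trans (cong (λ x → initial n * x * final (suc n) (n ℕ.∸ suc n)) num-n) (zeros (initial n) (final (suc n) (n ℕ.∸ suc n)))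
      where
      zeros : ∀ p f → p * 0ℤ * f ≡ 0ℤ
      zeros = solve-∀

    -- The last weight is the product of the `num i` with i < n; all the `den` factors belong to
    -- earlier weights.
    weight-≢0 : (∀ i d → n ≡ suc (i ℕ.+ d) → num i ≢ 0ℤ) → weight n ≢ 0ℤ
    weight-≢0 num≢0 = subst (λ l → initial n * final n l ≢ 0ℤ) (sym (ℕ.n∸n≡0 n))
                        (*-≢0 (initial n) 1ℤ (go n 0 (sym (ℕ.+-identityʳ n))) (λ ()))
      where
      go : ∀ i d → n ≡ i ℕ.+ d → initial i ≢ 0ℤ
      go zero    d e = λ ()
      go (suc i) d e = *-≢0 (initial i) (num i) (go i (suc d) (trans e (sym (ℕ.+-suc i d)))) (num≢0 i d e)

  oddNum-end-identity : ∀ n → + 2 * n * (+ 2 * n + + 5) - (+ 4 * n * n + + 10 * n) ≡ 0ℤ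
  oddNum-end-identity = solve-∀

  oddNum-end : ∀ n → oddNum (oddParameter n) n ≡ 0ℤ
  oddNum-end = oddNum-end-identity

  oddNum-≢0-identity : ∀ i d → let n = 1ℤ + (i + d) in
    + 2 * i * (+ 2 * i + + 5) - (+ 4 * n * n + + 10 * n)
    ≡ - (+ 8 * i * d + + 8 * i + + 4 * d * d + + 18 * d + + 14)
  oddNum-≢0-identity = solve-∀

  oddNum-≢0 : ∀ i d → NonNeg i → NonNeg d → oddNum (oddParameter (1ℤ + (i + d))) i ≢ 0ℤ
  oddNum-≢0 i d i₀ d₀ = Neg⇒≢0 (+ 8 * i * d + + 8 * i + + 4 * d * d + + 18 * d + + 14) (oddNum-≢0-identity i d)
    (nat 8 ⊠ i₀ ⊠ d₀ ⊞ nat 8 ⊠ i₀ ⊞ nat 4 ⊠ d₀ ⊠ d₀ ⊞ nat 18 ⊠ d₀ ⊞₊ pos 13)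

  oddα-≢0-identity : ∀ j d → let n = 1ℤ + (j + d) in
    (+ 4 * n * n + + 10 * n) + + 6 - j * (j + 1ℤ)
    ≡ + 3 * j * j + + 17 * j + + 4 * d * d + + 18 * d + + 8 * j * d + + 20
  oddα-≢0-identity = solve-∀

  -- Allows division by α when the vanishing of `S` is passed down from j + 1 to j.
  oddα-≢0 : ∀ j d → NonNeg j → NonNeg d → oddα (oddParameter (1ℤ + (j + d))) j ≢ 0ℤ
  oddα-≢0 j d j₀ d₀ = *-≢0 (m + + 6 - j * (j + 1ℤ)) (oddQuadric m (1ℤ + j))
    (Pos⇒≢0 (+ 3 * j * j + + 17 * j + + 4 * d * d + + 18 * d + + 8 * j * d + + 20) (oddα-≢0-identity j d)
      (nat 3 ⊠ j₀ ⊠ j₀ ⊞ nat 17 ⊠ j₀ ⊞ nat 4 ⊠ d₀ ⊠ d₀ ⊞ nat 18 ⊠ d₀ ⊞ nat 8 ⊠ j₀ ⊠ d₀ ⊞₊ pos 19))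
    (Pos⇒≢0 (oddQuadric m (1ℤ + j)) refl
      (nat 2 ⊠ j₁ ⊠ j₁ ⊞ (nat 3 ⊠ m₀ ⊞ nat 22) ⊠ j₁ ⊞ nat 5 ⊠ m₀ ⊞₊ pos 31))
    where
    m = oddParameter (1ℤ + (j + d))
    j₁ : NonNeg (1ℤ + j)
    j₁ = nat 1 ⊞ j₀
    m₀ : NonNeg m
    m₀ = nat 4 ⊠ (nat 1 ⊞ (j₀ ⊞ d₀)) ⊠ (nat 1 ⊞ (j₀ ⊞ d₀)) ⊞ nat 10 ⊠ (nat 1 ⊞ (j₀ ⊞ d₀))

  oddβ-end-identity : ∀ j → (+ 2 * j + + 2) * (+ 2 * j + + 7) - (+ 4 * (1ℤ + j) * (1ℤ + j) + + 10 * (1ℤ + j)) ≡ 0ℤ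
  oddβ-end-identity = solve-∀

  -- For n = j + 1 the factor (2j + 2)(2j + 7) equals the parameter 2n (2n + 5). The recurrence for
  -- `S` breaks off here, which starts the descent in `S-vanish`.
  oddβ-end : ∀ j → oddβ (oddParameter (1ℤ + j)) j ≡ 0ℤ
  oddβ-end j = trans (cong (_* oddQuadric (oddParameter (1ℤ + j)) j) (oddβ-end-identity j))
                     (*-zeroˡ (oddQuadric (oddParameter (1ℤ + j)) j))

  evenNum-≢0-identity : ∀ j d → let n = 1ℤ + (j + d) in
    (+ 2 * j + + 2) * (+ 2 * j + 1ℤ) - (+ 2 * n + + 2) * (+ 2 * n + 1ℤ)
    ≡ - (+ 8 * j * d + + 8 * j + + 4 * d * d + + 14 * d + + 10)
  evenNum-≢0-identity = solve-∀

  evenNum-≢0 : ∀ j d → NonNeg j → NonNeg d → evenNum (evenParameter (1ℤ + (j + d))) j ≢ 0ℤ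
  evenNum-≢0 j d j₀ d₀ = Neg⇒≢0 (+ 8 * j * d + + 8 * j + + 4 * d * d + + 14 * d + + 10) (evenNum-≢0-identity j d)
    (nat 8 ⊠ j₀ ⊠ d₀ ⊞ nat 8 ⊠ j₀ ⊞ nat 4 ⊠ d₀ ⊠ d₀ ⊞ nat 14 ⊠ d₀ ⊞₊ pos 9)

  evenFactor-end-identity : ∀ n → (+ 3 * n + + 4) * ((+ 2 * n + + 2) * (+ 2 * n + 1ℤ)) - (n + 1ℤ) * (+ 9 * n * n + + 20 * n + + 8)
                   ≡ n * (n + 1ℤ) * (+ 3 * n + + 2)
  evenFactor-end-identity = solve-∀

  evenFactor-end : ∀ n → evenFactor (evenParameter n) n ≡ n * (n + 1ℤ) * (+ 3 * n + + 2)
  evenFactor-end = evenFactor-end-identity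

  evenFactor-≢0 : ∀ n → NonNeg n → Pos n → evenFactor (evenParameter n) n ≢ 0ℤ
  evenFactor-≢0 n n₀ n₊ = Pos⇒≢0 (n * (n + 1ℤ) * (+ 3 * n + + 2)) (evenFactor-end n)
    (n₊ ⊠₊ (n₀ ⊞₊ pos 0) ⊠₊ (nat 3 ⊠ n₀ ⊞₊ pos 1))

  evenα-≢0-identity₁ : ∀ i d → let n = 1ℤ + (1ℤ + (i + d)) in
    (+ 2 * n + + 2) * (+ 2 * n + 1ℤ) - i * (i + 1ℤ)
    ≡ + 3 * i * i + + 21 * i + + 4 * d * d + + 22 * d + + 8 * i * d + + 30
  evenα-≢0-identity₁ = solve-∀

  evenα-≢0-identity₂ : ∀ i d → let n = 1ℤ + (1ℤ + (i + d)); i′ = 1ℤ + i in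
    + 3 * (i′ + 1ℤ) * (i′ + + 2) - (+ 2 * n + + 2) * (+ 2 * n + 1ℤ)
    ≡ - (i * i + + 7 * i + + 4 * d * d + + 22 * d + + 8 * i * d + + 12)
  evenα-≢0-identity₂ = solve-∀

  evenα-≢0 : ∀ i d → NonNeg i → NonNeg d → evenα (evenParameter (1ℤ + (1ℤ + (i + d)))) i ≢ 0ℤ
  evenα-≢0 i d i₀ d₀ =
    *-≢0 ((m - i * (i + 1ℤ)) * (+ 3 * i + + 7)) (evenQuadric m (1ℤ + i))
      (*-≢0 (m - i * (i + 1ℤ)) (+ 3 * i + + 7)
        (Pos⇒≢0 (+ 3 * i * i + + 21 * i + + 4 * d * d + + 22 * d + + 8 * i * d + + 30) (evenα-≢0-identity₁ i d)
          (nat 3 ⊠ i₀ ⊠ i₀ ⊞ nat 21 ⊠ i₀ ⊞ nat 4 ⊠ d₀ ⊠ d₀ ⊞ nat 22 ⊠ d₀ ⊞ nat 8 ⊠ i₀ ⊠ d₀ ⊞₊ pos 29))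
        (Pos⇒≢0 (+ 3 * i + + 7) refl (nat 3 ⊠ i₀ ⊞₊ pos 6)))
      (Neg⇒≢0 (i * i + + 7 * i + + 4 * d * d + + 22 * d + + 8 * i * d + + 12) (evenα-≢0-identity₂ i d)
        (i₀ ⊠ i₀ ⊞ nat 7 ⊠ i₀ ⊞ nat 4 ⊠ d₀ ⊠ d₀ ⊞ nat 22 ⊠ d₀ ⊞ nat 8 ⊠ i₀ ⊠ d₀ ⊞₊ pos 11))
    where
    m = evenParameter (1ℤ + (1ℤ + (i + d)))

  evenβ-end-identity : ∀ i → (+ 2 * i + + 5) * (+ 2 * i + + 6) - (+ 2 * (1ℤ + (1ℤ + i)) + + 2) * (+ 2 * (1ℤ + (1ℤ + i)) + 1ℤ) ≡ 0ℤ
  evenβ-end-identity = solve-∀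

  -- The break lies one place lower than for odd m, at i = n - 2. Orthogonality to w^i for all i < n
  -- then needs one more vector besides the w^i (w - 2), namely 1; this is `S′-zero`.
  evenβ-end : ∀ i → evenβ (evenParameter (1ℤ + (1ℤ + i))) i ≡ 0ℤ
  evenβ-end i = trans (cong (λ x → x * (+ 3 * i + + 4) * evenQuadric (evenParameter (1ℤ + (1ℤ + i))) i) (evenβ-end-identity i))
                             (zero-times refl (+ 3 * i + + 4) (evenQuadric (evenParameter (1ℤ + (1ℤ + i))) i))

  module Odd (n : ℕ) where

    m : ℤ
    m = oddParameter (+ n)

    open Weights (λ i → oddNum m (+ i)) (λ i → oddDen m (+ i)) n (oddNum-end (+ n)) public
      using () renaming (weight to u; weight-rec to u-rec; weight-end to u-end; weight-≢0 to u-≢0′)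

    h : ℕ → ℤ
    h i = u i * (+ i + 1ℤ)

    -- The pairing of the even vector Σ h_i w^i (w - 2) with x^j (1+x)^{j+1}, see `ψ-S`.
    S : ℕ → ℤ
    S j = ∑ (suc n) (λ i → h i * kernel i j)

    u-≢0 : u n ≢ 0ℤ
    u-≢0 = u-≢0′ (λ i d e → subst (λ x → oddNum (oddParameter x) (+ i) ≢ 0ℤ) (sym (cong +_ e)) (oddNum-≢0 (+ i) (+ d) (nat i) (nat d)))

    h-≢0 : h n ≢ 0ℤ
    h-≢0 = *-≢0 (u n) (+ n + 1ℤ) u-≢0 (Pos⇒≢0 (+ n + 1ℤ) refl (nat n ⊞₊ pos 0))

    -- Over the full range the telescoped sum is α S_j - β S_{j+1} on one side and a multiple of
    -- `u (suc n)`, hence zero, on the other.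
    S-rec : ∀ j → oddα m (+ j) * S j ≡ oddβ m (+ j) * S (suc j)
    S-rec j = i-j≡0⇒i≡j _ _ (trans (sym split) vanish)
      where
      open OddSum m u
      vanish : ∑ (suc n) (summand j) ≡ 0ℤ
      vanish = cancel-zero {+ 2 + + (suc n ℕ.+ j)} (λ ()) (cancel-zero {+ 3 + + (suc n ℕ.+ j)} (λ ())
        (trans (partial (suc n) u-rec j)
               (zero-times u-end (oddDen m (+ suc n - 1ℤ) * oddY m (+ suc n) (+ j)) (bin (3 ℕ.+ (suc n ℕ.+ j)) (centre (suc n) j + + 2)))))
      term : ∀ h α β a b → h * (α * a - β * b) ≡ α * (h * a) + - β * (h * b)
      term = solve-∀
      minus : ∀ α β a b → α * a + - β * b ≡ α * a - β * b
      minus = solve-∀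
      split : ∑ (suc n) (summand j) ≡ oddα m (+ j) * S j - oddβ m (+ j) * S (suc j)
      split = begin
        ∑ (suc n) (summand j)
          ≡⟨ ∑-cong (suc n) (λ i _ → term (h i) (oddα m (+ j)) (oddβ m (+ j)) (kernel i j) (kernel i (suc j))) ⟩
        ∑ (suc n) (λ i → oddα m (+ j) * (h i * kernel i j) + - oddβ m (+ j) * (h i * kernel i (suc j)))
          ≡⟨ ∑-+ (suc n) (λ i → oddα m (+ j) * (h i * kernel i j)) (λ i → - oddβ m (+ j) * (h i * kernel i (suc j))) ⟩
        ∑ (suc n) (λ i → oddα m (+ j) * (h i * kernel i j)) + ∑ (suc n) (λ i → - oddβ m (+ j) * (h i * kernel i (suc j)))
          ≡⟨ cong₂ _+_ (∑-* (suc n) (oddα m (+ j)) (λ i → h i * kernel i j)) (∑-* (suc n) (- oddβ m (+ j)) (λ i → h i * kernel i (suc j))) ⟩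
        oddα m (+ j) * S j + - oddβ m (+ j) * S (suc j)
          ≡⟨ minus (oddα m (+ j)) (oddβ m (+ j)) (S j) (S (suc j)) ⟩
        oddα m (+ j) * S j - oddβ m (+ j) * S (suc j) ∎

    -- Descent in j from the zero of β at j = n - 1. The value at j = n is left open; it is the one
    -- that links N_{m+2} to N_m.
    S-vanish : ∀ d j → n ≡ suc (j ℕ.+ d) → S j ≡ 0ℤ
    S-vanish d j e = cancel-zero {oddα m (+ j)} (subst (λ x → oddα (oddParameter x) (+ j) ≢ 0ℤ) (sym (cong +_ e)) (oddα-≢0 (+ j) (+ d) (nat j) (nat d)))
                       (trans (S-rec j) (above d j e))
      where
      above : ∀ d j → n ≡ suc (j ℕ.+ d) → oddβ m (+ j) * S (suc j) ≡ 0ℤ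
      above zero j e = trans (cong (_* S (suc j)) (subst (λ x → oddβ (oddParameter x) (+ j) ≡ 0ℤ) (sym (cong +_ (trans e (cong suc (ℕ.+-identityʳ j))))) (oddβ-end (+ j))))
                             (*-zeroˡ (S (suc j)))
      above (suc d) j e = trans (cong (oddβ m (+ j) *_) (S-vanish d (suc j) (trans e (cong suc (ℕ.+-suc j d)))))
                                (*-zeroʳ (oddβ m (+ j)))

  module Even (n : ℕ) where

    m : ℤ
    m = evenParameter (+ n)

    open Weights (λ j → evenNum m (+ j)) (λ j → evenDen m (+ j)) n (i≡j⇒i-j≡0 {m} refl) public
      using () renaming (weight to t; weight-rec to t-rec; weight-end to t-end; weight-≢0 to t-≢0′)

    q : ℕ → ℤ
    q j = t j * evenFactor m (+ j)

    R : ℕ → ℤ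
    R i = ∑ (suc n) (λ j → q j * kernel i j)

    t-≢0 : t n ≢ 0ℤ
    t-≢0 = t-≢0′ (λ j d e → subst (λ x → evenNum (evenParameter x) (+ j) ≢ 0ℤ) (sym (cong +_ e)) (evenNum-≢0 (+ j) (+ d) (nat j) (nat d)))

    q-≢0 : ∀ k → n ≡ suc k → q n ≢ 0ℤ
    q-≢0 k e = *-≢0 (t n) (evenFactor m (+ n)) t-≢0 (evenFactor-≢0 (+ n) (nat n) (subst (λ x → Pos (+ x)) (sym e) (pos k)))

    R-rec : ∀ i → evenα m (+ i) * R i ≡ evenβ m (+ i) * R (suc i)
    R-rec i = i-j≡0⇒i≡j _ _ (trans (sym split) vanish)
      where
      open EvenSum m t
      vanish : ∑ (suc n) (summand i) ≡ 0ℤ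
      vanish = cancel-zero {+ 2 + + (i ℕ.+ suc n)} (λ ()) (cancel-zero {+ 3 + + (i ℕ.+ suc n)} (λ ())
        (trans (partial (suc n) t-rec i)
               (zero-times t-end (evenDen m (+ suc n - 1ℤ) * evenY m (+ i) (+ suc n)) (bin (3 ℕ.+ (i ℕ.+ suc n)) (centre i (suc n) - 1ℤ - 1ℤ)))))
      term : ∀ q α β a b → q * (α * a - β * b) ≡ α * (q * a) + - β * (q * b)
      term = solve-∀
      minus : ∀ α β a b → α * a + - β * b ≡ α * a - β * b
      minus = solve-∀
      split : ∑ (suc n) (summand i) ≡ evenα m (+ i) * R i - evenβ m (+ i) * R (suc i)
      split = begin
        ∑ (suc n) (summand i)
          ≡⟨ ∑-cong (suc n) (λ j _ → term (q j) (evenα m (+ i)) (evenβ m (+ i)) (kernel i j) (kernel (suc i) j)) ⟩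
        ∑ (suc n) (λ j → evenα m (+ i) * (q j * kernel i j) + - evenβ m (+ i) * (q j * kernel (suc i) j))
          ≡⟨ ∑-+ (suc n) (λ j → evenα m (+ i) * (q j * kernel i j)) (λ j → - evenβ m (+ i) * (q j * kernel (suc i) j)) ⟩
        ∑ (suc n) (λ j → evenα m (+ i) * (q j * kernel i j)) + ∑ (suc n) (λ j → - evenβ m (+ i) * (q j * kernel (suc i) j))
          ≡⟨ cong₂ _+_ (∑-* (suc n) (evenα m (+ i)) (λ j → q j * kernel i j)) (∑-* (suc n) (- evenβ m (+ i)) (λ j → q j * kernel (suc i) j)) ⟩
        evenα m (+ i) * R i + - evenβ m (+ i) * R (suc i)
          ≡⟨ minus (evenα m (+ i)) (evenβ m (+ i)) (R i) (R (suc i)) ⟩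
        evenα m (+ i) * R i - evenβ m (+ i) * R (suc i) ∎

    R-vanish : ∀ d i → n ≡ suc (suc (i ℕ.+ d)) → R i ≡ 0ℤ
    R-vanish d i e = cancel-zero {evenα m (+ i)} (subst (λ x → evenα (evenParameter x) (+ i) ≢ 0ℤ) (sym (cong +_ e)) (evenα-≢0 (+ i) (+ d) (nat i) (nat d)))
                       (trans (R-rec i) (above d i e))
      where
      above : ∀ d i → n ≡ suc (suc (i ℕ.+ d)) → evenβ m (+ i) * R (suc i) ≡ 0ℤ
      above zero i e = trans (cong (_* R (suc i)) (subst (λ x → evenβ (evenParameter x) (+ i) ≡ 0ℤ) (sym (cong +_ (trans e (cong (λ k → suc (suc k)) (ℕ.+-identityʳ i))))) (evenβ-end (+ i))))
                             (*-zeroˡ (R (suc i)))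
      above (suc d) i e = trans (cong (evenβ m (+ i) *_) (R-vanish d (suc i) (trans e (cong (λ k → suc (suc k)) (ℕ.+-suc i d)))))
                                (*-zeroʳ (evenβ m (+ i)))

-- Relations between the values left open by orthogonality.

module Ratios where
  open import Data.Nat.Base as ℕ using (ℕ; zero; suc; s≤s)
  import Data.Nat.Properties as ℕ
  open import Data.Integer.Base using (ℤ; +_; 0ℤ; 1ℤ; -1ℤ; _+_; _*_; _-_; -_)
  open import Data.Integer.Properties
  open import Data.Integer.Tactic.RingSolver using (solve-∀)
  open Binomials
  open Kernel
  open Certificate
  open Telescoping
  open Orthogonality

  ∑-bilinear : ∀ a b (h q : ℕ → ℤ) (k : ℕ → ℕ → ℤ) →
    ∑ a (λ i → h i * ∑ b (λ j → q j * k i j)) ≡ ∑ b (λ j → q j * ∑ a (λ i → h i * k i j))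
  ∑-bilinear a b h q k = begin
    ∑ a (λ i → h i * ∑ b (λ j → q j * k i j))
      ≡⟨ ∑-cong a (λ i _ → sym (∑-* b (h i) (λ j → q j * k i j))) ⟩
    ∑ a (λ i → ∑ b (λ j → h i * (q j * k i j)))
      ≡⟨ ∑-swap a b (λ i j → h i * (q j * k i j)) ⟩
    ∑ b (λ j → ∑ a (λ i → h i * (q j * k i j)))
      ≡⟨ ∑-cong b (λ j _ → trans (∑-cong a (λ i _ → swap (h i) (q j) (k i j))) (∑-* a (q j) (λ i → h i * k i j))) ⟩
    ∑ b (λ j → q j * ∑ a (λ i → h i * k i j)) ∎
    where
    swap : ∀ x y z → x * (y * z) ≡ y * (x * z)
    swap = solve-∀

  ∑-last : ∀ n f → (∀ i → i ℕ.< n → f i ≡ 0ℤ) → ∑ (suc n) f ≡ f n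
  ∑-last n f z = trans (cong (_+ f n) (∑-zero n z)) (+-identityˡ (f n))

  <⇒+ : ∀ {i n} → i ℕ.< n → ∃ λ d → n ≡ suc (i ℕ.+ d)
  <⇒+ {i} {n} i<n = n ℕ.∸ suc i , sym (ℕ.m+[n∸m]≡n i<n)

  module EvenPairing (n : ℕ) where
    open Even n

    -- Half the pairing of the odd vector with w^i, see `ψ-diagonal`. The term 3 · 2^{i+j} comes
    -- from the multiple of `inf` that makes the odd vector orthogonal to `om`.
    S′ : ℕ → ℤ
    S′ i = ∑ (suc n) (λ j → q j * (+ 3 * pow2 (i ℕ.+ j) - cross i j))

    -- Passing from w^i to w^i (w - 2) removes the powers of two and turns `cross` into `kernel`.
    S′-suc : ∀ i → S′ (suc i) ≡ S′ i + S′ i - R i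
    S′-suc i = begin
      ∑ (suc n) (λ j → q j * (+ 3 * (pow2 (i ℕ.+ j) + pow2 (i ℕ.+ j)) - cross (suc i) j))
        ≡⟨ ∑-cong (suc n) (λ j _ → term (q j) (pow2 (i ℕ.+ j)) (cross (suc i) j) (cross i j)) ⟩
      ∑ (suc n) (λ j → (f j + f j) + -1ℤ * (q j * kernel i j))
        ≡⟨ ∑-+ (suc n) (λ j → f j + f j) (λ j → -1ℤ * (q j * kernel i j)) ⟩
      ∑ (suc n) (λ j → f j + f j) + ∑ (suc n) (λ j → -1ℤ * (q j * kernel i j))
        ≡⟨ cong₂ _+_ (∑-+ (suc n) f f) (∑-* (suc n) -1ℤ (λ j → q j * kernel i j)) ⟩
      S′ i + S′ i + -1ℤ * R i
        ≡⟨ minus (S′ i) (R i) ⟩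
      S′ i + S′ i - R i ∎
      where
      f : ℕ → ℤ
      f j = q j * (+ 3 * pow2 (i ℕ.+ j) - cross i j)
      term : ∀ q p c′ c → q * (+ 3 * (p + p) - c′) ≡ (q * (+ 3 * p - c) + q * (+ 3 * p - c)) + -1ℤ * (q * (c′ - (c + c)))
      term = solve-∀
      minus : ∀ s r → s + s + -1ℤ * r ≡ s + s - r
      minus = solve-∀

    -- Gosper summation: q_j 2^j has a hypergeometric indefinite sum. It settles the pairing with 1,
    -- which the recurrence for `R` does not reach.
    gosper : ∀ J → J ℕ.≤ suc n → + 3 * ∑ J (λ j → q j * pow2 j)
      ≡ + 2 * (m - + 2) * t 0 - (+ 3 * + J + + 2) * evenDen m (+ J - 1ℤ) * (t J * pow2 J)
    gosper zero _ = base m (t 0)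
      where
      base : ∀ m t → + 3 * 0ℤ ≡ + 2 * (m - + 2) * t - (+ 3 * 0ℤ + + 2) * (m - (-1ℤ + + 2) * (-1ℤ + + 3)) * (t * 1ℤ)
      base = solve-∀
    gosper (suc J) J<n+1 = begin
      + 3 * (∑ J f + t J * evenFactor m (+ J) * pow2 J)
        ≡⟨ distrib (∑ J f) (t J) (evenFactor m (+ J)) (pow2 J) ⟩
      + 3 * ∑ J f + + 3 * (evenFactor m (+ J) * (t J * pow2 J))
        ≡⟨ cong (_+ + 3 * (evenFactor m (+ J) * (t J * pow2 J))) (gosper J (ℕ.<⇒≤ J<n+1)) ⟩
      + 2 * (m - + 2) * t 0 - (+ 3 * + J + + 2) * evenDen m (+ J - 1ℤ) * (t J * pow2 J) + + 3 * (evenFactor m (+ J) * (t J * pow2 J))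
        ≡⟨ gosper-certificate m (+ J) (t 0) (t J * pow2 J) ⟩
      + 2 * (m - + 2) * t 0 - (+ 3 * + suc J + + 2) * + 2 * (evenNum m (+ J) * (t J * pow2 J))
        ≡⟨ cong (λ x → + 2 * (m - + 2) * t 0 - (+ 3 * + suc J + + 2) * + 2 * x)
             (trans (sym (*-assoc (evenNum m (+ J)) (t J) (pow2 J))) (cong (_* pow2 J) (sym (t-rec J J<n+1)))) ⟩
      + 2 * (m - + 2) * t 0 - (+ 3 * + suc J + + 2) * + 2 * (evenDen m (+ J) * t (suc J) * pow2 J)
        ≡⟨ regroup (+ 2 * (m - + 2) * t 0) (+ 3 * + suc J + + 2) (evenDen m (+ J)) (t (suc J)) (pow2 J) ⟩
      + 2 * (m - + 2) * t 0 - (+ 3 * + suc J + + 2) * evenDen m (+ J) * (t (suc J) * (pow2 J + pow2 J)) ∎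
      where
      f : ℕ → ℤ
      f j = q j * pow2 j
      distrib : ∀ s t f p → + 3 * (s + t * f * p) ≡ + 3 * s + + 3 * (f * (t * p))
      distrib = solve-∀
      regroup : ∀ a c d t p → a - c * + 2 * (d * t * p) ≡ a - c * d * (t * (p + p))
      regroup = solve-∀

    ∑-pow2 : + 6 * ∑ (suc n) (λ j → q j * pow2 j) ≡ q 0
    ∑-pow2 = begin
      + 6 * X                                            ≡⟨ double X ⟩
      + 2 * (+ 3 * X)                                    ≡⟨ cong (+ 2 *_) (gosper (suc n) ℕ.≤-refl) ⟩
      + 2 * (+ 2 * (m - + 2) * t 0 - Y * (t (suc n) * pow2 (suc n)))
        ≡⟨ cong (λ x → + 2 * (+ 2 * (m - + 2) * t 0 - Y * (x * pow2 (suc n)))) t-end ⟩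
      + 2 * (+ 2 * (m - + 2) * t 0 - Y * (0ℤ * pow2 (suc n)))
        -- `evenFactor m 0` is 4 (m - 2), so the surviving term is exactly `q 0`.
        ≡⟨ simplify m (t 0) Y (pow2 (suc n)) ⟩
      q 0 ∎
      where
      X = ∑ (suc n) (λ j → q j * pow2 j)
      Y = (+ 3 * + suc n + + 2) * evenDen m (+ suc n - 1ℤ)
      double : ∀ x → + 6 * x ≡ + 2 * (+ 3 * x)
      double = solve-∀
      simplify : ∀ m t y p → + 2 * (+ 2 * (m - + 2) * t - y * (0ℤ * p)) ≡ t * ((+ 3 * 0ℤ + + 4) * m - (0ℤ + 1ℤ) * (+ 9 * 0ℤ * 0ℤ + + 20 * 0ℤ + + 8))
      simplify = solve-∀

    -- The centre exceeds every lower index, so both tail sums are minus a full power of two.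
    cross-0 : ∀ j → cross 0 (suc j) ≡ - (+ 3 * pow2 (suc j))
    cross-0 j = trans (cross′ 0 (suc j))
      (trans (cong₂ _+_ (trans (cong (binDiff (suc (suc j))) arg₁) (binDiff-high (suc (suc j)) j))
                        (trans (cong (binDiff (suc j)) arg₂) (binDiff-high (suc j) (suc j))))
             (sum (pow2 (suc j))))
      where
      arg₂ : centre 0 (suc j) ≡ + (suc j ℕ.+ suc (suc j))
      arg₂ = +-identityʳ (+ (suc j ℕ.+ suc (suc j)))
      arg₁ : centre 0 (suc j) ≡ + (suc (suc j) ℕ.+ suc j)
      arg₁ = trans arg₂ (cong +_ (ℕ.+-suc (suc j) (suc j)))
      sum : ∀ p → - (p + p) + - p ≡ - (+ 3 * p)
      sum = solve-∀

    S′-zero : S′ 0 ≡ 0ℤ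
    S′-zero = trans (expand n) (i≡j⇒i-j≡0 ∑-pow2)
      where
      expand : ∀ n → ∑ (suc n) (λ j → q j * (+ 3 * pow2 j - cross 0 j)) ≡ + 6 * ∑ (suc n) (λ j → q j * pow2 j) - q 0
      -- `cross 0 0` is -2 and not -3; hence 5 in place of 6, and the correction - q_0 that `∑-pow2`
      -- cancels.
      expand zero = first (q 0)
        where
        first : ∀ q → 0ℤ + q * + 5 ≡ + 6 * (0ℤ + q * 1ℤ) - q
        first = solve-∀
      expand (suc n) = trans (cong₂ _+_ (expand n) (cong (λ c → q (suc n) * (+ 3 * pow2 (suc n) - c)) (cross-0 n)))
        (regroup (∑ (suc n) (λ j → q j * pow2 j)) (q 0) (q (suc n)) (pow2 (suc n)))
        where
        regroup : ∀ x a b p → + 6 * x - a + b * (+ 3 * p - - (+ 3 * p)) ≡ + 6 * (x + b * p) - a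
        regroup = solve-∀

    S′-vanish : ∀ i d → n ≡ suc (i ℕ.+ d) → S′ i ≡ 0ℤ
    S′-vanish zero    d e = S′-zero
    S′-vanish (suc i) d e = trans (S′-suc i)
      (cong₂ (λ s r → s + s - r) (S′-vanish i (suc d) (trans e (cong suc (sym (ℕ.+-suc i d))))) (R-vanish d i e))

    -- As S′_k = 0, only - R_k remains. In this form the open value of the odd vector can enter the
    -- two-way evaluation of the pairing.
    S′-last : ∀ k → n ≡ suc k → S′ n ≡ - R k
    S′-last k refl = trans (S′-suc k)
      (trans (cong (λ s → s + s - R k) (S′-vanish k 0 (cong suc (sym (ℕ.+-identityʳ k))))) (+-identityˡ (- R k)))

  cross-multiply : ∀ {x₁ x₂ x₃ x₄} C₁ C₂ g₁ g₂ → C₁ ≢ 0ℤ → C₁ * (x₄ * x₁) ≡ C₂ * (x₃ * x₂) → g₁ * C₂ ≡ g₂ * C₁ →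
            g₁ * (x₄ * x₁) ≡ g₂ * (x₃ * x₂)
  cross-multiply {x₁} {x₂} {x₃} {x₄} C₁ C₂ g₁ g₂ C₁≢0 e c = cancel {C₁} C₁≢0 (begin
    C₁ * (g₁ * (x₄ * x₁)) ≡⟨ swap C₁ g₁ (x₄ * x₁) ⟩
    g₁ * (C₁ * (x₄ * x₁)) ≡⟨ cong (g₁ *_) e ⟩
    g₁ * (C₂ * (x₃ * x₂)) ≡⟨ sym (*-assoc g₁ C₂ (x₃ * x₂)) ⟩
    g₁ * C₂ * (x₃ * x₂)   ≡⟨ cong (_* (x₃ * x₂)) c ⟩
    g₂ * C₁ * (x₃ * x₂)   ≡⟨ swap′ g₂ C₁ (x₃ * x₂) ⟩
    C₁ * (g₂ * (x₃ * x₂)) ∎)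
    where
    swap : ∀ a b c → a * (b * c) ≡ b * (a * c)
    swap = solve-∀
    swap′ : ∀ a b c → a * b * c ≡ b * (a * c)
    swap′ = solve-∀

  oddβ-positive-identity : ∀ n → (+ 2 * n + + 2) * (+ 2 * n + + 7) - (+ 4 * n * n + + 10 * n) ≡ + 8 * n + + 14
  oddβ-positive-identity = solve-∀

  oddβ-≢0 : ∀ n → NonNeg n → oddβ (oddParameter n) n ≢ 0ℤ
  oddβ-≢0 n n₀ = *-≢0 ((+ 2 * n + + 2) * (+ 2 * n + + 7) - oddParameter n) (oddQuadric (oddParameter n) n)
    (Pos⇒≢0 (+ 8 * n + + 14) (oddβ-positive-identity n) (nat 8 ⊠ n₀ ⊞₊ pos 13))
    (Pos⇒≢0 (oddQuadric (oddParameter n) n) refl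
      (nat 2 ⊠ n₀ ⊠ n₀ ⊞ (nat 3 ⊠ m₀ ⊞ nat 22) ⊠ n₀ ⊞ nat 5 ⊠ m₀ ⊞₊ pos 31))
    where
    m₀ : NonNeg (oddParameter n)
    m₀ = nat 4 ⊠ n₀ ⊠ n₀ ⊞ nat 10 ⊠ n₀

  oddToEven₁-≢0 : ∀ n → NonNeg n → oddToEven₁ n ≢ 0ℤ
  oddToEven₁-≢0 n n₀ = *-≢0 ((0ℤ - oddβ μ n) * evenNum κ n) (evenFactor κ (1ℤ + n))
    (*-≢0 (0ℤ - oddβ μ n) (evenNum κ n)
      (λ e → oddβ-≢0 n n₀ (neg-zero (oddβ μ n) e))
      (subst (λ x → evenNum (evenParameter (1ℤ + x)) n ≢ 0ℤ) (+-identityʳ n) (evenNum-≢0 n 0ℤ n₀ (nat 0))))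
    (evenFactor-≢0 (1ℤ + n) (nat 1 ⊞ n₀) (subst Pos (+-comm n 1ℤ) (n₀ ⊞₊ pos 0)))
    where
    μ κ : ℤ
    μ = oddParameter n
    κ = evenParameter (1ℤ + n)
    neg-zero : ∀ x → 0ℤ - x ≡ 0ℤ → x ≡ 0ℤ
    neg-zero x e = sym (i-j≡0⇒i≡j 0ℤ x e)

  evenβ-≢0-identity₁ : ∀ k → (+ 2 * k + + 5) * (+ 2 * k + + 6) - (+ 2 * (1ℤ + k) + + 2) * (+ 2 * (1ℤ + k) + 1ℤ) ≡ + 8 * k + + 18
  evenβ-≢0-identity₁ = solve-∀

  evenβ-≢0-identity₂ : ∀ k → + 3 * (k + 1ℤ) * (k + + 2) - (+ 2 * (1ℤ + k) + + 2) * (+ 2 * (1ℤ + k) + 1ℤ) ≡ - (k * k + + 5 * k + + 6)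
  evenβ-≢0-identity₂ = solve-∀

  evenβ-≢0 : ∀ k → NonNeg k → evenβ (evenParameter (1ℤ + k)) k ≢ 0ℤ
  evenβ-≢0 k k₀ = *-≢0 (((+ 2 * k + + 5) * (+ 2 * k + + 6) - κ) * (+ 3 * k + + 4)) (evenQuadric κ k)
    (*-≢0 ((+ 2 * k + + 5) * (+ 2 * k + + 6) - κ) (+ 3 * k + + 4)
      (Pos⇒≢0 (+ 8 * k + + 18) (evenβ-≢0-identity₁ k) (nat 8 ⊠ k₀ ⊞₊ pos 17))
      (Pos⇒≢0 (+ 3 * k + + 4) refl (nat 3 ⊠ k₀ ⊞₊ pos 3)))
    (Neg⇒≢0 (k * k + + 5 * k + + 6) (evenβ-≢0-identity₂ k) (k₀ ⊠ k₀ ⊞ nat 5 ⊠ k₀ ⊞₊ pos 5))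
    where
    κ : ℤ
    κ = evenParameter (1ℤ + k)

  evenToOdd₁-≢0 : ∀ k → NonNeg k → evenToOdd₁ k ≢ 0ℤ
  evenToOdd₁-≢0 k k₀ = *-≢0 (oddNum μ k * evenβ κ k) (k + + 2)
    (*-≢0 (oddNum μ k) (evenβ κ k)
      (subst (λ x → oddNum (oddParameter (1ℤ + x)) k ≢ 0ℤ) (+-identityʳ k) (oddNum-≢0 k 0ℤ k₀ (nat 0)))
      (evenβ-≢0 k k₀))
    (Pos⇒≢0 (k + + 2) refl (k₀ ⊞₊ pos 1))
    where
    μ κ : ℤ
    μ = oddParameter (1ℤ + k)
    κ = evenParameter (1ℤ + k)

  -- The x's stand for N_m at m = 2n + 1, ..., 2n + 4. The sum of h_i q_j `kernel` i j over i ≤ n, j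
  -- ≤ n + 1 is taken in both orders; orthogonality leaves h_n R_n in one order and q_n S_n +
  -- q_{n+1} S_{n+1} in the other.
  oddToEven : ∀ n {x₁ x₂ x₃ x₄} →
    Odd.h n n * x₃ ≡ Odd.S n n * x₁ →
    Even.q (suc n) (suc n) * x₄ ≡ EvenPairing.S′ (suc n) (suc n) * x₂ →
    growth₁ (+ 2 * + n + + 2) * (x₄ * x₁) ≡ growth₂ (+ 2 * + n + + 2) * (x₃ * x₂)
  oddToEven n {x₁} {x₂} {x₃} {x₄} e₃ e₄ =
    cross-multiply {x₁} {x₂} {x₃} {x₄} (oddToEven₁ (+ n)) (oddToEven₂ (+ n)) (growth₁ (+ 2 * + n + + 2)) (growth₂ (+ 2 * + n + + 2)) (oddToEven₁-≢0 (+ n) (nat n)) related (oddToEven-certificate (+ n))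
    where
    open Odd n using (h; S; S-vanish; S-rec; h-≢0)
    open Even (suc n) using (q; R; R-vanish; t; t-rec; t-≢0; q-≢0)
    open EvenPairing (suc n) using (S′; S′-last)
    μ κ : ℤ
    μ = Odd.m n
    κ = Even.m (suc n)
    α = oddα μ (+ n)
    β = oddβ μ (+ n)
    num = evenNum κ (+ n)
    den = evenDen κ (+ n)
    f₀ = evenFactor κ (+ n)
    f₁ = evenFactor κ (+ suc n)
    adjoint : h n * R n ≡ q n * S n + q (suc n) * S (suc n)
    adjoint = begin
      h n * R n ≡⟨ sym (∑-last n (λ i → h i * R i) (λ i i<n → let d , e = <⇒+ i<n in
                     trans (cong (h i *_) (R-vanish d i (cong suc e))) (*-zeroʳ (h i)))) ⟩
      ∑ (suc n) (λ i → h i * R i)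
        ≡⟨ ∑-bilinear (suc n) (suc (suc n)) h q kernel ⟩
      ∑ (suc n) (λ j → q j * S j) + q (suc n) * S (suc n)
        ≡⟨ cong (_+ q (suc n) * S (suc n)) (∑-last n (λ j → q j * S j) (λ j j<n → let d , e = <⇒+ j<n in
             trans (cong (q j *_) (S-vanish d j e)) (*-zeroʳ (q j)))) ⟩
      q n * S n + q (suc n) * S (suc n) ∎
    related : oddToEven₁ (+ n) * (x₄ * x₁) ≡ oddToEven₂ (+ n) * (x₃ * x₂)
    related = cancel {t (suc n)} t-≢0 (cancel {h n} h-≢0 (begin
      h n * (t (suc n) * ((0ℤ - β) * num * f₁ * (x₄ * x₁)))
        ≡⟨ step₁ (h n) (t (suc n)) β num f₁ x₄ x₁ ⟩
      - (β * num * h n * x₁ * (t (suc n) * f₁ * x₄))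
        ≡⟨ cong (λ x → - (β * num * h n * x₁ * x)) (trans e₄ (cong (_* x₂) (S′-last n refl))) ⟩
      - (β * num * h n * x₁ * (- R n * x₂))
        ≡⟨ step₂ β num (h n) x₁ (R n) x₂ ⟩
      num * x₂ * x₁ * (β * (h n * R n))
        ≡⟨ cong (λ x → num * x₂ * x₁ * (β * x)) adjoint ⟩
      num * x₂ * x₁ * (β * (q n * S n + q (suc n) * S (suc n)))
        ≡⟨ step₃ num x₂ x₁ β (q n) (S n) (q (suc n)) (S (suc n)) ⟩
      num * x₂ * x₁ * (β * q n * S n + q (suc n) * (β * S (suc n)))
        -- The recurrence trades β S_{n+1} for α S_n; then S_n x₁ can be replaced by h_n x₃, and no
        -- open value remains.
        ≡⟨ cong (λ x → num * x₂ * x₁ * (β * q n * S n + q (suc n) * x)) (sym (S-rec n)) ⟩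
      num * x₂ * x₁ * (β * q n * S n + q (suc n) * (α * S n))
        ≡⟨ step₄ num x₂ x₁ β (t n) f₀ (S n) (t (suc n)) f₁ α ⟩
      x₂ * (S n * x₁) * (num * t n * f₀ * β + num * t (suc n) * f₁ * α)
        ≡⟨ cong₂ (λ x y → x₂ * x * (y * f₀ * β + num * t (suc n) * f₁ * α)) (sym e₃) (sym (t-rec n (s≤s (ℕ.n≤1+n n)))) ⟩
      x₂ * (h n * x₃) * (den * t (suc n) * f₀ * β + num * t (suc n) * f₁ * α)
        ≡⟨ step₅ x₂ (h n) x₃ den (t (suc n)) f₀ β num f₁ α ⟩
      h n * (t (suc n) * ((den * f₀ * β + num * f₁ * α) * (x₃ * x₂))) ∎))
      where
      step₁ : ∀ h t β num f x₄ x₁ → h * (t * ((0ℤ - β) * num * f * (x₄ * x₁))) ≡ - (β * num * h * x₁ * (t * f * x₄))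
      step₁ = solve-∀
      step₂ : ∀ β num h x₁ R x₂ → - (β * num * h * x₁ * (- R * x₂)) ≡ num * x₂ * x₁ * (β * (h * R))
      step₂ = solve-∀
      step₃ : ∀ num x₂ x₁ β q S q′ S′ → num * x₂ * x₁ * (β * (q * S + q′ * S′)) ≡ num * x₂ * x₁ * (β * q * S + q′ * (β * S′))
      step₃ = solve-∀
      step₄ : ∀ num x₂ x₁ β t f S t′ f′ α → num * x₂ * x₁ * (β * (t * f) * S + (t′ * f′) * (α * S))
        ≡ x₂ * (S * x₁) * (num * t * f * β + num * t′ * f′ * α)
      step₄ = solve-∀
      step₅ : ∀ x₂ h x₃ den t f β num f′ α → x₂ * (h * x₃) * (den * t * f * β + num * t * f′ * α)
        ≡ h * (t * ((den * f * β + num * f′ * α) * (x₃ * x₂)))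
      step₅ = solve-∀

  -- As in `oddToEven`, with both vectors of index n = k + 1: one order leaves h_k R_k + h_n R_n,
  -- the other q_n S_n. The recurrence for `R` removes R_n.
  evenToOdd : ∀ k {x₁ x₂ x₃ x₄} →
    Even.q (suc k) (suc k) * x₃ ≡ EvenPairing.S′ (suc k) (suc k) * x₁ →
    Odd.h (suc k) (suc k) * x₄ ≡ Odd.S (suc k) (suc k) * x₂ →
    growth₁ (+ 2 * + k + + 3) * (x₄ * x₁) ≡ growth₂ (+ 2 * + k + + 3) * (x₃ * x₂)
  evenToOdd k {x₁} {x₂} {x₃} {x₄} e₃ e₄ =
    cross-multiply {x₁} {x₂} {x₃} {x₄} (evenToOdd₁ (+ k)) (evenToOdd₂ (+ k)) (growth₁ (+ 2 * + k + + 3)) (growth₂ (+ 2 * + k + + 3))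
      (evenToOdd₁-≢0 (+ k) (nat k)) related (evenToOdd-certificate (+ k))
    where
    n = suc k
    open Odd n using (h; u; u-rec; S; S-vanish; u-≢0)
    open Even n using (q; R; R-vanish; R-rec; q-≢0)
    open EvenPairing n using (S′; S′-last)
    μ κ : ℤ
    μ = Odd.m n
    κ = Even.m n
    α = evenα κ (+ k)
    β = evenβ κ (+ k)
    num = oddNum μ (+ k)
    den = oddDen μ (+ k)
    adjoint : h k * R k + h n * R n ≡ q n * S n
    adjoint = begin
      h k * R k + h n * R n
        ≡⟨ cong (_+ h n * R n) (sym (∑-last k (λ i → h i * R i) (λ i i<k → let d , e = <⇒+ i<k in
             trans (cong (h i *_) (R-vanish d i (cong suc e))) (*-zeroʳ (h i))))) ⟩
      ∑ (suc n) (λ i → h i * R i)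
        ≡⟨ ∑-bilinear (suc n) (suc n) h q kernel ⟩
      ∑ (suc n) (λ j → q j * S j)
        ≡⟨ ∑-last n (λ j → q j * S j) (λ j j<n → let d , e = <⇒+ j<n in
             trans (cong (q j *_) (S-vanish d j e)) (*-zeroʳ (q j))) ⟩
      q n * S n ∎
    related : evenToOdd₁ (+ k) * (x₄ * x₁) ≡ evenToOdd₂ (+ k) * (x₃ * x₂)
    related = cancel {u n} u-≢0 (cancel {q n} (q-≢0 k refl) (begin
      q n * (u n * (num * β * (+ k + + 2) * (x₄ * x₁)))
        ≡⟨ step₁ (q n) (u n) num β (+ k) x₄ x₁ ⟩
      num * β * q n * x₁ * (u n * (1ℤ + + k + 1ℤ) * x₄)
        ≡⟨ cong (num * β * q n * x₁ *_) e₄ ⟩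
      num * β * q n * x₁ * (S n * x₂)
        ≡⟨ step₂ num β (q n) x₁ (S n) x₂ ⟩
      num * β * x₁ * x₂ * (q n * S n)
        ≡⟨ cong (num * β * x₁ * x₂ *_) (sym adjoint) ⟩
      num * β * x₁ * x₂ * (h k * R k + h n * R n)
        ≡⟨ step₃ num β x₁ x₂ (u k) (+ k) (R k) (h n) (R n) ⟩
      x₁ * x₂ * (num * u k * (+ k + 1ℤ) * β * R k + num * h n * (β * R n))
        ≡⟨ cong₂ (λ x y → x₁ * x₂ * (x * (+ k + 1ℤ) * β * R k + num * h n * y)) (sym (u-rec k (s≤s (ℕ.n≤1+n k)))) (sym (R-rec k)) ⟩
      x₁ * x₂ * (den * u n * (+ k + 1ℤ) * β * R k + num * h n * (α * R k))
        ≡⟨ step₄ x₁ x₂ den (u n) (+ k) β (R k) num α ⟩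
      x₂ * (- R k * x₁) * u n * (0ℤ - (den * (+ k + 1ℤ) * β + num * (+ k + + 2) * α))
        ≡⟨ cong (λ x → x₂ * x * u n * (0ℤ - (den * (+ k + 1ℤ) * β + num * (+ k + + 2) * α)))
             (trans (cong (_* x₁) (sym (S′-last k refl))) (sym e₃)) ⟩
      x₂ * (q n * x₃) * u n * (0ℤ - (den * (+ k + 1ℤ) * β + num * (+ k + + 2) * α))
        ≡⟨ step₅ x₂ (q n) x₃ (u n) (0ℤ - (den * (+ k + 1ℤ) * β + num * (+ k + + 2) * α)) ⟩
      q n * (u n * ((0ℤ - (den * (+ k + 1ℤ) * β + num * (+ k + + 2) * α)) * (x₃ * x₂))) ∎))
      where
      step₁ : ∀ q u num β k x₄ x₁ → q * (u * (num * β * (k + + 2) * (x₄ * x₁))) ≡ num * β * q * x₁ * (u * (1ℤ + k + 1ℤ) * x₄)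
      step₁ = solve-∀
      step₂ : ∀ num β q x₁ S x₂ → num * β * q * x₁ * (S * x₂) ≡ num * β * x₁ * x₂ * (q * S)
      step₂ = solve-∀
      step₃ : ∀ num β x₁ x₂ u k R h R′ → num * β * x₁ * x₂ * (u * (k + 1ℤ) * R + h * R′)
        ≡ x₁ * x₂ * (num * u * (k + 1ℤ) * β * R + num * h * (β * R′))
      step₃ = solve-∀
      step₄ : ∀ x₁ x₂ den u k β R num α →
        x₁ * x₂ * (den * u * (k + 1ℤ) * β * R + num * (u * (1ℤ + k + 1ℤ)) * (α * R))
        ≡ x₂ * (- R * x₁) * u * (0ℤ - (den * (k + 1ℤ) * β + num * (k + + 2) * α))
      step₄ = solve-∀
      step₅ : ∀ x₂ q x₃ u c → x₂ * (q * x₃) * u * c ≡ q * (u * (c * (x₃ * x₂)))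
      step₅ = solve-∀

-- Exterior algebra and Pfaffians of skew forms.

module Pfaffian where
  open import Data.Nat.Base as ℕ using (ℕ; zero; suc; s≤s)
  import Data.Nat.Properties as ℕ
  open import Data.Integer.Base using (ℤ; +_; 0ℤ; 1ℤ; _+_; _*_; _-_; -_)
  open import Data.Integer.Properties
  open import Data.Integer.Tactic.RingSolver using (solve-∀)

  interchange : ∀ a b c d → (a + b) + (c + d) ≡ (a + c) + (b + d)
  interchange = solve-∀

  self-negative : ∀ x → x ≡ - x → x ≡ 0ℤ
  self-negative (+ zero) e = refl

  negate : ∀ x y → x + y ≡ 0ℤ → x ≡ - y
  negate x y e = i-j≡0⇒i≡j x (- y) (trans (cong (λ z → x + z) (neg-involutive y)) e)

  sign : ℕ → ℤ
  sign zero    = 1ℤ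
  sign (suc n) = - sign n

  sign² : ∀ n → sign n * sign n ≡ 1ℤ
  sign² zero    = refl
  sign² (suc n) = trans (signs (sign n)) (sign² n)
    where
    signs : ∀ s → - s * - s ≡ s * s
    signs = solve-∀

  module Exterior (I : Set) where

    -- A function on lists plays the role of a functional on the exterior algebra.
    Functional : Set
    Functional = List I → ℤ

    infixl 8 _at_
    _at_ : Functional → I → Functional
    (F at v) L = F (v ∷ L)

    -- The product φ ∧ F with a linear form: the alternating sum over the entries v of φ(v) times F
    -- of the remaining list.
    wedge : (I → ℤ) → Functional → Functional
    wedge φ F []      = 0ℤ
    wedge φ F (v ∷ L) = φ v * F L - wedge φ (F at v) L

    wedge-cong : ∀ {φ ψ F G} L → (∀ x → φ x ≡ ψ x) → (∀ X → suc (length X) ≡ length L → F X ≡ G X) →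
                 wedge φ F L ≡ wedge ψ G L
    wedge-cong []      eφ eF = refl
    wedge-cong (v ∷ L) eφ eF =
      cong₂ _-_ (cong₂ _*_ (eφ v) (eF L refl)) (wedge-cong L eφ (λ X e → eF (v ∷ X) (cong suc e)))

    wedge-+ : ∀ φ F G L → wedge φ (λ X → F X + G X) L ≡ wedge φ F L + wedge φ G L
    wedge-+ φ F G []      = refl
    wedge-+ φ F G (v ∷ L) = trans (cong (λ x → φ v * (F L + G L) - x) (wedge-+ φ (F at v) (G at v) L))
      (regroup (φ v) (F L) (G L) (wedge φ (F at v) L) (wedge φ (G at v) L))
      where
      regroup : ∀ p f g a b → p * (f + g) - (a + b) ≡ p * f - a + (p * g - b)
      regroup = solve-∀

    wedge-* : ∀ φ c F L → wedge φ (λ X → c * F X) L ≡ c * wedge φ F L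
    wedge-* φ c F []      = sym (*-zeroʳ c)
    wedge-* φ c F (v ∷ L) = trans (cong (λ x → φ v * (c * F L) - x) (wedge-* φ c (F at v) L))
      (regroup (φ v) c (F L) (wedge φ (F at v) L))
      where
      regroup : ∀ p c f a → p * (c * f) - c * a ≡ c * (p * f - a)
      regroup = solve-∀

    wedge-neg : ∀ φ F L → wedge φ (λ X → - F X) L ≡ - wedge φ F L
    wedge-neg φ F []      = refl
    wedge-neg φ F (v ∷ L) = trans (cong (λ x → φ v * (- F L) - x) (wedge-neg φ (F at v) L))
      (regroup (φ v) (F L) (wedge φ (F at v) L))
      where
      regroup : ∀ p f a → p * (- f) - - a ≡ - (p * f - a)
      regroup = solve-∀

    wedge-+ˡ : ∀ φ ψ F L → wedge (λ x → φ x + ψ x) F L ≡ wedge φ F L + wedge ψ F L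
    wedge-+ˡ φ ψ F []      = refl
    wedge-+ˡ φ ψ F (v ∷ L) = trans (cong (λ x → (φ v + ψ v) * F L - x) (wedge-+ˡ φ ψ (F at v) L))
      (regroup (φ v) (ψ v) (F L) (wedge φ (F at v) L) (wedge ψ (F at v) L))
      where
      regroup : ∀ p q f a b → (p + q) * f - (a + b) ≡ p * f - a + (q * f - b)
      regroup = solve-∀

    wedge-*ˡ : ∀ c φ F L → wedge (λ x → c * φ x) F L ≡ c * wedge φ F L
    wedge-*ˡ c φ F []      = sym (*-zeroʳ c)
    wedge-*ˡ c φ F (v ∷ L) = trans (cong (λ x → c * φ v * F L - x) (wedge-*ˡ c φ (F at v) L))
      (regroup c (φ v) (F L) (wedge φ (F at v) L))
      where
      regroup : ∀ c p f a → c * p * f - c * a ≡ c * (p * f - a)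
      regroup = solve-∀

    wedge-zeroˡ : ∀ φ F L → (∀ x → x ∈ L → φ x ≡ 0ℤ) → wedge φ F L ≡ 0ℤ
    wedge-zeroˡ φ F []      z = refl
    wedge-zeroˡ φ F (v ∷ L) z = trans
      (cong₂ (λ a b → a * F L - b) (z v (here refl)) (wedge-zeroˡ φ (F at v) L (λ x x∈L → z x (there x∈L))))
      (cong (_- 0ℤ) (*-zeroˡ (F L)))

    wedge-anti : ∀ φ ψ F L → wedge φ (wedge ψ F) L + wedge ψ (wedge φ F) L ≡ 0ℤ
    wedge-anti φ ψ F []      = refl
    wedge-anti φ ψ F (v ∷ L) = begin
      (φ v * b - wedge φ (λ X → ψ v * F X - wedge ψ (F at v) X) L) + (ψ v * a - wedge ψ (λ X → φ v * F X - wedge φ (F at v) X) L)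
        ≡⟨ cong₂ (λ x y → (φ v * b - x) + (ψ v * a - y)) (split φ ψ) (split ψ φ) ⟩
      (φ v * b - (ψ v * a - wedge φ (wedge ψ (F at v)) L)) + (ψ v * a - (φ v * b - wedge ψ (wedge φ (F at v)) L))
        ≡⟨ regroup (φ v * b) (ψ v * a) (wedge φ (wedge ψ (F at v)) L) (wedge ψ (wedge φ (F at v)) L) ⟩
      wedge φ (wedge ψ (F at v)) L + wedge ψ (wedge φ (F at v)) L
        ≡⟨ wedge-anti φ ψ (F at v) L ⟩
      0ℤ ∎
      where
      a = wedge φ F L
      b = wedge ψ F L
      split : ∀ φ ψ → wedge φ (λ X → ψ v * F X - wedge ψ (F at v) X) L ≡ ψ v * wedge φ F L - wedge φ (wedge ψ (F at v)) L
      split φ ψ = trans (wedge-+ φ (λ X → ψ v * F X) (λ X → - wedge ψ (F at v) X) L)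
                        (cong₂ _+_ (wedge-* φ (ψ v) F L) (wedge-neg φ (wedge ψ (F at v)) L))
      regroup : ∀ x y p q → (x - (y - p)) + (y - (x - q)) ≡ p + q
      regroup = solve-∀

    Alternating : Functional → Set
    Alternating F = ∀ X a b Y → F (X ++ a ∷ b ∷ Y) + F (X ++ b ∷ a ∷ Y) ≡ 0ℤ

    at-alternating : ∀ {F} v → Alternating F → Alternating (F at v)
    at-alternating v alt X = alt (v ∷ X)

    wedge-alternating : ∀ φ F → Alternating F → Alternating (wedge φ F)
    wedge-alternating φ F alt [] a b Y = begin
      (φ a * F (b ∷ Y) - (φ b * F (a ∷ Y) - wedge φ (F at a at b) Y)) + (φ b * F (a ∷ Y) - (φ a * F (b ∷ Y) - wedge φ (F at b at a) Y))
        ≡⟨ regroup (φ a * F (b ∷ Y)) (φ b * F (a ∷ Y)) _ _ ⟩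
      wedge φ (F at a at b) Y + wedge φ (F at b at a) Y
        ≡⟨ sym (wedge-+ φ (F at a at b) (F at b at a) Y) ⟩
      wedge φ (λ Z → F (a ∷ b ∷ Z) + F (b ∷ a ∷ Z)) Y
        ≡⟨ wedge-cong Y (λ _ → refl) (λ Z _ → trans (alt [] a b Z) (sym (*-zeroˡ 0ℤ))) ⟩
      wedge φ (λ Z → 0ℤ * 0ℤ) Y
        ≡⟨ trans (wedge-* φ 0ℤ (λ _ → 0ℤ) Y) (*-zeroˡ (wedge φ (λ _ → 0ℤ) Y)) ⟩
      0ℤ ∎
      where
      regroup : ∀ x y p q → (x - (y - p)) + (y - (x - q)) ≡ p + q
      regroup = solve-∀
    wedge-alternating φ F alt (c ∷ X) a b Y = begin
      (φ c * p - wedge φ (F at c) (X ++ a ∷ b ∷ Y)) + (φ c * q - wedge φ (F at c) (X ++ b ∷ a ∷ Y))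
        ≡⟨ regroup (φ c) p q _ _ ⟩
      φ c * (p + q) - (wedge φ (F at c) (X ++ a ∷ b ∷ Y) + wedge φ (F at c) (X ++ b ∷ a ∷ Y))
        ≡⟨ cong₂ (λ x y → φ c * x - y) (alt X a b Y) (wedge-alternating φ (F at c) (at-alternating {F} c alt) X a b Y) ⟩
      φ c * 0ℤ - 0ℤ
        ≡⟨ cong (_- 0ℤ) (*-zeroʳ (φ c)) ⟩
      0ℤ ∎
      where
      p = F (X ++ a ∷ b ∷ Y)
      q = F (X ++ b ∷ a ∷ Y)
      regroup : ∀ c p q x y → (c * p - x) + (c * q - y) ≡ c * (p + q) - (x + y)
      regroup = solve-∀

    alternating-repeat : ∀ F → Alternating F → ∀ u L → u ∈ L → F (u ∷ L) ≡ 0ℤ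
    alternating-repeat F alt u (.u ∷ L) (here refl) = half (F (u ∷ u ∷ L)) (alt [] u u L)
      where
      half : ∀ x → x + x ≡ 0ℤ → x ≡ 0ℤ
      half x e = *-cancelˡ-≡ (+ 2) x 0ℤ (trans (double x) e)
        where
        double : ∀ x → + 2 * x ≡ x + x
        double = solve-∀
    alternating-repeat F alt u (v ∷ L) (there u∈L) = trans (negate (F (u ∷ v ∷ L)) (F (v ∷ u ∷ L)) (alt [] u v L))
      (cong -_ (alternating-repeat (F at v) (at-alternating {F} v alt) u L u∈L))

    -- Vectors are only named by elements of `I`. Linearity is needed just for c = a + b, as in
    -- (1+x)^{k+1} = (1+x)^k + x (1+x)^k, and is stated for three such names.
    Additive : I → I → I → Functional → Set
    Additive c a b F = ∀ X Y → F (X ++ c ∷ Y) ≡ F (X ++ a ∷ Y) + F (X ++ b ∷ Y)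

    wedge-additive : ∀ {c a b} φ F → φ c ≡ φ a + φ b → Additive c a b F → Additive c a b (wedge φ F)
    wedge-additive {c} {a} {b} φ F eφ add [] Y = begin
      φ c * F Y - wedge φ (F at c) Y
        ≡⟨ cong₂ (λ x y → x * F Y - y) eφ (trans (wedge-cong Y (λ _ → refl) (λ Z _ → add [] Z)) (wedge-+ φ (F at a) (F at b) Y)) ⟩
      (φ a + φ b) * F Y - (wedge φ (F at a) Y + wedge φ (F at b) Y)
        ≡⟨ regroup (φ a) (φ b) (F Y) _ _ ⟩
      (φ a * F Y - wedge φ (F at a) Y) + (φ b * F Y - wedge φ (F at b) Y) ∎
      where
      regroup : ∀ p q f x y → (p + q) * f - (x + y) ≡ (p * f - x) + (q * f - y)
      regroup = solve-∀
    wedge-additive {c} {a} {b} φ F eφ add (v ∷ X) Y = begin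
      φ v * F (X ++ c ∷ Y) - wedge φ (F at v) (X ++ c ∷ Y)
        ≡⟨ cong₂ (λ x y → φ v * x - y) (add X Y) (wedge-additive φ (F at v) eφ (λ X′ → add (v ∷ X′)) X Y) ⟩
      φ v * (F (X ++ a ∷ Y) + F (X ++ b ∷ Y)) - (wedge φ (F at v) (X ++ a ∷ Y) + wedge φ (F at v) (X ++ b ∷ Y))
        ≡⟨ regroup (φ v) _ _ _ _ ⟩
      (φ v * F (X ++ a ∷ Y) - wedge φ (F at v) (X ++ a ∷ Y)) + (φ v * F (X ++ b ∷ Y) - wedge φ (F at v) (X ++ b ∷ Y)) ∎
      where
      regroup : ∀ c p q x y → c * (p + q) - (x + y) ≡ (c * p - x) + (c * q - y)
      regroup = solve-∀

    infix 9 _±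
    _± : Functional → Functional
    (F ±) L = sign (length L) * F L

    -- The exterior product F ∧ G: a sum over all splittings of the list with the sign of the
    -- shuffle. Moving v to the second part passes it over the entries given to F, whence `±`.
    conv : Functional → Functional → Functional
    conv F G []      = F [] * G []
    conv F G (v ∷ L) = conv (F at v) G L + conv (F ±) (G at v) L

    conv-cong : ∀ {F F′ G G′} L → (∀ X → F X ≡ F′ X) → (∀ X → G X ≡ G′ X) → conv F G L ≡ conv F′ G′ L
    conv-cong []      eF eG = cong₂ _*_ (eF []) (eG [])
    conv-cong (v ∷ L) eF eG = cong₂ _+_ (conv-cong L (λ X → eF (v ∷ X)) eG)
                                (conv-cong L (λ X → cong (sign (length X) *_) (eF X)) (λ X → eG (v ∷ X)))

    conv-linearˡ : ∀ c F F′ G L → conv (λ X → c * F X - F′ X) G L ≡ c * conv F G L - conv F′ G L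
    conv-linearˡ c F F′ G []      = distrib c (F []) (F′ []) (G [])
      where
      distrib : ∀ c f f′ g → (c * f - f′) * g ≡ c * (f * g) - f′ * g
      distrib = solve-∀
    conv-linearˡ c F F′ G (v ∷ L) = trans
      (cong₂ _+_ (conv-linearˡ c (F at v) (F′ at v) G L)
        (trans (conv-cong L (λ X → distrib (sign (length X)) c (F X) (F′ X)) (λ _ → refl)) (conv-linearˡ c (F ±) (F′ ±) (G at v) L)))
      (regroup c (conv (F at v) G L) (conv (F′ at v) G L) (conv (F ±) (G at v) L) (conv (F′ ±) (G at v) L))
      where
      distrib : ∀ s c f g → s * (c * f - g) ≡ c * (s * f) - s * g
      distrib = solve-∀
      regroup : ∀ c p q x y → (c * p - q) + (c * x - y) ≡ c * (p + x) - (q + y)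
      regroup = solve-∀

    conv-linearʳ : ∀ c F G G′ L → conv F (λ X → c * G X - G′ X) L ≡ c * conv F G L - conv F G′ L
    conv-linearʳ c F G G′ []      = distrib c (F []) (G []) (G′ [])
      where
      distrib : ∀ c f g g′ → f * (c * g - g′) ≡ c * (f * g) - f * g′
      distrib = solve-∀
    conv-linearʳ c F G G′ (v ∷ L) = trans
      (cong₂ _+_ (conv-linearʳ c (F at v) G G′ L) (conv-linearʳ c (F ±) (G at v) (G′ at v) L))
      (regroup c (conv (F at v) G L) (conv (F at v) G′ L) (conv (F ±) (G at v) L) (conv (F ±) (G′ at v) L))
      where
      regroup : ∀ c p q x y → (c * p - q) + (c * x - y) ≡ c * (p + x) - (q + y)
      regroup = solve-∀

    conv-negˡ : ∀ F G L → conv (λ X → - F X) G L ≡ - conv F G L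
    conv-negˡ F G L = trans (conv-cong L (λ X → sym (+-identityˡ (- F X))) (λ _ → refl))
      (trans (conv-linearˡ 0ℤ F F G L) (trans (cong (_- conv F G L) (*-zeroˡ (conv F G L))) (+-identityˡ (- conv F G L))))

    ±-± : ∀ F X → (F ± ±) X ≡ F X
    ±-± F X = trans (sym (*-assoc (sign (length X)) (sign (length X)) (F X))) (trans (cong (_* F X) (sign² (length X))) (*-identityˡ (F X)))

    ±-at : ∀ F v X → (F ± at v) X ≡ - ((F at v) ±) X
    ±-at F v X = sym (neg-distribˡ-* (sign (length X)) (F (v ∷ X)))

    wedge-± : ∀ φ F X → ((wedge φ F) ±) X ≡ - wedge φ (F ±) X
    wedge-± φ F []      = refl
    wedge-± φ F (v ∷ X) = begin
      - s * (φ v * F X - wedge φ (F at v) X)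
        ≡⟨ expand s (φ v) (F X) (wedge φ (F at v) X) ⟩
      - (φ v * (s * F X)) + s * wedge φ (F at v) X
        ≡⟨ cong (λ x → - (φ v * (s * F X)) + x) (trans (wedge-± φ (F at v) X)
             (trans (sym (wedge-neg φ ((F at v) ±) X)) (wedge-cong X (λ _ → refl) (λ Z _ → sym (±-at F v Z))))) ⟩
      - (φ v * (s * F X)) + wedge φ (F ± at v) X
        ≡⟨ factor (φ v * (s * F X)) (wedge φ (F ± at v) X) ⟩
      - (φ v * (s * F X) - wedge φ (F ± at v) X) ∎
      where
      s = sign (length X)
      expand : ∀ s p f w → - s * (p * f - w) ≡ - (p * (s * f)) + s * w
      expand = solve-∀
      factor : ∀ x y → - x + y ≡ - (x - y)
      factor = solve-∀

    -- Associativity of the exterior product; `wedge-convʳ` carries φ past F, at the price of the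
    -- parity sign.
    wedge-convˡ : ∀ φ F G L → wedge φ (conv F G) L ≡ conv (wedge φ F) G L
    wedge-convʳ : ∀ φ F G L → wedge φ (conv F G) L ≡ conv (F ±) (wedge φ G) L

    wedge-convˡ φ F G []      = sym (*-zeroˡ (G []))
    wedge-convˡ φ F G (v ∷ L) = begin
      φ v * conv F G L - wedge φ (λ X → conv (F at v) G X + conv (F ±) (G at v) X) L
        ≡⟨ cong (λ x → φ v * conv F G L - x) (trans (wedge-+ φ (conv (F at v) G) (conv (F ±) (G at v)) L)
             (cong₂ _+_ (wedge-convˡ φ (F at v) G L) (wedge-convˡ φ (F ±) (G at v) L))) ⟩
      φ v * conv F G L - (conv (wedge φ (F at v)) G L + conv (wedge φ (F ±)) (G at v) L)
        ≡⟨ regroup (φ v * conv F G L) _ _ ⟩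
      (φ v * conv F G L - conv (wedge φ (F at v)) G L) + - conv (wedge φ (F ±)) (G at v) L
        ≡⟨ cong₂ _+_ (sym (conv-linearˡ (φ v) F (wedge φ (F at v)) G L))
             (trans (sym (conv-negˡ (wedge φ (F ±)) (G at v) L)) (conv-cong L (λ X → sym (wedge-± φ F X)) (λ _ → refl))) ⟩
      conv (wedge φ F at v) G L + conv (wedge φ F ±) (G at v) L ∎
      where
      regroup : ∀ a b c → a - (b + c) ≡ (a - b) + - c
      regroup = solve-∀

    wedge-convʳ φ F G []      = sym (*-zeroʳ (1ℤ * F []))
    wedge-convʳ φ F G (v ∷ L) = begin
      φ v * conv F G L - wedge φ (λ X → conv (F at v) G X + conv (F ±) (G at v) X) L
        ≡⟨ cong (λ x → φ v * conv F G L - x) (trans (wedge-+ φ (conv (F at v) G) (conv (F ±) (G at v)) L)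
             (cong₂ _+_ (wedge-convʳ φ (F at v) G L)
               (trans (wedge-convʳ φ (F ±) (G at v) L) (conv-cong L (±-± F) (λ _ → refl))))) ⟩
      φ v * conv F G L - (conv ((F at v) ±) (wedge φ G) L + conv F (wedge φ (G at v)) L)
        ≡⟨ regroup (φ v * conv F G L) (conv ((F at v) ±) (wedge φ G) L) (conv F (wedge φ (G at v)) L) ⟩
      - conv ((F at v) ±) (wedge φ G) L + (φ v * conv F G L - conv F (wedge φ (G at v)) L)
        ≡⟨ cong₂ _+_
             (trans (sym (conv-negˡ ((F at v) ±) (wedge φ G) L)) (conv-cong L (λ X → sym (±-at F v X)) (λ _ → refl)))
             (trans (sym (conv-linearʳ (φ v) F G (wedge φ (G at v)) L)) (conv-cong L (λ X → sym (±-± F X)) (λ _ → refl))) ⟩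
      conv (F ± at v) (wedge φ G) L + conv (F ± ±) (wedge φ G at v) L ∎
      where
      regroup : ∀ a b c → a - (b + c) ≡ - b + (a - c)
      regroup = solve-∀

    module _ (B : I → I → ℤ) where

      -- Expansion along the first row calls itself on lists with two entries removed, which are not
      -- structurally smaller; the fuel bounds the number of expansions. On lists of odd length the
      -- value is zero.
      pfFuel : ℕ → Functional
      pfFuel f       []      = 1ℤ
      pfFuel zero    (u ∷ L) = 0ℤ
      pfFuel (suc f) (u ∷ L) = wedge (B u) (pfFuel f) L

      pf : Functional
      pf L = pfFuel (length L) L

      pfFuel-stable : ∀ f g L → length L ℕ.≤ f → length L ℕ.≤ g → pfFuel f L ≡ pfFuel g L
      pfFuel-stable f       g       []      _       _       = refl
      pfFuel-stable (suc f) (suc g) (u ∷ L) (s≤s p) (s≤s q) = wedge-cong L (λ _ → refl)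
        (λ X e → pfFuel-stable f g X (shorter X e p) (shorter X e q))
        where
        shorter : ∀ X {k} → suc (length X) ≡ length L → length L ℕ.≤ k → length X ℕ.≤ k
        shorter X e p = ℕ.≤-trans (ℕ.n≤1+n (length X)) (ℕ.≤-trans (ℕ.≤-reflexive e) p)

      pf-∷ : ∀ u L → pf (u ∷ L) ≡ wedge (B u) pf L
      pf-∷ u L = wedge-cong L (λ _ → refl)
        (λ X e → pfFuel-stable (length L) (length X) X (ℕ.≤-trans (ℕ.n≤1+n (length X)) (ℕ.≤-reflexive e)) ℕ.≤-refl)

      module _ (skew : ∀ x y → B x y + B y x ≡ 0ℤ) where

        -- For a swap in front, two expansions are unfolded: the term pairing a with b cancels by
        -- skew symmetry, the others by `wedge-anti`.
        pfFuel-alternating : ∀ f → Alternating (pfFuel f)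
        pfFuel-alternating zero    []      a b Y = refl
        pfFuel-alternating zero    (_ ∷ X) a b Y = refl
        pfFuel-alternating (suc f) (c ∷ X) a b Y = wedge-alternating (B c) (pfFuel f) (pfFuel-alternating f) X a b Y
        pfFuel-alternating (suc zero) [] a b Y = begin
          (B a b * pfFuel 0 Y - wedge (B a) (λ _ → 0ℤ) Y) + (B b a * pfFuel 0 Y - wedge (B b) (λ _ → 0ℤ) Y)
            ≡⟨ cong₂ (λ x y → (B a b * pfFuel 0 Y - x) + (B b a * pfFuel 0 Y - y)) (zeros (B a)) (zeros (B b)) ⟩
          (B a b * pfFuel 0 Y - 0ℤ) + (B b a * pfFuel 0 Y - 0ℤ)
            ≡⟨ factor (B a b) (B b a) (pfFuel 0 Y) ⟩
          (B a b + B b a) * pfFuel 0 Y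
            ≡⟨ trans (cong (_* pfFuel 0 Y) (skew a b)) (*-zeroˡ (pfFuel 0 Y)) ⟩
          0ℤ ∎
          where
          zeros : ∀ φ → wedge φ (λ _ → 0ℤ) Y ≡ 0ℤ
          zeros φ = wedge-* φ 0ℤ (λ _ → 0ℤ) Y
          factor : ∀ x y p → (x * p - 0ℤ) + (y * p - 0ℤ) ≡ (x + y) * p
          factor = solve-∀
        pfFuel-alternating (suc (suc f)) [] a b Y = begin
          (B a b * p - wedge (B a) (wedge (B b) (pfFuel f)) Y) + (B b a * p - wedge (B b) (wedge (B a) (pfFuel f)) Y)
            ≡⟨ factor (B a b) (B b a) p _ _ ⟩
          (B a b + B b a) * p - (wedge (B a) (wedge (B b) (pfFuel f)) Y + wedge (B b) (wedge (B a) (pfFuel f)) Y)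
            ≡⟨ cong₂ (λ x y → x * p - y) (skew a b) (wedge-anti (B a) (B b) (pfFuel f) Y) ⟩
          0ℤ * p - 0ℤ
            ≡⟨ cong (_- 0ℤ) (*-zeroˡ p) ⟩
          0ℤ ∎
          where
          p = pfFuel (suc f) Y
          factor : ∀ x y p v w → (x * p - v) + (y * p - w) ≡ (x + y) * p - (v + w)
          factor = solve-∀

        pf-alternating : Alternating pf
        pf-alternating X a b Y = trans
          (cong (λ n → pfFuel (length (X ++ a ∷ b ∷ Y)) (X ++ a ∷ b ∷ Y) + pfFuel n (X ++ b ∷ a ∷ Y))
            (trans (length-++ X) (sym (length-++ X))))
          (pfFuel-alternating (length (X ++ a ∷ b ∷ Y)) X a b Y)

        module _ {c a b : I} (add : ∀ x → B c x ≡ B a x + B b x) where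

          addʳ : ∀ x → B x c ≡ B x a + B x b
          addʳ x = begin
            B x c                     ≡⟨ negate (B x c) (B c x) (skew x c) ⟩
            - B c x                   ≡⟨ cong -_ (add x) ⟩
            - (B a x + B b x)         ≡⟨ neg-distrib-+ (B a x) (B b x) ⟩
            - B a x + - B b x         ≡⟨ sym (cong₂ _+_ (negate (B x a) (B a x) (skew x a)) (negate (B x b) (B b x) (skew x b))) ⟩
            B x a + B x b ∎

          pfFuel-additive : ∀ f → Additive c a b (pfFuel f)
          pfFuel-additive zero    []      Y = refl
          pfFuel-additive zero    (_ ∷ X) Y = refl
          pfFuel-additive (suc f) []      Y = trans (wedge-cong Y add (λ _ _ → refl)) (wedge-+ˡ (B a) (B b) (pfFuel f) Y)
          pfFuel-additive (suc f) (v ∷ X) Y = wedge-additive (B v) (pfFuel f) (addʳ v) (pfFuel-additive f) X Y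

          pf-additive : Additive c a b pf
          pf-additive X Y = trans (pfFuel-additive (length (X ++ c ∷ Y)) X Y)
            (cong₂ (λ m n → pfFuel m (X ++ a ∷ Y) + pfFuel n (X ++ b ∷ Y))
              (trans (length-++ X) (sym (length-++ X))) (trans (length-++ X) (sym (length-++ X))))

    -- The first vector u is joined to its partner by Q or by K; this decides to which part of the
    -- splitting u belongs.
    pf-conv : ∀ Q K n L → length L ℕ.≤ n → pf (λ x y → Q x y + K x y) L ≡ conv (pf Q) (pf K) L
    pf-conv Q K n       []      _       = refl
    pf-conv Q K (suc n) (u ∷ L) (s≤s p) = begin
      pf B (u ∷ L)
        ≡⟨ pf-∷ B u L ⟩
      wedge (B u) (pf B) L
        ≡⟨ wedge-cong L (λ _ → refl) (λ X e → pf-conv Q K n X (ℕ.≤-trans (ℕ.n≤1+n (length X)) (ℕ.≤-trans (ℕ.≤-reflexive e) p))) ⟩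
      wedge (B u) (conv (pf Q) (pf K)) L
        ≡⟨ wedge-+ˡ (Q u) (K u) (conv (pf Q) (pf K)) L ⟩
      wedge (Q u) (conv (pf Q) (pf K)) L + wedge (K u) (conv (pf Q) (pf K)) L
        ≡⟨ cong₂ _+_ (wedge-convˡ (Q u) (pf Q) (pf K) L) (wedge-convʳ (K u) (pf Q) (pf K) L) ⟩
      conv (wedge (Q u) (pf Q)) (pf K) L + conv (pf Q ±) (wedge (K u) (pf K)) L
        ≡⟨ sym (cong₂ _+_ (conv-cong L (pf-∷ Q u) (λ _ → refl)) (conv-cong L (λ _ → refl) (pf-∷ K u))) ⟩
      conv (pf Q) (pf K) (u ∷ L) ∎
      where
      B : I → I → ℤ
      B x y = Q x y + K x y

-- Sums over all sublists as Pfaffians.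

module SubsetSums where
  open import Data.Nat.Base as ℕ using (ℕ; zero; suc; s≤s)
  import Data.Nat.Properties as ℕ
  open import Data.Integer.Base using (ℤ; +_; 0ℤ; 1ℤ; -1ℤ; _+_; _*_; _-_; -_)
  open import Data.Integer.Properties
  open import Data.Integer.Tactic.RingSolver using (solve-∀)
  open Pfaffian

  module Sublists (I : Set) where
    open Exterior I public

    AllPairs-resp-⊆ : ∀ {R : I → I → Set} {X Y} → X ⊆ Y → AllPairs R Y → AllPairs R X
    AllPairs-resp-⊆ []         []       = []
    AllPairs-resp-⊆ (_ ∷ʳ s)   (_ ∷ ps) = AllPairs-resp-⊆ s ps
    AllPairs-resp-⊆ (refl ∷ s) (p ∷ ps) = All-resp-⊆ s p ∷ AllPairs-resp-⊆ s ps

    wedge-cong-⊆ : ∀ {φ ψ F G} L → All (λ x → φ x ≡ ψ x) L →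
                   (∀ X → X ⊆ L → suc (length X) ≡ length L → F X ≡ G X) → wedge φ F L ≡ wedge ψ G L
    wedge-cong-⊆ []      eφ        eF = refl
    wedge-cong-⊆ (v ∷ L) (e ∷ eφ) eF = cong₂ _-_ (cong₂ _*_ e (eF L (v ∷ʳ ⊆-refl) refl))
      (wedge-cong-⊆ L eφ (λ X s l → eF (v ∷ X) (refl ∷ s) (cong suc l)))

    conv-cong-⊆ : ∀ {F G G′} L → (∀ X → X ⊆ L → G X ≡ G′ X) → conv F G L ≡ conv F G′ L
    conv-cong-⊆ {F} []      e = cong (F [] *_) (e [] [])
    conv-cong-⊆     (v ∷ L) e = cong₂ _+_ (conv-cong-⊆ L (λ X s → e X (v ∷ʳ s)))
                                          (conv-cong-⊆ L (λ X s → e (v ∷ X) (refl ∷ s)))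

    sub : Functional → Functional
    sub F []      = F []
    sub F (v ∷ L) = sub F L + sub (F at v) L

    -- The parts of sub with |A| ≡ |L| and |A| ≢ |L| modulo 2.
    sub₀ sub₁ : Functional → Functional
    sub₀ F []      = F []
    sub₀ F (v ∷ L) = sub₁ F L + sub₀ (F at v) L
    sub₁ F []      = 0ℤ
    sub₁ F (v ∷ L) = sub₀ F L + sub₁ (F at v) L

    sub-parity : ∀ F L → sub F L ≡ sub₀ F L + sub₁ F L
    sub-parity F []      = sym (+-identityʳ (F []))
    sub-parity F (v ∷ L) = trans (cong₂ _+_ (sub-parity F L) (sub-parity (F at v) L))
      (regroup (sub₀ F L) (sub₁ F L) (sub₀ (F at v) L) (sub₁ (F at v) L))
      where
      regroup : ∀ a b c d → (a + b) + (c + d) ≡ (b + c) + (a + d)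
      regroup = solve-∀

    sub-cong : ∀ {F G} L → (∀ X → F X ≡ G X) → sub F L ≡ sub G L
    sub-cong []      e = e []
    sub-cong (v ∷ L) e = cong₂ _+_ (sub-cong L e) (sub-cong L (λ X → e (v ∷ X)))

    sub-+ : ∀ F G L → sub (λ X → F X + G X) L ≡ sub F L + sub G L
    sub-+ F G []      = refl
    sub-+ F G (v ∷ L) = trans (cong₂ _+_ (sub-+ F G L) (sub-+ (F at v) (G at v) L))
      (interchange (sub F L) (sub G L) (sub (F at v) L) (sub (G at v) L))

    sub-zero : ∀ F L → (∀ X → F X ≡ 0ℤ) → sub F L ≡ 0ℤ
    sub-zero F []      z = z []
    sub-zero F (v ∷ L) z = cong₂ _+_ (sub-zero F L z) (sub-zero (F at v) L (λ X → z (v ∷ X)))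

    mutual
      sub₀-cong : ∀ {F G} L → (∀ X → F X ≡ G X) → sub₀ F L ≡ sub₀ G L
      sub₀-cong []      e = e []
      sub₀-cong (v ∷ L) e = cong₂ _+_ (sub₁-cong L e) (sub₀-cong L (λ X → e (v ∷ X)))
      sub₁-cong : ∀ {F G} L → (∀ X → F X ≡ G X) → sub₁ F L ≡ sub₁ G L
      sub₁-cong []      e = refl
      sub₁-cong (v ∷ L) e = cong₂ _+_ (sub₀-cong L e) (sub₁-cong L (λ X → e (v ∷ X)))

    mutual
      sub₀-neg : ∀ F L → sub₀ (λ X → - F X) L ≡ - sub₀ F L
      sub₀-neg F []      = refl
      sub₀-neg F (v ∷ L) = trans (cong₂ _+_ (sub₁-neg F L) (sub₀-neg (F at v) L)) (sym (neg-distrib-+ (sub₁ F L) _))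
      sub₁-neg : ∀ F L → sub₁ (λ X → - F X) L ≡ - sub₁ F L
      sub₁-neg F []      = refl
      sub₁-neg F (v ∷ L) = trans (cong₂ _+_ (sub₀-neg F L) (sub₁-neg (F at v) L)) (sym (neg-distrib-+ (sub₀ F L) _))

    mutual
      sub₀-± : ∀ F L → sub₀ (F ±) L ≡ sign (length L) * sub₀ F L
      sub₀-± F []      = refl
      sub₀-± F (v ∷ L) = trans
        (cong₂ _+_ (sub₁-± F L) (trans (sub₀-cong L (±-at F v)) (trans (sub₀-neg ((F at v) ±) L) (cong -_ (sub₀-± (F at v) L)))))
        (regroup (sign (length L)) (sub₁ F L) (sub₀ (F at v) L))
        where
        regroup : ∀ s a b → - (s * a) + - (s * b) ≡ - s * (a + b)
        regroup = solve-∀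
      sub₁-± : ∀ F L → sub₁ (F ±) L ≡ - (sign (length L) * sub₁ F L)
      sub₁-± F []      = refl
      sub₁-± F (v ∷ L) = trans
        (cong₂ _+_ (sub₀-± F L) (trans (sub₁-cong L (±-at F v)) (trans (sub₁-neg ((F at v) ±) L) (cong -_ (sub₁-± (F at v) L)))))
        (regroup (sign (length L)) (sub₀ F L) (sub₁ (F at v) L))
        where
        regroup : ∀ s a b → s * a + - - (s * b) ≡ - (- s * (a + b))
        regroup = solve-∀

    pfFuel-± : ∀ B f X → (pfFuel B f ±) X ≡ pfFuel B f X
    pfFuel-± B f       []      = refl
    pfFuel-± B zero    (u ∷ X) = *-zeroʳ (sign (suc (length X)))
    pfFuel-± B (suc f) (u ∷ X) = begin
      - sign (length X) * wedge (B u) (pfFuel B f) X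
        ≡⟨ sym (neg-distribˡ-* (sign (length X)) _) ⟩
      - (sign (length X) * wedge (B u) (pfFuel B f) X)
        ≡⟨ cong -_ (wedge-± (B u) (pfFuel B f) X) ⟩
      - - wedge (B u) (pfFuel B f ±) X
        ≡⟨ neg-involutive _ ⟩
      wedge (B u) (pfFuel B f ±) X
        ≡⟨ wedge-cong X (λ _ → refl) (λ Z _ → pfFuel-± B f Z) ⟩
      wedge (B u) (pfFuel B f) X ∎

    pf-± : ∀ B X → (pf B ±) X ≡ pf B X
    pf-± B X = pfFuel-± B (length X) X

    module Uniform (c : ℤ) (c²≡1 : c * c ≡ 1ℤ) (π : I → ℤ) where

      -- The Pfaffian of the form c π(x) π(y): c^k times the product of the π for length 2k, zero
      -- for odd length. `uniform′` is its odd companion, with c^{k+1} for length 2k + 1 and zero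
      -- for even length.
      uniform uniform′ : Functional
      uniform []       = 1ℤ
      uniform (v ∷ L)  = π v * uniform′ L
      uniform′ []      = 0ℤ
      uniform′ (v ∷ L) = c * (π v * uniform L)

      -- All terms of the expansion are the same product with alternating signs: an odd number of
      -- them leaves one, an even number none.
      wedge-uniform  : ∀ L → wedge π uniform L ≡ c * uniform′ L
      wedge-uniform′ : ∀ L → wedge π uniform′ L ≡ 0ℤ

      wedge-uniform []      = sym (*-zeroʳ c)
      wedge-uniform (v ∷ L) = begin
        π v * uniform L - wedge π (λ X → π v * uniform′ X) L
          ≡⟨ cong (λ x → π v * uniform L - x) (trans (wedge-* π (π v) uniform′ L) (trans (cong (π v *_) (wedge-uniform′ L)) (*-zeroʳ (π v)))) ⟩
        π v * uniform L - 0ℤ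
          ≡⟨ regroup (π v * uniform L) ⟩
        1ℤ * (π v * uniform L)
          ≡⟨ cong (_* (π v * uniform L)) (sym c²≡1) ⟩
        c * c * (π v * uniform L)
          ≡⟨ *-assoc c c (π v * uniform L) ⟩
        c * (c * (π v * uniform L)) ∎
        where
        regroup : ∀ x → x - 0ℤ ≡ 1ℤ * x
        regroup = solve-∀
      wedge-uniform′ []      = refl
      wedge-uniform′ (v ∷ L) = begin
        π v * uniform′ L - wedge π (λ X → c * (π v * uniform X)) L
          ≡⟨ cong (λ x → π v * uniform′ L - x) (trans (wedge-* π c (λ X → π v * uniform X) L)
               (cong (c *_) (trans (wedge-* π (π v) uniform L) (cong (π v *_) (wedge-uniform L))))) ⟩
        π v * uniform′ L - c * (π v * (c * uniform′ L))
          ≡⟨ regroup c (π v) (uniform′ L) ⟩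
        (1ℤ - c * c) * (π v * uniform′ L)
          ≡⟨ cong (λ x → (1ℤ - x) * (π v * uniform′ L)) c²≡1 ⟩
        0ℤ * (π v * uniform′ L)
          ≡⟨ *-zeroˡ (π v * uniform′ L) ⟩
        0ℤ ∎
        where
        regroup : ∀ c p u → p * u - c * (p * (c * u)) ≡ (1ℤ - c * c) * (p * u)
        regroup = solve-∀

      pf-uniform : ∀ {B} n L → length L ℕ.≤ n → AllPairs (λ x y → B x y ≡ c * (π x * π y)) L → pf B L ≡ uniform L
      pf-uniform     n       []      _       _        = refl
      pf-uniform {B} (suc n) (u ∷ L) (s≤s l) (p ∷ ps) = begin
        pf B (u ∷ L)
          ≡⟨ pf-∷ B u L ⟩
        wedge (B u) (pf B) L
          ≡⟨ wedge-cong-⊆ {ψ = λ x → c * π u * π x} L (All.map (λ e → trans e (sym (*-assoc c (π u) _))) p)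
               (λ X s e → pf-uniform n X (ℕ.≤-trans (ℕ.n≤1+n (length X)) (ℕ.≤-trans (ℕ.≤-reflexive e) l)) (AllPairs-resp-⊆ s ps)) ⟩
        wedge (λ x → c * π u * π x) uniform L
          ≡⟨ wedge-*ˡ (c * π u) π uniform L ⟩
        c * π u * wedge π uniform L
          ≡⟨ cong (c * π u *_) (wedge-uniform L) ⟩
        c * π u * (c * uniform′ L)
          ≡⟨ regroup c (π u) (uniform′ L) ⟩
        c * c * (π u * uniform′ L)
          ≡⟨ trans (cong (_* (π u * uniform′ L)) c²≡1) (*-identityˡ (π u * uniform′ L)) ⟩
        π u * uniform′ L ∎
        where
        regroup : ∀ c p u → c * p * (c * u) ≡ c * c * (p * u)
        regroup = solve-∀

    module _ (π : I → ℤ) where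
      open Uniform -1ℤ refl π

      -- With these signs and c = -1, the Pfaffian of K on the complement is exactly the shuffle
      -- sign of the splitting, so all signs in `conv` cancel.
      Alternate : List I → Set
      Alternate []      = ⊤
      Alternate (v ∷ L) = π v ≡ sign (length L) × Alternate L

      conv-* : ∀ F k G L → conv F (λ X → k * G X) L ≡ k * conv F G L
      conv-* F k G []      = swap (F []) k (G [])
        where
        swap : ∀ f k g → f * (k * g) ≡ k * (f * g)
        swap = solve-∀
      conv-* F k G (v ∷ L) = trans (cong₂ _+_ (conv-* (F at v) k G L) (conv-* (F ±) k (G at v) L)) (sym (*-distribˡ-+ k _ _))

      conv-uniform  : ∀ F L → Alternate L → conv F uniform L ≡ sub₀ F L
      conv-uniform′ : ∀ F L → Alternate L → conv F uniform′ L ≡ - sub₁ F L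

      conv-uniform F []      _       = *-identityʳ (F [])
      conv-uniform F (v ∷ L) (e , a) = begin
        conv (F at v) uniform L + conv (F ±) (λ X → π v * uniform′ X) L
          ≡⟨ cong₂ _+_ (conv-uniform (F at v) L a) (trans (conv-* (F ±) (π v) uniform′ L) (cong₂ _*_ e (trans (conv-uniform′ (F ±) L a) (cong -_ (sub₁-± F L))))) ⟩
        sub₀ (F at v) L + s * - - (s * sub₁ F L)
          ≡⟨ regroup (sub₀ (F at v) L) s (sub₁ F L) ⟩
        s * s * sub₁ F L + sub₀ (F at v) L
          ≡⟨ cong (_+ sub₀ (F at v) L) (trans (cong (_* sub₁ F L) (sign² (length L))) (*-identityˡ (sub₁ F L))) ⟩
        sub₁ F L + sub₀ (F at v) L ∎
        where
        s = sign (length L)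
        regroup : ∀ a s b → a + s * - - (s * b) ≡ s * s * b + a
        regroup = solve-∀
      conv-uniform′ F []      _       = *-zeroʳ (F [])
      conv-uniform′ F (v ∷ L) (e , a) = begin
        conv (F at v) uniform′ L + conv (F ±) (λ X → -1ℤ * (π v * uniform X)) L
          ≡⟨ cong₂ _+_ (conv-uniform′ (F at v) L a)
               (trans (conv-* (F ±) -1ℤ (λ X → π v * uniform X) L) (cong (-1ℤ *_)
                 (trans (conv-* (F ±) (π v) uniform L) (cong₂ _*_ e (trans (conv-uniform (F ±) L a) (sub₀-± F L)))))) ⟩
        - sub₁ (F at v) L + -1ℤ * (s * (s * sub₀ F L))
          ≡⟨ regroup (sub₁ (F at v) L) s (sub₀ F L) ⟩
        - (s * s * sub₀ F L + sub₁ (F at v) L)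
          ≡⟨ cong (λ x → - (x + sub₁ (F at v) L)) (trans (cong (_* sub₀ F L) (sign² (length L))) (*-identityˡ (sub₀ F L))) ⟩
        - (sub₀ F L + sub₁ (F at v) L) ∎
        where
        s = sign (length L)
        regroup : ∀ a s b → - a + -1ℤ * (s * (s * b)) ≡ - (s * s * b + a)
        regroup = solve-∀

      -- `pf-conv` yields the sublists with even complement, each with sign 1. As L has even length
      -- these are the sublists of even length, and the others add nothing since `pf Q` is zero on
      -- odd lists.
      pf-sub : ∀ Q K L → AllPairs (λ x y → K x y ≡ -1ℤ * (π x * π y)) L → Alternate L → sign (length L) ≡ 1ℤ →
               pf (λ x y → Q x y + K x y) L ≡ sub (pf Q) L
      pf-sub Q K L ps a even = begin
        pf (λ x y → Q x y + K x y) L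
          ≡⟨ pf-conv Q K (length L) L ℕ.≤-refl ⟩
        conv (pf Q) (pf K) L
          ≡⟨ conv-cong-⊆ L (λ X s → pf-uniform (length X) X ℕ.≤-refl (AllPairs-resp-⊆ s ps)) ⟩
        conv (pf Q) uniform L
          ≡⟨ conv-uniform (pf Q) L a ⟩
        sub₀ (pf Q) L
          ≡⟨ sym (+-identityʳ _) ⟩
        sub₀ (pf Q) L + 0ℤ
          ≡⟨ cong (λ x → sub₀ (pf Q) L + x) (sym vanish) ⟩
        sub₀ (pf Q) L + sub₁ (pf Q) L
          ≡⟨ sym (sub-parity (pf Q) L) ⟩
        sub (pf Q) L ∎
        where
        vanish : sub₁ (pf Q) L ≡ 0ℤ
        vanish = self-negative (sub₁ (pf Q) L) (begin
          sub₁ (pf Q) L                           ≡⟨ sub₁-cong L (λ X → sym (pf-± Q X)) ⟩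
          sub₁ (pf Q ±) L                         ≡⟨ sub₁-± (pf Q) L ⟩
          - (sign (length L) * sub₁ (pf Q) L)     ≡⟨ cong (λ s → - (s * sub₁ (pf Q) L)) even ⟩
          - (1ℤ * sub₁ (pf Q) L)                  ≡⟨ cong -_ (*-identityˡ (sub₁ (pf Q) L)) ⟩
          - sub₁ (pf Q) L ∎)

-- The skew forms on labelled polynomials.

module Forms where
  open import Data.Nat.Base as ℕ using (ℕ; zero; suc; s≤s)
  import Data.Nat.Properties as ℕ
  open import Data.Integer.Base using (ℤ; +_; 0ℤ; 1ℤ; -1ℤ; _+_; _*_; _-_; -_)
  open import Data.Integer.Properties
  open import Data.Integer.Tactic.RingSolver using (solve-∀)
  open Binomials
  open Kernel
  open Telescoping
  open Ratios
  open Pfaffian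
  open SubsetSums

  -- lab p k stands for the polynomial x^p (1+x)^k.
  data Label : Set where
    lab : ℕ → ℕ → Label
    inf om : Label

  open Sublists Label public

  -- The bilinear extension of sign (a - c) from monomials to x^a (1+x)^b, summed by Vandermonde's
  -- identity. On `inf` it is p(1).
  Q : Label → Label → ℤ
  Q (lab a b) (lab c d) = binDiff (b ℕ.+ d) (+ c + + d - + a)
  Q (lab a b) inf       = pow2 b
  Q inf (lab a b)       = - pow2 b
  Q _ _                 = 0ℤ

  -- The substitution x ↦ -1 - x sends x^a (1+x)^b to (-1)^{a+b} x^b (1+x)^a. The pairing of p with
  -- `inf` is p(-2), that with `om` is - p(-2).
  K : Label → Label → ℤ
  K (lab a b) (lab c d) = - (sign (a ℕ.+ b) * sign (c ℕ.+ d) * Q (lab b a) (lab d c))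
  K (lab a b) inf       = sign (a ℕ.+ b) * pow2 a
  K inf (lab a b)       = - (sign (a ℕ.+ b) * pow2 a)
  K (lab a b) om        = - (sign (a ℕ.+ b) * pow2 a)
  K om (lab a b)        = sign (a ℕ.+ b) * pow2 a
  K inf om              = 1ℤ
  K om inf              = -1ℤ
  K inf inf             = 0ℤ
  K om om               = 0ℤ

  B : Label → Label → ℤ
  B x y = Q x y + K x y

  Q-skew : ∀ x y → Q x y + Q y x ≡ 0ℤ
  Q-skew (lab a b) (lab c d) = trans (cong (λ x → Q (lab a b) (lab c d) + x) (begin
      binDiff (d ℕ.+ b) (+ a + + b - + c)
        ≡⟨ cong₂ binDiff (ℕ.+-comm d b) (shift (+ a) (+ b) (+ c) (+ d)) ⟩
      binDiff (b ℕ.+ d) (+ (b ℕ.+ d) - (+ c + + d - + a))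
        ≡⟨ binDiff-reflect (b ℕ.+ d) (+ c + + d - + a) ⟩
      - Q (lab a b) (lab c d) ∎))
    (+-inverseʳ (Q (lab a b) (lab c d)))
    where
    shift : ∀ a b c d → a + b - c ≡ (b + d) - (c + d - a)
    shift = solve-∀
  Q-skew (lab a b) inf = +-inverseʳ (pow2 b)
  Q-skew inf (lab a b) = +-inverseˡ (pow2 b)
  Q-skew (lab _ _) om  = refl
  Q-skew om (lab _ _)  = refl
  Q-skew inf inf       = refl
  Q-skew inf om        = refl
  Q-skew om inf        = refl
  Q-skew om om         = refl

  K-skew : ∀ x y → K x y + K y x ≡ 0ℤ
  K-skew (lab a b) (lab c d) = trans (factor (sign (a ℕ.+ b)) (sign (c ℕ.+ d)) (Q (lab b a) (lab d c)) (Q (lab d c) (lab b a)))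
    (trans (cong (λ x → - (sign (a ℕ.+ b) * sign (c ℕ.+ d) * x)) (Q-skew (lab b a) (lab d c)))
           (cong -_ (*-zeroʳ (sign (a ℕ.+ b) * sign (c ℕ.+ d)))))
    where
    factor : ∀ s t x y → - (s * t * x) + - (t * s * y) ≡ - (s * t * (x + y))
    factor = solve-∀
  K-skew (lab a b) inf = +-inverseʳ (sign (a ℕ.+ b) * pow2 a)
  K-skew inf (lab a b) = +-inverseˡ (sign (a ℕ.+ b) * pow2 a)
  K-skew (lab a b) om  = +-inverseˡ (sign (a ℕ.+ b) * pow2 a)
  K-skew om (lab a b)  = +-inverseʳ (sign (a ℕ.+ b) * pow2 a)
  K-skew inf inf       = refl
  K-skew inf om        = refl
  K-skew om inf        = refl
  K-skew om om         = refl

  B-skew : ∀ x y → B x y + B y x ≡ 0ℤ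
  B-skew x y = trans (interchange (Q x y) (K x y) (Q y x) (K y x)) (cong₂ _+_ (Q-skew x y) (K-skew x y))

  Q-additive : ∀ a b x → Q (lab a (suc b)) x ≡ Q (lab a b) x + Q (lab (suc a) b) x
  Q-additive a b (lab c d) = cong (λ r → binDiff (b ℕ.+ d) (+ c + + d - + a) + binDiff (b ℕ.+ d) r) (shift (+ a) (+ c) (+ d))
    where
    shift : ∀ a c d → c + d - a - 1ℤ ≡ c + d - (1ℤ + a)
    shift = solve-∀
  Q-additive a b inf = refl
  Q-additive a b om  = refl

  K-additive : ∀ a b x → K (lab a (suc b)) x ≡ K (lab a b) x + K (lab (suc a) b) x
  K-additive a b (lab c d) = begin
    - (sign (a ℕ.+ suc b) * s * Q (lab (suc b) a) (lab d c))
      ≡⟨ cong (λ n → - (sign n * s * Q (lab (suc b) a) (lab d c))) (ℕ.+-suc a b) ⟩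
    - (- σ * s * Q (lab (suc b) a) (lab d c))
      ≡⟨ regroup σ s (Q (lab b a) (lab d c)) (Q (lab (suc b) a) (lab d c)) ⟩
    - (σ * s * Q (lab b a) (lab d c)) + - (- σ * s * (Q (lab b a) (lab d c) + Q (lab (suc b) a) (lab d c)))
      ≡⟨ cong (λ x → - (σ * s * Q (lab b a) (lab d c)) + - (- σ * s * x)) (sym (Q-additive b a (lab d c))) ⟩
    - (σ * s * Q (lab b a) (lab d c)) + - (- σ * s * Q (lab b (suc a)) (lab d c)) ∎
    where
    σ = sign (a ℕ.+ b)
    s = sign (c ℕ.+ d)
    regroup : ∀ σ s p q → - (- σ * s * q) ≡ - (σ * s * p) + - (- σ * s * (p + q))
    regroup = solve-∀
  K-additive a b inf = trans (cong (λ n → sign n * pow2 a) (ℕ.+-suc a b)) (regroup (sign (a ℕ.+ b)) (pow2 a))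
    where
    regroup : ∀ s p → - s * p ≡ s * p + - s * (p + p)
    regroup = solve-∀
  K-additive a b om = trans (cong (λ n → - (sign n * pow2 a)) (ℕ.+-suc a b)) (regroup (sign (a ℕ.+ b)) (pow2 a))
    where
    regroup : ∀ s p → - (- s * p) ≡ - (s * p) + - (- s * (p + p))
    regroup = solve-∀

  B-additive : ∀ a b x → B (lab a (suc b)) x ≡ B (lab a b) x + B (lab (suc a) b) x
  B-additive a b x = trans (cong₂ _+_ (Q-additive a b x) (K-additive a b x))
    (interchange (Q (lab a b) x) (Q (lab (suc a) b) x) (K (lab a b) x) (K (lab (suc a) b) x))

  -- `lab 0 j` is a path that enters at position 0 with j steps to go, so there is one vector for
  -- each possible time of entry.
  starts : ℕ → List Label → List Label
  starts zero    E = E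
  starts (suc k) E = lab 0 k ∷ starts k E

  starts-∈ : ∀ {k m} E → k ℕ.< m → lab 0 k ∈ starts m E
  starts-∈ {k} {suc m} E (s≤s k≤m) with ℕ.m≤n⇒m<n∨m≡n k≤m
  ... | inj₁ k<m  = there (starts-∈ E k<m)
  ... | inj₂ refl = here refl

  starts-∈ʳ : ∀ {x} m {E} → x ∈ E → x ∈ starts m E
  starts-∈ʳ zero    x∈E = x∈E
  starts-∈ʳ (suc m) x∈E = there (starts-∈ʳ m x∈E)

  starts-all : ∀ {P : Label → Set} m {E} → (∀ k → k ℕ.< m → P (lab 0 k)) → All P E → All P (starts m E)
  starts-all zero    p e = e
  starts-all (suc m) p e = p m ℕ.≤-refl ∷ starts-all m (λ k k<m → p k (ℕ.m≤n⇒m≤1+n k<m)) e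

  -- An even set of starting vectors contributes without `inf`, an odd one together with it.
  families : ℕ → ℤ
  families m = sub (pf Q) (starts m (inf ∷ []))

  sign-double : ∀ n → sign (n ℕ.+ n) ≡ 1ℤ
  sign-double zero    = refl
  sign-double (suc n) = trans (cong (λ k → - sign k) (ℕ.+-suc n n)) (trans (neg-involutive (sign (n ℕ.+ n))) (sign-double n))

  Q-starts : ∀ {a c} → c ℕ.< a → Q (lab a 0) (lab c 0) ≡ 1ℤ
  Q-starts {a} {c} c<a = cong (binDiff 0)
    (trans (cong (λ x → + c + 0ℤ - + x) (sym (ℕ.m+[n∸m]≡n c<a))) (difference (+ c) (+ (a ℕ.∸ suc c))))
    where
    difference : ∀ c d → c + 0ℤ - (1ℤ + (c + d)) ≡ - (1ℤ + d)
    difference = solve-∀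

  K-starts : ∀ {a c} → c ℕ.< a → K (lab 0 a) (lab 0 c) ≡ -1ℤ * (sign a * sign c)
  K-starts {a} {c} c<a = trans (cong (λ x → - (sign a * sign c * x)) (Q-starts c<a)) (regroup (sign a) (sign c))
    where
    regroup : ∀ s t → - (s * t * 1ℤ) ≡ -1ℤ * (s * t)
    regroup = solve-∀

  length-starts : ∀ m E → length (starts m E) ≡ m ℕ.+ length E
  length-starts zero    E = refl
  length-starts (suc m) E = cong suc (length-starts m E)

  -- For odd m the list ending in `inf` has even length, and signs alternating along it factor `K`;
  -- so `pf-sub` applies.
  families-odd : ∀ n → families (suc (n ℕ.+ n)) ≡ pf B (starts (suc (n ℕ.+ n)) (inf ∷ []))
  families-odd n = sym (pf-sub π Q K (starts m (inf ∷ [])) (pairs m) (alternate m) even)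
    where
    m = suc (n ℕ.+ n)
    π : Label → ℤ
    π (lab _ b) = - sign b
    π _         = 1ℤ
    alternate : ∀ m → Alternate π (starts m (inf ∷ []))
    alternate zero    = refl , tt
    alternate (suc m) = cong sign (sym (trans (length-starts m (inf ∷ [])) (ℕ.+-comm m 1))) , alternate m
    pairs : ∀ m → AllPairs (λ x y → K x y ≡ -1ℤ * (π x * π y)) (starts m (inf ∷ []))
    pairs zero    = [] ∷ []
    pairs (suc m) = starts-all m (λ c c<m → trans (K-starts c<m) (cong (-1ℤ *_) (signs (sign m) (sign c)))) (unit (sign m) ∷ []) ∷ pairs m
      where
      signs : ∀ s t → s * t ≡ - s * - t
      signs = solve-∀
      unit : ∀ s → s * 1ℤ ≡ -1ℤ * (- s * 1ℤ)
      unit = solve-∀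
    even : sign (length (starts m (inf ∷ []))) ≡ 1ℤ
    even = trans (cong sign (trans (length-starts m (inf ∷ [])) (trans (ℕ.+-comm m 1) (cong suc (sym (ℕ.+-suc n n)))))) (sign-double (suc n))

  om-vanish : ∀ X Y → pf Q (X ++ om ∷ Y) ≡ 0ℤ
  om-vanish X Y = idempotent (pf Q (X ++ om ∷ Y)) (pf-additive Q Q-skew {om} {om} {om} zeros X Y)
    where
    zeros : ∀ x → Q om x ≡ Q om x + Q om x
    zeros (lab _ _) = refl
    zeros inf       = refl
    zeros om        = refl
    idempotent : ∀ x → x ≡ x + x → x ≡ 0ℤ
    idempotent x e = trans (sym (identity x)) (i≡j⇒i-j≡0 (sym e))
      where
      identity : ∀ x → x + x - x ≡ x
      identity = solve-∀

  sub-om : ∀ F m → (∀ X Y → F (X ++ om ∷ Y) ≡ 0ℤ) → sub F (starts m (inf ∷ om ∷ [])) ≡ sub F (starts m (inf ∷ []))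
  sub-om F zero    z = trans (cong₂ (λ a b → F [] + a + (F (inf ∷ []) + b)) (z [] []) (z (inf ∷ []) [])) (drop (F []) (F (inf ∷ [])))
    where
    drop : ∀ a b → a + 0ℤ + (b + 0ℤ) ≡ a + b
    drop = solve-∀
  sub-om F (suc m) z = cong₂ _+_ (sub-om F m z) (sub-om (F at lab 0 m) m (λ X → z (lab 0 m ∷ X)))

  -- Here `om` makes the length even. Since `Q` vanishes on it, sublists containing `om` contribute
  -- nothing to the sum.
  families-even : ∀ n → families (n ℕ.+ n) ≡ pf B (starts (n ℕ.+ n) (inf ∷ om ∷ []))
  families-even n = trans (sym (sub-om (pf Q) m om-vanish))
    (sym (pf-sub π Q K (starts m (inf ∷ om ∷ [])) (pairs m) (alternate m) even))
    where
    m = n ℕ.+ n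
    π : Label → ℤ
    π (lab _ b) = sign b
    π inf       = -1ℤ
    π om        = 1ℤ
    alternate : ∀ m → Alternate π (starts m (inf ∷ om ∷ []))
    alternate zero    = refl , refl , tt
    alternate (suc m) = trans (sym (neg-involutive (sign m))) (cong sign (sym (trans (length-starts m (inf ∷ om ∷ [])) (ℕ.+-comm m 2)))) , alternate m
    pairs : ∀ m → AllPairs (λ x y → K x y ≡ -1ℤ * (π x * π y)) (starts m (inf ∷ om ∷ []))
    pairs zero    = (refl ∷ []) ∷ [] ∷ []
    pairs (suc m) = starts-all m (λ c c<m → K-starts c<m) (unit (sign m) ∷ unit′ (sign m) ∷ []) ∷ pairs m
      where
      unit : ∀ s → s * 1ℤ ≡ -1ℤ * (s * -1ℤ)
      unit = solve-∀
      unit′ : ∀ s → - (s * 1ℤ) ≡ -1ℤ * (s * 1ℤ)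
      unit′ = solve-∀
    even : sign (length (starts m (inf ∷ om ∷ []))) ≡ 1ℤ
    even = trans (cong sign (trans (length-starts m (inf ∷ om ∷ [])) (trans (ℕ.+-comm m 2) (cong suc (sym (ℕ.+-suc n n)))))) (sign-double (suc n))

-- Replacing the top vector by an orthogonal polynomial; the case of odd m.

module OddElimination where
  open import Data.Nat.Base as ℕ using (ℕ; zero; suc; s≤s)
  import Data.Nat.Properties as ℕ
  open import Data.Integer.Base using (ℤ; +_; 0ℤ; 1ℤ; -1ℤ; _+_; _*_; _-_; -_)
  open import Data.Integer.Properties
  open import Data.Integer.Tactic.RingSolver using (solve-∀)
  open Binomials
  open Kernel
  open Telescoping
  open Orthogonality using (module Odd)
  open Ratios
  open Pfaffian
  open SubsetSums
  open Forms

  B-additiveʳ : ∀ x a b → B x (lab a (suc b)) ≡ B x (lab a b) + B x (lab (suc a) b)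
  B-additiveʳ x a b = addʳ B B-skew {lab a (suc b)} {lab a b} {lab (suc a) b} (B-additive a b) x

  module Replacement (E : List Label) (m : ℕ) where

    rest : List Label
    rest = starts (suc m) E

    -- Extended linearly, Θ kills the polynomials of degree at most m, which the rest already spans,
    -- and is constant on monic polynomials of degree m + 1; see `Θ-low` and `Θ-top`.
    Θ : Label → ℤ
    Θ ℓ = pf B (ℓ ∷ rest)

    Θ-additive : ∀ a b → Θ (lab a (suc b)) ≡ Θ (lab a b) + Θ (lab (suc a) b)
    Θ-additive a b = pf-additive B B-skew {lab a (suc b)} {lab a b} {lab (suc a) b} (B-additive a b) [] rest

    Θ-suc : ∀ a b → Θ (lab (suc a) b) ≡ Θ (lab a (suc b)) - Θ (lab a b)
    Θ-suc a b = trans (identity (Θ (lab a b)) (Θ (lab (suc a) b))) (cong (_- Θ (lab a b)) (sym (Θ-additive a b)))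
      where
      identity : ∀ x y → y ≡ x + y - x
      identity = solve-∀

    Θ-∈ : ∀ ℓ → ℓ ∈ rest → Θ ℓ ≡ 0ℤ
    Θ-∈ ℓ ℓ∈ = alternating-repeat (pf B) (pf-alternating B B-skew) ℓ rest ℓ∈

    Θ-low : ∀ a b → a ℕ.+ b ℕ.≤ m → Θ (lab a b) ≡ 0ℤ
    Θ-low zero    b b≤m = Θ-∈ (lab 0 b) (starts-∈ E (s≤s b≤m))
    Θ-low (suc a) b l   = trans (Θ-suc a b) (cong₂ _-_
      (Θ-low a (suc b) (ℕ.≤-trans (ℕ.≤-reflexive (ℕ.+-suc a b)) l)) (Θ-low a b (ℕ.<⇒≤ l)))

    Θ-top : ∀ a b → a ℕ.+ b ≡ suc m → Θ (lab a b) ≡ pf B (starts (suc (suc m)) E)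
    Θ-top zero    b refl = refl
    Θ-top (suc a) b e    = trans (Θ-suc a b) (trans
      (cong₂ _-_ (Θ-top a (suc b) (trans (ℕ.+-suc a b) e)) (Θ-low a b (ℕ.≤-reflexive (ℕ.suc-injective e))))
      (+-identityʳ (pf B (starts (suc (suc m)) E))))

    Θ-combination : ∀ n (g : ℕ → ℤ) (ℓ : ℕ → Label) →
      ∑ n (λ i → g i * Θ (ℓ i)) ≡ wedge (λ x → ∑ n (λ i → g i * B (ℓ i) x)) (pf B) rest
    Θ-combination zero    g ℓ = sym (wedge-zeroˡ (λ _ → 0ℤ) (pf B) rest (λ _ _ → refl))
    Θ-combination (suc n) g ℓ = trans
      (cong₂ _+_ (Θ-combination n g ℓ) (trans (cong (g n *_) (pf-∷ B (ℓ n) rest)) (sym (wedge-*ˡ (g n) (B (ℓ n)) (pf B) rest))))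
      (sym (wedge-+ˡ (λ x → ∑ n (λ i → g i * B (ℓ i) x)) (λ x → g n * B (ℓ n) x) (pf B) rest))

    -- If the new top vector is orthogonal to all but (1+x)^m, the expansion along its row has one
    -- term, and N_m appears as the remaining Pfaffian.
    wedge-rest : ∀ ψ → All (λ x → ψ x ≡ 0ℤ) (starts m E) → wedge ψ (pf B) rest ≡ ψ (lab 0 m) * pf B (starts m E)
    wedge-rest ψ z = trans (cong (λ x → ψ (lab 0 m) * pf B (starts m E) - x)
        (wedge-zeroˡ ψ (pf B at lab 0 m) (starts m E) (λ x x∈ → All.lookup z x∈)))
      (+-identityʳ (ψ (lab 0 m) * pf B (starts m E)))

  -- A functional on labels that is odd (resp. even) under x ↦ - 1 - x is determined by its values
  -- near the diagonal.
  module Reduction (ψ : ℕ → ℕ → ℤ) (add : ∀ a b → ψ a (suc b) ≡ ψ a b + ψ (suc a) b) where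

    -- The gap between the exponents of 1 + x and x drops from d + 2 to d + 1 and d, so gaps 0 and 1
    -- determine everything.
    step : ∀ p d {x y} → ψ p (p ℕ.+ suc d) ≡ x → ψ (suc p) (suc p ℕ.+ d) ≡ y → ψ p (p ℕ.+ suc (suc d)) ≡ x + y
    step p d e₁ e₂ = trans (cong (ψ p) (ℕ.+-suc p (suc d)))
      (trans (add p (p ℕ.+ suc d)) (cong₂ _+_ e₁ (trans (cong (ψ (suc p)) (ℕ.+-suc p d)) e₂)))

    vanish : ∀ M → (∀ p → p ℕ.+ p ℕ.≤ M → ψ p (p ℕ.+ 0) ≡ 0ℤ) → (∀ p → p ℕ.+ p ℕ.+ 1 ℕ.≤ M → ψ p (p ℕ.+ 1) ≡ 0ℤ) →
             ∀ d p → p ℕ.+ p ℕ.+ d ℕ.≤ M → ψ p (p ℕ.+ d) ≡ 0ℤ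
    vanish M z₀ z₁ zero          p l = z₀ p (subst (ℕ._≤ M) (ℕ.+-identityʳ (p ℕ.+ p)) l)
    vanish M z₀ z₁ (suc zero)    p l = z₁ p l
    vanish M z₀ z₁ (suc (suc d)) p l = step p d
      (vanish M z₀ z₁ (suc d) p (ℕ.≤-trans (ℕ.+-monoʳ-≤ (p ℕ.+ p) (ℕ.n≤1+n (suc d))) l))
      (vanish M z₀ z₁ d (suc p) (ℕ.≤-trans (ℕ.≤-reflexive (shift p d)) l))
      where
      shift : ∀ p d → suc p ℕ.+ suc p ℕ.+ d ≡ p ℕ.+ p ℕ.+ suc (suc d)
      shift p d = trans (cong (λ k → suc (k ℕ.+ d)) (ℕ.+-suc p p))
                  (trans (cong suc (sym (ℕ.+-suc (p ℕ.+ p) d))) (sym (ℕ.+-suc (p ℕ.+ p) (suc d))))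

    -- In degree M the first summand of `step` has lower degree and vanishes; each round turns one
    -- factor 1 + x into x.
    climb : ∀ M → (∀ d p → p ℕ.+ p ℕ.+ d ℕ.< M → ψ p (p ℕ.+ d) ≡ 0ℤ) →
            ∀ k p d → p ℕ.+ p ℕ.+ (k ℕ.+ k ℕ.+ d) ≡ M → ψ p (p ℕ.+ (k ℕ.+ k ℕ.+ d)) ≡ ψ (k ℕ.+ p) (k ℕ.+ p ℕ.+ d)
    climb M z zero    p d e = refl
    climb M z (suc k) p d e = trans (cong (λ x → ψ p (p ℕ.+ x)) shape)
      (trans (step p (k ℕ.+ k ℕ.+ d)
        (z (suc (k ℕ.+ k ℕ.+ d)) p (ℕ.≤-reflexive (trans (sym (ℕ.+-suc (p ℕ.+ p) _)) e′)))
        (climb M z k (suc p) d (trans shift e′)))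
      (trans (+-identityˡ (ψ (k ℕ.+ suc p) (k ℕ.+ suc p ℕ.+ d))) (cong (λ x → ψ x (x ℕ.+ d)) (ℕ.+-suc k p))))
      where
      shape : suc k ℕ.+ suc k ℕ.+ d ≡ suc (suc (k ℕ.+ k ℕ.+ d))
      shape = cong (λ x → suc (x ℕ.+ d)) (ℕ.+-suc k k)
      e′ : p ℕ.+ p ℕ.+ suc (suc (k ℕ.+ k ℕ.+ d)) ≡ M
      e′ = trans (cong (p ℕ.+ p ℕ.+_) (sym shape)) e
      shift : suc p ℕ.+ suc p ℕ.+ (k ℕ.+ k ℕ.+ d) ≡ p ℕ.+ p ℕ.+ suc (suc (k ℕ.+ k ℕ.+ d))
      shift = trans (cong (λ x → suc (x ℕ.+ (k ℕ.+ k ℕ.+ d))) (ℕ.+-suc p p))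
              (trans (cong suc (sym (ℕ.+-suc (p ℕ.+ p) _))) (sym (ℕ.+-suc (p ℕ.+ p) _)))

  diagonal-sum : ∀ n → ∀ p → p ℕ.+ p ℕ.+ 1 ℕ.≤ n ℕ.+ n → p ℕ.< n
  diagonal-sum n p l = ℕ.≰⇒> (λ n≤p → ℕ.<-irrefl refl (ℕ.≤-trans (ℕ.≤-trans (ℕ.≤-reflexive (ℕ.+-comm 1 (p ℕ.+ p))) l) (ℕ.+-mono-≤ n≤p n≤p)))

  odd-diagonal : ∀ j → sign (j ℕ.+ suc j) ≡ -1ℤ
  odd-diagonal j = trans (cong sign (ℕ.+-suc j j)) (cong -_ (sign-double j))

  B-diagonal : ∀ i p q → B (lab i i) (lab p q) ≡ Q (lab i i) (lab p q) - sign (p ℕ.+ q) * Q (lab i i) (lab q p)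
  B-diagonal i p q = trans (cong (λ s → Q (lab i i) (lab p q) + - (s * sign (p ℕ.+ q) * Q (lab i i) (lab q p))) (sign-double i))
    (identity (Q (lab i i) (lab p q)) (sign (p ℕ.+ q)) (Q (lab i i) (lab q p)))
    where
    identity : ∀ x s y → x + - (1ℤ * s * y) ≡ x - s * y
    identity = solve-∀

  B-cross : ∀ i j → B (lab i i) (lab j (suc j)) ≡ cross i j
  B-cross i j = trans (B-diagonal i j (suc j))
    (trans (cong (λ s → Q (lab i i) (lab j (suc j)) - s * Q (lab i i) (lab (suc j) j)) (odd-diagonal j))
           (identity (Q (lab i i) (lab j (suc j))) (Q (lab i i) (lab (suc j) j))))
    where
    identity : ∀ x y → x - -1ℤ * y ≡ x + y
    identity = solve-∀

  B-cross′ : ∀ i j → B (lab i i) (lab (suc j) j) ≡ cross i j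
  B-cross′ i j = trans (B-diagonal i (suc j) j)
    (trans (cong (λ s → Q (lab i i) (lab (suc j) j) - - s * Q (lab i i) (lab j (suc j))) (sign-double j))
           (identity (Q (lab i i) (lab (suc j) j)) (Q (lab i i) (lab j (suc j)))))
    where
    identity : ∀ x y → x - - 1ℤ * y ≡ y + x
    identity = solve-∀

  -- The substitution x ↦ -1 - x in both arguments changes the sign of `B`, and w^i is invariant
  -- under it.
  B-diagonal-anti : ∀ i p q → B (lab i i) (lab p q) ≡ - (sign (p ℕ.+ q) * B (lab i i) (lab q p))
  B-diagonal-anti i p q = begin
    B (lab i i) (lab p q)            ≡⟨ B-diagonal i p q ⟩
    x - s * y                        ≡⟨ identity s x y ⟩
    x * (1ℤ - s * s) + - (s * (y - s * x))
      ≡⟨ cong₂ (λ a b → x * (1ℤ - a) + - (s * b)) (sign² (p ℕ.+ q))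
           (trans (cong (λ k → y - sign k * x) (ℕ.+-comm p q)) (sym (B-diagonal i q p))) ⟩
    x * 0ℤ + - (s * B (lab i i) (lab q p)) ≡⟨ trans (cong (_+ - (s * B (lab i i) (lab q p))) (*-zeroʳ x)) (+-identityˡ (- (s * B (lab i i) (lab q p)))) ⟩
    - (s * B (lab i i) (lab q p)) ∎
    where
    s = sign (p ℕ.+ q)
    x = Q (lab i i) (lab p q)
    y = Q (lab i i) (lab q p)
    identity : ∀ s x y → x - s * y ≡ x * (1ℤ - s * s) + - (s * (y - s * x))
    identity = solve-∀

  module OddStep (n : ℕ) where
    open Odd n using (h; S; S-vanish)
    m : ℕ
    m = suc (n ℕ.+ n)
    open Replacement (inf ∷ []) m

    -- Σ hᵢ (wⁱ⁺¹ - 2 wⁱ) with w = x (1 + x), as a functional of the linear functional Φ.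
    comb : (Label → ℤ) → ℤ
    comb Φ = ∑ (suc n) (λ i → h i * (Φ (lab (suc i) (suc i)) - (Φ (lab i i) + Φ (lab i i))))

    comb-cong : ∀ {Φ Φ′} → (∀ i → Φ (lab i i) ≡ Φ′ (lab i i)) → comb Φ ≡ comb Φ′
    comb-cong e = ∑-cong (suc n) (λ i _ → cong₂ (λ a b → h i * (a - (b + b))) (e (suc i)) (e i))

    comb-linear : ∀ c Φ Φ′ → comb (λ ℓ → c * Φ ℓ + Φ′ ℓ) ≡ c * comb Φ + comb Φ′
    comb-linear c Φ Φ′ = trans
      (∑-cong (suc n) (λ i _ → term (h i) c (Φ (lab (suc i) (suc i))) (Φ (lab i i)) (Φ′ (lab (suc i) (suc i))) (Φ′ (lab i i))))
      (trans (∑-+ (suc n) (λ i → c * f Φ i) (f Φ′)) (cong (_+ comb Φ′) (∑-* (suc n) c (f Φ))))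
      where
      f : (Label → ℤ) → ℕ → ℤ
      f Φ i = h i * (Φ (lab (suc i) (suc i)) - (Φ (lab i i) + Φ (lab i i)))
      term : ∀ h c a b x y → h * (c * a + x - (c * b + y + (c * b + y))) ≡ c * (h * (a - (b + b))) + h * (x - (y + y))
      term = solve-∀

    ψ : Label → ℤ
    ψ x = comb (λ ℓ → B ℓ x)

    -- Only the leading term h_n w^{n+1} has degree m + 1 = 2n + 2.
    comb-Θ : comb Θ ≡ h n * pf B (starts (suc (suc m)) (inf ∷ []))
    comb-Θ = trans (∑-last n f (λ i i<n → trans
        (cong₂ (λ a b → h i * (a - (b + b))) (Θ-low (suc i) (suc i) (below i i<n)) (Θ-low i i (ℕ.≤-trans (ℕ.+-mono-≤ (ℕ.n≤1+n i) (ℕ.n≤1+n i)) (below i i<n))))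
        (*-zeroʳ (h i))))
      (trans (cong₂ (λ a b → h n * (a - (b + b))) (Θ-top (suc n) (suc n) (cong suc (ℕ.+-suc n n))) (Θ-low n n (ℕ.n≤1+n (n ℕ.+ n))))
             (cong (h n *_) (+-identityʳ (pf B (starts (suc (suc m)) (inf ∷ []))))))
      where
      f : ℕ → ℤ
      f i = h i * (Θ (lab (suc i) (suc i)) - (Θ (lab i i) + Θ (lab i i)))
      below : ∀ i → i ℕ.< n → suc i ℕ.+ suc i ℕ.≤ m
      below i i<n = ℕ.≤-trans (ℕ.+-mono-≤ i<n i<n) (ℕ.n≤1+n (n ℕ.+ n))

    comb-wedge : comb Θ ≡ wedge ψ (pf B) rest
    comb-wedge = begin
      comb Θ
        ≡⟨ trans (∑-cong (suc n) (λ i _ → expand (h i) (Θ (lab (suc i) (suc i))) (Θ (lab i i)))) (∑-+ (suc n) _ _) ⟩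
      ∑ (suc n) (λ i → h i * Θ (lab (suc i) (suc i))) + ∑ (suc n) (λ i → - (h i + h i) * Θ (lab i i))
        ≡⟨ cong₂ _+_ (Θ-combination (suc n) h (λ i → lab (suc i) (suc i))) (Θ-combination (suc n) (λ i → - (h i + h i)) (λ i → lab i i)) ⟩
      wedge ψ₁ (pf B) rest + wedge ψ₂ (pf B) rest
        ≡⟨ sym (wedge-+ˡ ψ₁ ψ₂ (pf B) rest) ⟩
      wedge (λ x → ψ₁ x + ψ₂ x) (pf B) rest
        ≡⟨ wedge-cong {F = pf B} {G = pf B} rest (λ x → sym (trans (∑-cong (suc n) (λ i _ → expand (h i) (B (lab (suc i) (suc i)) x) (B (lab i i) x))) (∑-+ (suc n) _ _))) (λ _ _ → refl) ⟩
      wedge ψ (pf B) rest ∎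
      where
      ψ₁ ψ₂ : Label → ℤ
      ψ₁ x = ∑ (suc n) (λ i → h i * B (lab (suc i) (suc i)) x)
      ψ₂ x = ∑ (suc n) (λ i → - (h i + h i) * B (lab i i) x)
      expand : ∀ h a b → h * (a - (b + b)) ≡ h * a + - (h + h) * b
      expand = solve-∀

    ψ-additive : ∀ a b → ψ (lab a (suc b)) ≡ ψ (lab a b) + ψ (lab (suc a) b)
    ψ-additive a b = trans (comb-cong {λ ℓ → B ℓ (lab a (suc b))} {λ ℓ → 1ℤ * B ℓ (lab a b) + B ℓ (lab (suc a) b)}
        (λ i → trans (B-additiveʳ (lab i i) a b) (cong (_+ B (lab i i) (lab (suc a) b)) (sym (*-identityˡ (B (lab i i) (lab a b)))))))
      (trans (comb-linear 1ℤ (λ ℓ → B ℓ (lab a b)) (λ ℓ → B ℓ (lab (suc a) b))) (cong (_+ ψ (lab (suc a) b)) (*-identityˡ (ψ (lab a b)))))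

    ψ-diagonal : ∀ p → ψ (lab p p) ≡ 0ℤ
    ψ-diagonal p = ∑-zero (suc n) (λ i _ → trans (cong₂ (λ a b → h i * (a - (b + b))) (zeros (suc i)) (zeros i)) (*-zeroʳ (h i)))
      where
      zeros : ∀ i → B (lab i i) (lab p p) ≡ 0ℤ
      zeros i = self-negative (B (lab i i) (lab p p)) (trans (B-diagonal-anti i p p) (cong -_ (trans (cong (_* B (lab i i) (lab p p)) (sign-double p)) (*-identityˡ (B (lab i i) (lab p p))))))

    ψ-S : ∀ j → ψ (lab j (suc j)) ≡ S j
    ψ-S j = comb-cong {λ ℓ → B ℓ (lab j (suc j))} {λ { (lab i _) → cross i j ; _ → 0ℤ }} (λ i → B-cross i j)

    -- B(p, inf) is p(1) + p(-2), and w - 2 vanishes at both points.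
    ψ-inf : ψ inf ≡ 0ℤ
    ψ-inf = ∑-zero (suc n) (λ i _ → trans
      (cong₂ (λ s s′ → h i * (pow2 (suc i) + s * pow2 (suc i) - (pow2 i + s′ * pow2 i + (pow2 i + s′ * pow2 i)))) (sign-double (suc i)) (sign-double i))
      (identity (h i) (pow2 i)))
      where
      identity : ∀ h p → h * ((p + p) + 1ℤ * (p + p) - (p + 1ℤ * p + (p + 1ℤ * p))) ≡ 0ℤ
      identity = solve-∀

    open Reduction (λ a b → ψ (lab a b)) ψ-additive

    ψ-low : ∀ d p → p ℕ.+ p ℕ.+ d ℕ.≤ n ℕ.+ n → ψ (lab p (p ℕ.+ d)) ≡ 0ℤ
    ψ-low = vanish (n ℕ.+ n) (λ p _ → trans (cong (λ q → ψ (lab p q)) (ℕ.+-identityʳ p)) (ψ-diagonal p))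
      (λ p l → let d , e = <⇒+ (diagonal-sum n p l) in
        trans (cong (λ q → ψ (lab p q)) (ℕ.+-comm p 1)) (trans (ψ-S p) (S-vanish d p e)))

    ψ-top : ψ (lab 0 m) ≡ S n
    ψ-top = trans (cong (λ q → ψ (lab 0 q)) (ℕ.+-comm 1 (n ℕ.+ n)))
      (trans (climb m (λ d p l → ψ-low d p (ℕ.≤-pred l)) n 0 1 (ℕ.+-comm (n ℕ.+ n) 1))
      (trans (cong (λ p → ψ (lab p (p ℕ.+ 1))) (ℕ.+-identityʳ n)) (trans (cong (λ q → ψ (lab n q)) (ℕ.+-comm n 1)) (ψ-S n))))

    -- `comb Θ` in two ways: the leading coefficient produces N_{m+2}, orthogonality produces N_m.
    families-step : h n * families (suc (suc m)) ≡ S n * families m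
    families-step = begin
      h n * families (suc (suc m))
        ≡⟨ cong (h n *_) (trans (cong families shape) (trans (families-odd (suc n)) (cong (λ k → pf B (starts k (inf ∷ []))) (sym shape)))) ⟩
      h n * pf B (starts (suc (suc m)) (inf ∷ []))
        ≡⟨ trans (sym comb-Θ) comb-wedge ⟩
      wedge ψ (pf B) rest
        ≡⟨ wedge-rest ψ (starts-all m (λ k k<m → ψ-low k 0 (ℕ.≤-pred k<m)) (ψ-inf ∷ [])) ⟩
      ψ (lab 0 m) * pf B (starts m (inf ∷ []))
        ≡⟨ cong₂ _*_ ψ-top (sym (families-odd n)) ⟩
      S n * families m ∎
      where
      shape : suc (suc m) ≡ suc (suc n ℕ.+ suc n)
      shape = cong (λ k → suc (suc k)) (sym (ℕ.+-suc n n))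

-- The case of even m and the recurrence for the counts.

module EvenElimination where
  open import Data.Nat.Base as ℕ using (ℕ; zero; suc; z≤n; s≤s)
  import Data.Nat.Properties as ℕ
  open import Data.Integer.Base using (ℤ; +_; 0ℤ; 1ℤ; -1ℤ; _+_; _*_; _-_; -_)
  open import Data.Integer.Properties
  open import Data.Integer.Tactic.RingSolver using (solve-∀)
  open Binomials
  open Kernel
  open Telescoping
  open Orthogonality using (module Even)
  open Certificate using (growth₁; growth₂)
  open Ratios
  open Pfaffian
  open SubsetSums
  open Forms
  open OddElimination

  pow2-+ : ∀ a b → pow2 (a ℕ.+ b) ≡ pow2 a * pow2 b
  pow2-+ zero    b = sym (*-identityˡ (pow2 b))
  pow2-+ (suc a) b = trans (cong (λ x → x + x) (pow2-+ a b)) (sym (*-distribʳ-+ (pow2 b) (pow2 a) (pow2 a)))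

  module EvenStep (n : ℕ) where
    open Even n using (q)
    open EvenPairing n using (S′; S′-vanish)
    m : ℕ
    m = n ℕ.+ n
    E : List Label
    E = inf ∷ om ∷ []
    open Replacement E m

    -- Forced by B((1 + 2x) w^j, om) = 3 · 2^j and B(inf, om) = 1.
    c : ℤ
    c = - (+ 3 * ∑ (suc n) (λ j → q j * pow2 j))

    -- Σ qⱼ wʲ (1 + 2x) minus the multiple of inf that makes it orthogonal to om.
    comb : (Label → ℤ) → ℤ
    comb Φ = ∑ (suc n) (λ j → q j * (Φ (lab j (suc j)) + Φ (lab (suc j) j))) + c * Φ inf

    comb-cong : ∀ {Φ Φ′} → (∀ j → Φ (lab j (suc j)) + Φ (lab (suc j) j) ≡ Φ′ (lab j (suc j)) + Φ′ (lab (suc j) j)) →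
                Φ inf ≡ Φ′ inf → comb Φ ≡ comb Φ′
    comb-cong e e′ = cong₂ (λ a b → a + c * b) (∑-cong (suc n) (λ j _ → cong (q j *_) (e j))) e′

    comb-+ : ∀ Φ Φ′ → comb (λ ℓ → Φ ℓ + Φ′ ℓ) ≡ comb Φ + comb Φ′
    comb-+ Φ Φ′ = trans
      (cong (_+ c * (Φ inf + Φ′ inf)) (trans
        (∑-cong (suc n) (λ j _ → term (q j) (Φ (lab j (suc j))) (Φ (lab (suc j) j)) (Φ′ (lab j (suc j))) (Φ′ (lab (suc j) j))))
        (∑-+ (suc n) (f Φ) (f Φ′))))
      (regroup (∑ (suc n) (f Φ)) (∑ (suc n) (f Φ′)) c (Φ inf) (Φ′ inf))
      where
      f : (Label → ℤ) → ℕ → ℤ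
      f Φ j = q j * (Φ (lab j (suc j)) + Φ (lab (suc j) j))
      term : ∀ h a b x y → h * (a + x + (b + y)) ≡ h * (a + b) + h * (x + y)
      term = solve-∀
      regroup : ∀ s t c a b → s + t + c * (a + b) ≡ s + c * a + (t + c * b)
      regroup = solve-∀

    ψ : Label → ℤ
    ψ x = comb (λ ℓ → B ℓ x)

    -- (1 + 2x) w^n is the sum of two labels of degree m + 1, hence the factor 2; Θ kills `inf`
    -- because it occurs in `rest`.
    comb-Θ : comb Θ ≡ + 2 * (q n * pf B (starts (suc (suc m)) E))
    comb-Θ = begin
      ∑ (suc n) f + c * Θ inf
        ≡⟨ cong₂ (λ a b → a + c * b) (∑-last n f below) (Θ-∈ inf (starts-∈ʳ (suc m) (here refl))) ⟩
      q n * (Θ (lab n (suc n)) + Θ (lab (suc n) n)) + c * 0ℤ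
        ≡⟨ cong₂ (λ a b → q n * (a + b) + c * 0ℤ) (Θ-top n (suc n) (ℕ.+-suc n n)) (Θ-top (suc n) n refl) ⟩
      q n * (P + P) + c * 0ℤ
        ≡⟨ identity (q n) P c ⟩
      + 2 * (q n * P) ∎
      where
      P = pf B (starts (suc (suc m)) E)
      f : ℕ → ℤ
      f j = q j * (Θ (lab j (suc j)) + Θ (lab (suc j) j))
      identity : ∀ q p c → q * (p + p) + c * 0ℤ ≡ + 2 * (q * p)
      identity = solve-∀
      below : ∀ j → j ℕ.< n → f j ≡ 0ℤ
      below j j<n = trans (cong₂ (λ a b → q j * (a + b)) (Θ-low j (suc j) (ℕ.+-mono-≤ (ℕ.<⇒≤ j<n) j<n)) (Θ-low (suc j) j (ℕ.+-mono-≤ j<n (ℕ.<⇒≤ j<n))))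
                          (*-zeroʳ (q j))

    comb-wedge : comb Θ ≡ wedge ψ (pf B) rest
    comb-wedge = begin
      comb Θ
        ≡⟨ split Θ ⟩
      ∑ (suc n) (λ j → q j * Θ (lab j (suc j))) + ∑ (suc n) (λ j → q j * Θ (lab (suc j) j)) + c * Θ inf
        ≡⟨ cong₂ _+_ (cong₂ _+_ (Θ-combination (suc n) q (λ j → lab j (suc j))) (Θ-combination (suc n) q (λ j → lab (suc j) j)))
             (trans (cong (c *_) (pf-∷ B inf rest)) (sym (wedge-*ˡ c (B inf) (pf B) rest))) ⟩
      wedge ψ₁ (pf B) rest + wedge ψ₂ (pf B) rest + wedge ψ₃ (pf B) rest
        ≡⟨ sym (trans (wedge-+ˡ (λ x → ψ₁ x + ψ₂ x) ψ₃ (pf B) rest) (cong (_+ wedge ψ₃ (pf B) rest) (wedge-+ˡ ψ₁ ψ₂ (pf B) rest))) ⟩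
      wedge (λ x → ψ₁ x + ψ₂ x + ψ₃ x) (pf B) rest
        ≡⟨ wedge-cong {F = pf B} {G = pf B} rest (λ x → sym (split (λ ℓ → B ℓ x))) (λ _ _ → refl) ⟩
      wedge ψ (pf B) rest ∎
      where
      ψ₁ ψ₂ ψ₃ : Label → ℤ
      ψ₁ x = ∑ (suc n) (λ j → q j * B (lab j (suc j)) x)
      ψ₂ x = ∑ (suc n) (λ j → q j * B (lab (suc j) j) x)
      ψ₃ x = c * B inf x
      split : ∀ Φ → comb Φ ≡ ∑ (suc n) (λ j → q j * Φ (lab j (suc j))) + ∑ (suc n) (λ j → q j * Φ (lab (suc j) j)) + c * Φ inf
      split Φ = cong (_+ c * Φ inf) (trans
        (∑-cong (suc n) (λ j _ → *-distribˡ-+ (q j) (Φ (lab j (suc j))) (Φ (lab (suc j) j))))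
        (∑-+ (suc n) (λ j → q j * Φ (lab j (suc j))) (λ j → q j * Φ (lab (suc j) j))))

    ψ-additive : ∀ a b → ψ (lab a (suc b)) ≡ ψ (lab a b) + ψ (lab (suc a) b)
    ψ-additive a b = trans (comb-cong {λ ℓ → B ℓ (lab a (suc b))} {λ ℓ → B ℓ (lab a b) + B ℓ (lab (suc a) b)}
        (λ j → cong₂ _+_ (B-additiveʳ (lab j (suc j)) a b) (B-additiveʳ (lab (suc j) j) a b)) (B-additiveʳ inf a b))
      (comb-+ (λ ℓ → B ℓ (lab a b)) (λ ℓ → B ℓ (lab (suc a) b)))

    -- Under x ↦ -1 - x both `B` and (1 + 2x) w^j change sign, and the two signs cancel.
    B-odd : ∀ j p q → B (lab j (suc j)) (lab p q) + B (lab (suc j) j) (lab p q)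
                    ≡ sign (p ℕ.+ q) * (B (lab j (suc j)) (lab q p) + B (lab (suc j) j) (lab q p))
    B-odd j p q = begin
      (x + - (sign (j ℕ.+ suc j) * s * y)) + (y′ + - (- sign (j ℕ.+ j) * s * x′))
        ≡⟨ cong₂ (λ a b → (x + - (a * s * y)) + (y′ + - (- b * s * x′))) (odd-diagonal j) (sign-double j) ⟩
      (x + - (-1ℤ * s * y)) + (y′ + - (- 1ℤ * s * x′))
        ≡⟨ identity s x x′ y y′ ⟩
      s * ((x′ + - (-1ℤ * s * y′)) + (y + - (- 1ℤ * s * x))) + (1ℤ - s * s) * (x + y′)
        ≡⟨ cong₂ (λ a b → s * a + b * (x + y′)) (sym right) (cong (λ t → 1ℤ - t) (sign² (p ℕ.+ q))) ⟩
      s * (B (lab j (suc j)) (lab q p) + B (lab (suc j) j) (lab q p)) + 0ℤ * (x + y′)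
        ≡⟨ trans (cong (λ z → s * (B (lab j (suc j)) (lab q p) + B (lab (suc j) j) (lab q p)) + z) (*-zeroˡ (x + y′))) (+-identityʳ (s * (B (lab j (suc j)) (lab q p) + B (lab (suc j) j) (lab q p)))) ⟩
      s * (B (lab j (suc j)) (lab q p) + B (lab (suc j) j) (lab q p)) ∎
      where
      s = sign (p ℕ.+ q)
      x = Q (lab j (suc j)) (lab p q)
      x′ = Q (lab j (suc j)) (lab q p)
      y = Q (lab (suc j) j) (lab q p)
      y′ = Q (lab (suc j) j) (lab p q)
      identity : ∀ s x x′ y y′ → (x + - (-1ℤ * s * y)) + (y′ + - (- 1ℤ * s * x′))
        ≡ s * ((x′ + - (-1ℤ * s * y′)) + (y + - (- 1ℤ * s * x))) + (1ℤ - s * s) * (x + y′)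
      identity = solve-∀
      right : B (lab j (suc j)) (lab q p) + B (lab (suc j) j) (lab q p) ≡ (x′ + - (-1ℤ * s * y′)) + (y + - (- 1ℤ * s * x))
      right = trans (cong (λ k → (x′ + - (sign (j ℕ.+ suc j) * sign k * y′)) + (y + - (- sign (j ℕ.+ j) * sign k * x))) (ℕ.+-comm q p))
                    (cong₂ (λ a b → (x′ + - (a * s * y′)) + (y + - (- b * s * x))) (odd-diagonal j) (sign-double j))

    ψ-symmetric : ∀ p → ψ (lab p (suc p)) ≡ - ψ (lab (suc p) p)
    ψ-symmetric p = trans (comb-cong {λ ℓ → B ℓ (lab p (suc p))} {λ ℓ → -1ℤ * B ℓ (lab (suc p) p)}
        (λ j → trans (B-odd j p (suc p)) (trans (cong (_* (B (lab j (suc j)) (lab (suc p) p) + B (lab (suc j) j) (lab (suc p) p))) (odd-diagonal p))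
                 (*-distribˡ-+ -1ℤ (B (lab j (suc j)) (lab (suc p) p)) (B (lab (suc j) j) (lab (suc p) p)))))
        (trans (cong (λ s → - pow2 (suc p) + - (s * pow2 p)) (odd-diagonal p))
          (trans (identity (pow2 p)) (cong (λ s → -1ℤ * (- pow2 p + - (- s * pow2 (suc p)))) (sym (sign-double p))))))
      (trans (scale (λ ℓ → B ℓ (lab (suc p) p))) (neg (ψ (lab (suc p) p))))
      where
      identity : ∀ x → - (x + x) + - (-1ℤ * x) ≡ -1ℤ * (- x + - (- 1ℤ * (x + x)))
      identity = solve-∀
      neg : ∀ x → -1ℤ * x ≡ - x
      neg = solve-∀
      scale : ∀ Φ → comb (λ ℓ → -1ℤ * Φ ℓ) ≡ -1ℤ * comb Φ
      scale Φ = trans (cong (_+ c * (-1ℤ * Φ inf)) (trans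
          (∑-cong (suc n) (λ j _ → term (q j) (Φ (lab j (suc j))) (Φ (lab (suc j) j))))
          (∑-* (suc n) -1ℤ (λ j → q j * (Φ (lab j (suc j)) + Φ (lab (suc j) j))))))
        (regroup (∑ (suc n) (λ j → q j * (Φ (lab j (suc j)) + Φ (lab (suc j) j)))) c (Φ inf))
        where
        term : ∀ h a b → h * (-1ℤ * a + -1ℤ * b) ≡ -1ℤ * (h * (a + b))
        term = solve-∀
        regroup : ∀ s c a → -1ℤ * s + c * (-1ℤ * a) ≡ -1ℤ * (s + c * a)
        regroup = solve-∀

    ψ-diagonal : ∀ i → ψ (lab i i) ≡ + 2 * S′ i
    ψ-diagonal i = begin
      ∑ (suc n) (λ j → q j * (B (lab j (suc j)) (lab i i) + B (lab (suc j) j) (lab i i))) + c * (- pow2 i + - (sign (i ℕ.+ i) * pow2 i))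
        ≡⟨ cong₂ (λ a s → a + c * (- pow2 i + - (s * pow2 i))) (∑-cong (suc n) (λ j _ → cong (q j *_) (entries j))) (sign-double i) ⟩
      ∑ (suc n) (λ j → q j * (- (cross i j + cross i j))) + c * (- pow2 i + - (1ℤ * pow2 i))
        ≡⟨ cong (λ a → a + c * (- pow2 i + - (1ℤ * pow2 i))) (trans (∑-cong (suc n) (λ j _ → term (q j) (cross i j) (pow2 i) (pow2 j)))
             (∑-+ (suc n) (λ j → + 2 * (q j * (+ 3 * (pow2 i * pow2 j) - cross i j))) (λ j → - (+ 6 * pow2 i) * (q j * pow2 j)))) ⟩
      ∑ (suc n) (λ j → + 2 * (q j * (+ 3 * (pow2 i * pow2 j) - cross i j))) + ∑ (suc n) (λ j → - (+ 6 * pow2 i) * (q j * pow2 j)) + c * (- pow2 i + - (1ℤ * pow2 i))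
        ≡⟨ cong₂ (λ a b → a + b + c * (- pow2 i + - (1ℤ * pow2 i)))
             (trans (∑-* (suc n) (+ 2) (λ j → q j * (+ 3 * (pow2 i * pow2 j) - cross i j)))
                    (cong (+ 2 *_) (∑-cong (suc n) (λ j _ → cong (λ p → q j * (+ 3 * p - cross i j)) (sym (pow2-+ i j))))))
             (∑-* (suc n) (- (+ 6 * pow2 i)) (λ j → q j * pow2 j)) ⟩
      + 2 * S′ i + - (+ 6 * pow2 i) * ∑ (suc n) (λ j → q j * pow2 j) + c * (- pow2 i + - (1ℤ * pow2 i))
        ≡⟨ cancels (S′ i) (pow2 i) (∑ (suc n) (λ j → q j * pow2 j)) ⟩
      + 2 * S′ i ∎
      where
      entries : ∀ j → B (lab j (suc j)) (lab i i) + B (lab (suc j) j) (lab i i) ≡ - (cross i j + cross i j)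
      entries j = trans (cong₂ _+_ (trans (negate (B (lab j (suc j)) (lab i i)) (B (lab i i) (lab j (suc j))) (B-skew (lab j (suc j)) (lab i i))) (cong -_ (B-cross i j)))
                                   (trans (negate (B (lab (suc j) j) (lab i i)) (B (lab i i) (lab (suc j) j)) (B-skew (lab (suc j) j) (lab i i))) (cong -_ (B-cross′ i j))))
                        (sym (neg-distrib-+ (cross i j) (cross i j)))
      term : ∀ q x p p′ → q * (- (x + x)) ≡ + 2 * (q * (+ 3 * (p * p′) - x)) + - (+ 6 * p) * (q * p′)
      term = solve-∀
      cancels : ∀ s p x → + 2 * s + - (+ 6 * p) * x + - (+ 3 * x) * (- p + - (1ℤ * p)) ≡ + 2 * s
      cancels = solve-∀

    ψ-inf : ψ inf ≡ 0ℤ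
    ψ-inf = trans (cong₂ (λ a b → a + c * b) (∑-zero (suc n) zeros) refl) (trans (+-identityˡ (c * 0ℤ)) (*-zeroʳ c))
      where
      zeros : ∀ j → j ℕ.< suc n → q j * (B (lab j (suc j)) inf + B (lab (suc j) j) inf) ≡ 0ℤ
      zeros j _ = trans (cong₂ (λ s t → q j * ((pow2 j + pow2 j + s * pow2 j) + (pow2 j + - t * (pow2 j + pow2 j)))) (odd-diagonal j) (sign-double j))
                        (identity (q j) (pow2 j))
        where
        identity : ∀ q p → q * ((p + p + -1ℤ * p) + (p + - 1ℤ * (p + p))) ≡ 0ℤ
        identity = solve-∀

    ψ-om : ψ om ≡ 0ℤ
    ψ-om = trans (cong₂ _+_ (trans (∑-cong (suc n) (λ j _ → entry j)) (∑-* (suc n) (+ 3) (λ j → q j * pow2 j))) (*-identityʳ c))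
      (+-inverseʳ (+ 3 * ∑ (suc n) (λ j → q j * pow2 j)))
      where
      entry : ∀ j → q j * (B (lab j (suc j)) om + B (lab (suc j) j) om) ≡ + 3 * (q j * pow2 j)
      entry j = trans (cong₂ (λ s t → q j * ((0ℤ + - (s * pow2 j)) + (0ℤ + - (- t * (pow2 j + pow2 j))))) (odd-diagonal j) (sign-double j))
                      (identity (q j) (pow2 j))
        where
        identity : ∀ q p → q * ((0ℤ + - (-1ℤ * p)) + (0ℤ + - (- 1ℤ * (p + p)))) ≡ + 3 * (q * p)
        identity = solve-∀

    open Reduction (λ a b → ψ (lab a b)) ψ-additive

    diagonal-vanish : ∀ p → p ℕ.< n → ψ (lab p p) ≡ 0ℤ
    diagonal-vanish p p<n = let d , e = <⇒+ p<n in trans (ψ-diagonal p) (cong (+ 2 *_) (S′-vanish p d e))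

    ψ-low : ∀ d p → p ℕ.+ p ℕ.+ d ℕ.< m → ψ (lab p (p ℕ.+ d)) ≡ 0ℤ
    ψ-low d p l = vanish (ℕ.pred m)
        (λ p l → trans (cong (λ q → ψ (lab p q)) (ℕ.+-identityʳ p)) (diagonal-vanish p (half (below₀ p l))))
        (λ p l → trans (cong (λ q → ψ (lab p q)) (ℕ.+-comm p 1)) (near p (half (below₁ p l))))
        d p (ℕ.<⇒≤pred l)
      where
      positive : 0 ℕ.< m
      positive = ℕ.≤-trans (s≤s z≤n) l
      suc-pred-m : suc (ℕ.pred m) ≡ m
      suc-pred-m = ℕ.suc-pred m {{ℕ.>-nonZero positive}}
      half : ∀ {p} → p ℕ.+ p ℕ.+ 1 ℕ.≤ m → p ℕ.< n
      half {p} = diagonal-sum n p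
      below₁ : ∀ p → p ℕ.+ p ℕ.+ 1 ℕ.≤ ℕ.pred m → p ℕ.+ p ℕ.+ 1 ℕ.≤ m
      below₁ p l = ℕ.≤-trans l (ℕ.pred[n]≤n)
      below₀ : ∀ p → p ℕ.+ p ℕ.≤ ℕ.pred m → p ℕ.+ p ℕ.+ 1 ℕ.≤ m
      below₀ p l = ℕ.≤-trans (ℕ.≤-reflexive (ℕ.+-comm (p ℕ.+ p) 1)) (ℕ.≤-trans (s≤s l) (ℕ.≤-reflexive suc-pred-m))
      -- x^p (1+x)^{p+1} is w^p plus x^{p+1} (1+x)^p. As ψ vanishes on w^p and is opposite on the
      -- other two, its value equals its own negative.
      near : ∀ p → p ℕ.< n → ψ (lab p (suc p)) ≡ 0ℤ
      near p p<n = self-negative (ψ (lab p (suc p))) (trans (ψ-symmetric p) (cong -_ (sym (trans (ψ-additive p p)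
        (trans (cong (_+ ψ (lab (suc p) p)) (diagonal-vanish p p<n)) (+-identityˡ (ψ (lab (suc p) p))))))))

    ψ-top : ψ (lab 0 m) ≡ + 2 * S′ n
    ψ-top = trans (cong (λ q → ψ (lab 0 q)) (sym (ℕ.+-identityʳ m)))
      (trans (climb m ψ-low n 0 0 (ℕ.+-identityʳ m))
      (trans (cong₂ (λ p q → ψ (lab p q)) (ℕ.+-identityʳ n) (trans (ℕ.+-identityʳ (n ℕ.+ 0)) (ℕ.+-identityʳ n))) (ψ-diagonal n)))

    families-step : q n * families (suc (suc m)) ≡ S′ n * families m
    families-step = *-cancelˡ-≡ (+ 2) (q n * families (suc (suc m))) (S′ n * families m) (begin
      + 2 * (q n * families (suc (suc m)))
        ≡⟨ cong (λ x → + 2 * (q n * x)) (trans (cong families shape) (trans (families-even (suc n)) (cong (λ k → pf B (starts k E)) (sym shape)))) ⟩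
      + 2 * (q n * pf B (starts (suc (suc m)) E))
        ≡⟨ trans (sym comb-Θ) comb-wedge ⟩
      wedge ψ (pf B) rest
        ≡⟨ wedge-rest ψ (starts-all m (λ k k<m → ψ-low k 0 k<m) (ψ-inf ∷ ψ-om ∷ [])) ⟩
      ψ (lab 0 m) * pf B (starts m E)
        ≡⟨ cong₂ _*_ ψ-top (sym (families-even n)) ⟩
      + 2 * S′ n * families m
        ≡⟨ *-assoc (+ 2) (S′ n) (families m) ⟩
      + 2 * (S′ n * families m) ∎)
      where
      shape : suc (suc m) ≡ suc n ℕ.+ suc n
      shape = cong suc (sym (ℕ.+-suc n n))

  parity : ∀ n → (∃ λ k → n ≡ k ℕ.+ k) ⊎ (∃ λ k → n ≡ suc (k ℕ.+ k))
  parity zero = inj₁ (0 , refl)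
  parity (suc n) with parity n
  ... | inj₁ (k , e) = inj₂ (k , cong suc e)
  ... | inj₂ (k , e) = inj₁ (suc k , cong suc (trans e (sym (ℕ.+-suc k k))))

  families-growth : ∀ m → growth₁ (+ suc m) * (families (suc (suc (suc m))) * families m)
                        ≡ growth₂ (+ suc m) * (families (suc (suc m)) * families (suc m))
  families-growth m with parity m
  -- For m = 0 the leading coefficient q_0 of the even step is zero, so this case is settled by
  -- evaluation.
  ... | inj₁ (zero , refl)  = refl
  ... | inj₁ (suc k , refl) = subst (λ x → growth₁ x * (families (suc (suc (suc m))) * families m) ≡ growth₂ x * (families (suc (suc m)) * families (suc m)))
      (trans (index (+ k)) (cong (λ x → + suc (suc x)) (sym (ℕ.+-suc k k))))
      (evenToOdd k (EvenStep.families-step (suc k)) (OddStep.families-step (suc k)))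
    where
    index : ∀ k → + 2 * k + + 3 ≡ 1ℤ + (1ℤ + (1ℤ + (k + k)))
    index = solve-∀
  ... | inj₂ (n , refl) = subst (λ x → growth₁ x * (families (suc (suc (suc m))) * families m) ≡ growth₂ x * (families (suc (suc m)) * families (suc m)))
      (index (+ n))
      (oddToEven n (OddStep.families-step n)
        (subst (λ x → Even.q (suc n) (suc n) * families (suc (suc x)) ≡ EvenPairing.S′ (suc n) (suc n) * families x)
               (cong suc (ℕ.+-suc n n)) (EvenStep.families-step (suc n))))
    where
    index : ∀ n → + 2 * n + + 2 ≡ 1ℤ + (1ℤ + (n + n))
    index = solve-∀

-- Enumeration of the slices of an ideal by Pfaffians.

module Counting where
  open import Data.Nat.Base as ℕ using (ℕ; zero; suc; z≤n; s≤s)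
  import Data.Nat.Properties as ℕ
  open import Data.Integer.Base using (ℤ; +_; 0ℤ; 1ℤ; _+_; _*_)
  open import Data.Integer.Properties
  open Binomials
  open Pfaffian
  open SubsetSums
  open Forms

  -- A row lists the heights of the columns of a slice of an order ideal; every column stays or
  -- grows by one box, subject to strict decrease of the nonzero heights.
  data Step : ℕ → List ℕ → List ℕ → Set where
    []   : ∀ {c} → Step c [] []
    stay : ∀ {c a e e′} → Step (a ℕ.∸ 1) e e′ → Step c (a ∷ e) (a ∷ e′)
    rise : ∀ {c a e e′} → a ℕ.< c → Step a e e′ → Step c (a ∷ e) (suc a ∷ e′)

  -- Each slice has one column more than the one before, hence the appended 0; the cap
  -- `suc (length e)` is the new number of columns. The starting row itself is not recorded.
  data Path : ℕ → List ℕ → List (List ℕ) → Set where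
    []  : ∀ {e} → Path 0 e []
    _∷_ : ∀ {k e e′ p} → Step (suc (length e)) (e ++ 0 ∷ []) e′ → Path k e′ p → Path (suc k) e (e′ ∷ p)

  data Desc : ℕ → List ℕ → Set where
    []  : ∀ {c} → Desc c []
    _∷_ : ∀ {c a e} → a ℕ.≤ c → Desc (a ℕ.∸ 1) e → Desc c (a ∷ e)

  optional : ∀ {P A : Set} → Dec P → List A → List A
  optional (yes _) xs = xs
  optional (no _)  _  = []

  nexts : ℕ → List ℕ → List (List ℕ)
  nexts c []      = [] ∷ []
  nexts c (a ∷ e) = map (a ∷_) (nexts (a ℕ.∸ 1) e) ++ optional (a ℕ.<? c) (map (suc a ∷_) (nexts a e))

  paths : ℕ → List ℕ → List (List (List ℕ))
  paths zero    e = [] ∷ []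
  paths (suc k) e = concatMap (λ e′ → map (e′ ∷_) (paths k e′)) (nexts (suc (length e)) (e ++ 0 ∷ []))

  ∈-nexts⁻ : ∀ c e {e′} → e′ ∈ nexts c e → Step c e e′
  ∈-nexts⁻ c []      (here refl) = []
  ∈-nexts⁻ c (a ∷ e) e′∈ with ∈-++⁻ (map (a ∷_) (nexts (a ℕ.∸ 1) e)) e′∈
  ... | inj₁ l with ∈-map⁻ (a ∷_) l
  ...   | _ , x∈ , refl = stay (∈-nexts⁻ (a ℕ.∸ 1) e x∈)
  ∈-nexts⁻ c (a ∷ e) e′∈ | inj₂ r with a ℕ.<? c
  ... | yes a<c with ∈-map⁻ (suc a ∷_) r
  ...   | _ , x∈ , refl = rise a<c (∈-nexts⁻ a e x∈)
  ∈-nexts⁻ c (a ∷ e) e′∈ | inj₂ () | no _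

  ∈-nexts⁺ : ∀ {c e e′} → Step c e e′ → e′ ∈ nexts c e
  ∈-nexts⁺ [] = here refl
  ∈-nexts⁺ {e = a ∷ e} (stay s) = ∈-++⁺ˡ (∈-map⁺ (a ∷_) (∈-nexts⁺ s))
  ∈-nexts⁺ {c} {a ∷ e} (rise a<c s) with a ℕ.<? c
  ... | yes _  = ∈-++⁺ʳ (map (a ∷_) (nexts (a ℕ.∸ 1) e)) (∈-map⁺ (suc a ∷_) (∈-nexts⁺ s))
  ... | no a≮c = ⊥-elim (a≮c a<c)

  nexts-unique : ∀ c e → Unique (nexts c e)
  nexts-unique c []      = [] ∷ []
  nexts-unique c (a ∷ e) = Unique.++⁺ (Unique.map⁺ ∷-injectiveʳ (nexts-unique (a ℕ.∸ 1) e)) (optional-unique (a ℕ.<? c)) disjoint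
    where
    optional-unique : (d : Dec (a ℕ.< c)) → Unique (optional d (map (suc a ∷_) (nexts a e)))
    optional-unique (yes _) = Unique.map⁺ ∷-injectiveʳ (nexts-unique a e)
    optional-unique (no _)  = []
    disjoint : ∀ {x} → x ∈ map (a ∷_) (nexts (a ℕ.∸ 1) e) × x ∈ optional (a ℕ.<? c) (map (suc a ∷_) (nexts a e)) → ⊥
    disjoint (l , r) with a ℕ.<? c
    disjoint (l , ()) | no _
    disjoint (l , r)  | yes _ with ∈-map⁻ (a ∷_) l | ∈-map⁻ (suc a ∷_) r
    ... | _ , _ , refl | _ , _ , e = ℕ.1+n≢n (sym (∷-injectiveˡ e))

  ∈-paths⁻ : ∀ k e {p} → p ∈ paths k e → Path k e p
  ∈-paths⁻ zero    e (here refl) = []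
  ∈-paths⁻ (suc k) e p∈ with find (∈-concatMap⁻ (λ e′ → map (e′ ∷_) (paths k e′)) {xs = nexts (suc (length e)) (e ++ 0 ∷ [])} p∈)
  ... | e′ , e′∈ , q∈ with ∈-map⁻ (e′ ∷_) q∈
  ...   | _ , x∈ , refl = ∈-nexts⁻ (suc (length e)) (e ++ 0 ∷ []) e′∈ ∷ ∈-paths⁻ k e′ x∈

  ∈-paths⁺ : ∀ {k e p} → Path k e p → p ∈ paths k e
  ∈-paths⁺ [] = here refl
  ∈-paths⁺ {suc k} (_∷_ {e′ = e′} s p) = ∈-concatMap⁺ (λ e′ → map (e′ ∷_) (paths k e′))
    (Any.map (λ { refl → ∈-map⁺ (e′ ∷_) (∈-paths⁺ p) }) (∈-nexts⁺ s))

  concatMap-unique : ∀ {A B : Set} (f : A → List B) xs → (∀ x → Unique (f x)) →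
    (∀ {x y z} → z ∈ f x → z ∈ f y → x ≡ y) → Unique xs → Unique (concatMap f xs)
  concatMap-unique f []       u d []       = []
  concatMap-unique f (x ∷ xs) u d (p ∷ ps) = Unique.++⁺ (u x) (concatMap-unique f xs u d ps) disjoint
    where
    disjoint : ∀ {z} → z ∈ f x × z ∈ concatMap f xs → ⊥
    disjoint (l , r) with find (∈-concatMap⁻ f {xs = xs} r)
    ... | y , y∈ , z∈ = All.lookup p y∈ (d l z∈)

  paths-unique : ∀ k e → Unique (paths k e)
  paths-unique zero    e = [] ∷ []
  paths-unique (suc k) e = concatMap-unique (λ e′ → map (e′ ∷_) (paths k e′)) (nexts (suc (length e)) (e ++ 0 ∷ []))
    (λ e′ → Unique.map⁺ ∷-injectiveʳ (paths-unique k e′)) same-head (nexts-unique (suc (length e)) (e ++ 0 ∷ []))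
    where
    same-head : ∀ {x y z} → z ∈ map (x ∷_) (paths k x) → z ∈ map (y ∷_) (paths k y) → x ≡ y
    same-head {x} {y} l r with ∈-map⁻ (x ∷_) l | ∈-map⁻ (y ∷_) r
    ... | _ , _ , refl | _ , _ , e = ∷-injectiveˡ e

  Desc-snoc : ∀ {c e} → Desc c e → Desc c (e ++ 0 ∷ [])
  Desc-snoc []      = z≤n ∷ []
  Desc-snoc (p ∷ d) = p ∷ Desc-snoc d

  Step-Desc : ∀ {c c′ e e′} → Step c′ e e′ → Desc c e → c ℕ.≤ c′ → Desc c′ e′
  Step-Desc []         _       _ = []
  Step-Desc (stay s)   (p ∷ d) l = ℕ.≤-trans p l ∷ Step-Desc s d ℕ.≤-refl
  Step-Desc (rise q s) (p ∷ d) l = q ∷ Step-Desc s d (ℕ.m∸n≤m _ 1)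

  Step-length : ∀ {c e e′} → Step c e e′ → length e′ ≡ length e
  Step-length []         = refl
  Step-length (stay s)   = cong suc (Step-length s)
  Step-length (rise _ s) = cong suc (Step-length s)

  length-snoc : ∀ (e : List ℕ) → length (e ++ 0 ∷ []) ≡ suc (length e)
  length-snoc e = trans (length-++ e) (ℕ.+-comm (length e) 1)

  Step-row : ∀ {e e′} → Desc (length e) e → Step (suc (length e)) (e ++ 0 ∷ []) e′ → Desc (length e′) e′
  Step-row {e} {e′} d s = subst (λ n → Desc n e′) (sym (trans (Step-length s) (length-snoc e)))
    (Step-Desc s (Desc-snoc d) (ℕ.n≤1+n (length e)))

  -- A column of height a + 1 is a particle at position a with k steps to go.
  labels : ℕ → List ℕ → List Label
  labels k []          = []
  labels k (zero ∷ e)  = labels k e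
  labels k (suc a ∷ e) = lab a k ∷ labels k e

  total : ∀ {A : Set} → (A → ℤ) → List A → ℤ
  total F []       = 0ℤ
  total F (x ∷ xs) = F x + total F xs

  total-++ : ∀ {A : Set} (F : A → ℤ) xs ys → total F (xs ++ ys) ≡ total F xs + total F ys
  total-++ F []       ys = sym (+-identityˡ (total F ys))
  total-++ F (x ∷ xs) ys = trans (cong (λ z → F x + z) (total-++ F xs ys)) (sym (+-assoc (F x) (total F xs) (total F ys)))

  total-map : ∀ {A B : Set} (F : B → ℤ) (f : A → B) xs → total F (map f xs) ≡ total (λ x → F (f x)) xs
  total-map F f []       = refl
  total-map F f (x ∷ xs) = cong (λ z → F (f x) + z) (total-map F f xs)

  total-cong : ∀ {A : Set} {F G : A → ℤ} xs → (∀ {x} → x ∈ xs → F x ≡ G x) → total F xs ≡ total G xs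
  total-cong []       e = refl
  total-cong (x ∷ xs) e = cong₂ _+_ (e (here refl)) (total-cong xs (λ x∈ → e (there x∈)))

  length-concatMap : ∀ {A B : Set} (f : A → List B) xs → + length (concatMap f xs) ≡ total (λ x → + length (f x)) xs
  length-concatMap f []       = refl
  length-concatMap f (x ∷ xs) = trans (cong +_ (length-++ (f x))) (cong (λ z → + length (f x) + z) (length-concatMap f xs))

  nexts-zeros : ∀ {e} → Desc 0 e → nexts 0 e ≡ e ∷ []
  nexts-zeros []        = refl
  nexts-zeros (z≤n ∷ d) rewrite nexts-zeros d = refl

  labels-zeros : ∀ {e} k → Desc 0 e → labels k e ≡ []
  labels-zeros k []        = refl
  labels-zeros k (z≤n ∷ d) = labels-zeros k d

  Desc-unsnoc : ∀ {c} e → Desc c (e ++ 0 ∷ []) → Desc c e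
  Desc-unsnoc []      d       = []
  Desc-unsnoc (a ∷ e) (p ∷ d) = p ∷ Desc-unsnoc e d

  module _ (k : ℕ) where

    -- The states with one more step to go, summed over the next step. A move that would violate
    -- strictness repeats a label, so alternation lets us sum over all moves.
    next-total : ∀ F → Alternating F → (∀ a → Additive (lab a (suc k)) (lab a k) (lab (suc a) k) F) →
      ∀ {c c′} e → Desc c (e ++ 0 ∷ []) → (∀ a → a ℕ.≤ c → a ℕ.< c′ ⊎ (∀ X → F (lab a k ∷ X) ≡ 0ℤ)) →
      total (λ e′ → F (labels k e′)) (nexts c′ (e ++ 0 ∷ []))
      ≡ F (labels (suc k) e) + F (labels (suc k) e ++ lab 0 k ∷ [])

    -- Behind an empty column all are empty; what remains open is whether a particle enters at the
    -- first of them.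
    zero-case : ∀ (F : Functional) {c c′} e → Desc 0 e → (∀ a → a ℕ.≤ c → a ℕ.< c′ ⊎ (∀ X → F (lab a k ∷ X) ≡ 0ℤ)) →
      total (λ e′ → F (labels k e′)) (nexts c′ (0 ∷ e)) ≡ F [] + F (lab 0 k ∷ [])
    zero-case F {c} {c′} e d free = trans
      (cong (λ es → total G (map (0 ∷_) es ++ optional (0 ℕ.<? c′) (map (1 ∷_) es))) (nexts-zeros d))
      (cong₂ (λ x y → F x + y) (labels-zeros k d) (entrant (0 ℕ.<? c′)))
      where
      G : List ℕ → ℤ
      G e′ = F (labels k e′)
      entrant : (dec : Dec (0 ℕ.< c′)) → total G (optional dec ((1 ∷ e) ∷ [])) ≡ F (lab 0 k ∷ [])
      entrant (yes _) = trans (+-identityʳ (G (1 ∷ e))) (cong (λ L → F (lab 0 k ∷ L)) (labels-zeros k d))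
      entrant (no ¬p) with free 0 z≤n
      ... | inj₁ p = ⊥-elim (¬p p)
      ... | inj₂ z = sym (z [])

    next-total F alt add []          (p ∷ d) free = zero-case F [] [] free
    next-total F alt add (zero ∷ e)  (p ∷ d) free
      rewrite labels-zeros (suc k) (Desc-unsnoc e d) = zero-case F (e ++ 0 ∷ []) d free
    next-total F alt add {c} {c′} (suc b ∷ e) (p ∷ d) free = begin
      total (λ e′ → F (labels k e′)) (map (suc b ∷_) (nexts b ee) ++ optional (suc b ℕ.<? c′) (map (suc (suc b) ∷_) (nexts (suc b) ee)))
        ≡⟨ total-++ (λ e′ → F (labels k e′)) (map (suc b ∷_) (nexts b ee)) (optional (suc b ℕ.<? c′) (map (suc (suc b) ∷_) (nexts (suc b) ee))) ⟩
      total (λ e′ → F (labels k e′)) (map (suc b ∷_) (nexts b ee)) + total (λ e′ → F (labels k e′)) (optional (suc b ℕ.<? c′) (map (suc (suc b) ∷_) (nexts (suc b) ee)))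
        ≡⟨ cong₂ _+_ (trans (total-map (λ e′ → F (labels k e′)) (suc b ∷_) (nexts b ee)) stays) (rises (suc b ℕ.<? c′)) ⟩
      (F (lab b k ∷ L) + F (lab b k ∷ L′)) + (F (lab (suc b) k ∷ L) + F (lab (suc b) k ∷ L′))
        ≡⟨ interchange (F (lab b k ∷ L)) _ _ _ ⟩
      (F (lab b k ∷ L) + F (lab (suc b) k ∷ L)) + (F (lab b k ∷ L′) + F (lab (suc b) k ∷ L′))
        ≡⟨ sym (cong₂ _+_ (add b [] L) (add b [] L′)) ⟩
      F (lab b (suc k) ∷ L) + F (lab b (suc k) ∷ L′) ∎
      where
      ee = e ++ 0 ∷ []
      L = labels (suc k) e
      L′ = labels (suc k) e ++ lab 0 k ∷ []
      stays : total (λ e′ → F (lab b k ∷ labels k e′)) (nexts b ee) ≡ F (lab b k ∷ L) + F (lab b k ∷ L′)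
      stays = next-total (F at lab b k) (at-alternating {F} (lab b k) alt) (λ a X → add a (lab b k ∷ X)) e d blocked
        where
        -- A column of height b behind one that stays at b + 1 may not rise: this would repeat
        -- `lab b k`.
        blocked : ∀ a → a ℕ.≤ b → a ℕ.< b ⊎ (∀ X → F (lab b k ∷ lab a k ∷ X) ≡ 0ℤ)
        blocked a a≤b with ℕ.m≤n⇒m<n∨m≡n a≤b
        ... | inj₁ a<b  = inj₁ a<b
        ... | inj₂ refl = inj₂ (λ X → alternating-repeat F alt (lab a k) (lab a k ∷ X) (here refl))
      rises : (dec : Dec (suc b ℕ.< c′)) → total (λ e′ → F (labels k e′)) (optional dec (map (suc (suc b) ∷_) (nexts (suc b) ee)))
              ≡ F (lab (suc b) k ∷ L) + F (lab (suc b) k ∷ L′)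
      rises (yes _) = trans (total-map (λ e′ → F (labels k e′)) (suc (suc b) ∷_) (nexts (suc b) ee))
        (next-total (F at lab (suc b) k) (at-alternating {F} (lab (suc b) k) alt) (λ a X → add a (lab (suc b) k ∷ X)) e d (λ a a≤b → inj₁ (s≤s a≤b)))
      rises (no ¬p) with free (suc b) p
      ... | inj₁ q = ⊥-elim (¬p q)
      ... | inj₂ z = sym (cong₂ _+_ (z L) (z L′))

  -- The particles X present, together with any set A of later entrants; `inf` joins when the total
  -- is odd.
  completions : ℕ → Functional
  completions k X = sub (λ A → pf Q (X ++ A)) (starts k (inf ∷ []))

  sub-alternating : ∀ F S → Alternating F → Alternating (λ X → sub (λ A → F (X ++ A)) S)
  sub-alternating F S alt X a b Y = trans (sym (sub-+ (λ A → F ((X ++ a ∷ b ∷ Y) ++ A)) (λ A → F ((X ++ b ∷ a ∷ Y) ++ A)) S))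
    (sub-zero _ S (λ A → trans (cong₂ (λ U V → F U + F V) (++-assoc X (a ∷ b ∷ Y) A) (++-assoc X (b ∷ a ∷ Y) A)) (alt X a b (Y ++ A))))

  sub-additive : ∀ F S {c a b} → Additive c a b F → Additive c a b (λ X → sub (λ A → F (X ++ A)) S)
  sub-additive F S {c} {a} {b} add X Y = trans
    (sub-cong S (λ A → trans (cong F (++-assoc X (c ∷ Y) A)) (trans (add X (Y ++ A))
      (sym (cong₂ (λ U V → F U + F V) (++-assoc X (a ∷ Y) A) (++-assoc X (b ∷ Y) A))))))
    (sub-+ (λ A → F ((X ++ a ∷ Y) ++ A)) (λ A → F ((X ++ b ∷ Y) ++ A)) S)

  module _ where
    open Uniform 1ℤ refl (λ _ → 1ℤ)

    uniform-snoc : ∀ L x → uniform (L ++ x ∷ []) ≡ uniform′ L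
    uniform′-snoc : ∀ L x → uniform′ (L ++ x ∷ []) ≡ uniform L
    uniform-snoc []      x = refl
    uniform-snoc (v ∷ L) x = cong (1ℤ *_) (trans (uniform′-snoc L x) (sym (*-identityˡ (uniform L))))
    uniform′-snoc []      x = refl
    uniform′-snoc (v ∷ L) x = trans (*-identityˡ (1ℤ * uniform (L ++ x ∷ []))) (cong (1ℤ *_) (uniform-snoc L x))

    uniform-total : ∀ L → uniform L + uniform′ L ≡ 1ℤ
    uniform-total []      = refl
    uniform-total (v ∷ L) = trans (cong₂ _+_ (*-identityˡ (uniform′ L)) (trans (*-identityˡ (1ℤ * uniform L)) (*-identityˡ (uniform L))))
      (trans (+-comm (uniform′ L) (uniform L)) (uniform-total L))

    labels-all : ∀ {a c e} → Desc c e → c ℕ.≤ a → All (λ y → Q (lab a 0) y ≡ 1ℤ * (1ℤ * 1ℤ)) (labels 0 e)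
    labels-all []                    l = []
    labels-all {e = zero ∷ _}  (p ∷ d) l = labels-all d (ℕ.≤-trans z≤n l)
    labels-all {e = suc b ∷ _} (p ∷ d) l = Q-starts (ℕ.≤-trans p l) ∷ labels-all d (ℕ.≤-trans (ℕ.n≤1+n b) (ℕ.≤-trans p l))

    labels-pairs : ∀ {c e} → Desc c e → AllPairs (λ x y → Q x y ≡ 1ℤ * (1ℤ * 1ℤ)) (labels 0 e)
    labels-pairs []                      = []
    labels-pairs {e = zero ∷ _}  (p ∷ d) = labels-pairs d
    labels-pairs {e = suc b ∷ _} (p ∷ d) = labels-all d ℕ.≤-refl ∷ labels-pairs d

    labels-inf : ∀ e → All (λ x → Q x inf ≡ 1ℤ * (1ℤ * 1ℤ)) (labels 0 e)
    labels-inf []          = []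
    labels-inf (zero ∷ e)  = labels-inf e
    labels-inf (suc a ∷ e) = refl ∷ labels-inf e

    AllPairs-snoc : ∀ {R : Label → Label → Set} {L x} → AllPairs R L → All (λ y → R y x) L → AllPairs R (L ++ x ∷ [])
    AllPairs-snoc []       []       = [] ∷ []
    AllPairs-snoc (p ∷ ps) (r ∷ rs) = snoc p r ∷ AllPairs-snoc ps rs
      where
      snoc : ∀ {P : Label → Set} {L x} → All P L → P x → All P (L ++ x ∷ [])
      snoc []       r = r ∷ []
      snoc (p ∷ ps) r = p ∷ snoc ps r

    -- With no steps left the positions decrease strictly, so `Q` is 1 on all pairs. Of L and
    -- `L ++ inf ∷ []` exactly one has even length, and its Pfaffian is 1.
    completions-zero : ∀ {c e} → Desc c e → completions 0 (labels 0 e) ≡ 1ℤ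
    completions-zero {e = e} d = begin
      pf Q (L ++ []) + pf Q (L ++ inf ∷ [])
        ≡⟨ cong₂ _+_ (trans (cong (pf Q) (++-identityʳ L)) (pf-uniform (length L) L ℕ.≤-refl (labels-pairs d)))
                     (trans (pf-uniform (length (L ++ inf ∷ [])) (L ++ inf ∷ []) ℕ.≤-refl (AllPairs-snoc (labels-pairs d) (labels-inf e))) (uniform-snoc L inf)) ⟩
      uniform L + uniform′ L
        ≡⟨ uniform-total L ⟩
      1ℤ ∎
      where
      L = labels 0 e

  -- The two terms of `next-total` are the two branches of `sub` at the head of `starts (suc k)`: a
  -- particle enters in this step or not.
  length-paths : ∀ k e → Desc (length e) e → + length (paths k e) ≡ completions k (labels k e)
  length-paths zero    e d = sym (completions-zero d)
  length-paths (suc k) e d = begin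
    + length (paths (suc k) e)
      ≡⟨ length-concatMap (λ e′ → map (e′ ∷_) (paths k e′)) (nexts (suc (length e)) (e ++ 0 ∷ [])) ⟩
    total (λ e′ → + length (map (e′ ∷_) (paths k e′))) (nexts (suc (length e)) (e ++ 0 ∷ []))
      ≡⟨ total-cong (nexts (suc (length e)) (e ++ 0 ∷ [])) (λ {e′} e′∈ → trans (cong +_ (length-map (e′ ∷_) (paths k e′)))
           (length-paths k e′ (Step-row d (∈-nexts⁻ (suc (length e)) (e ++ 0 ∷ []) e′∈)))) ⟩
    total (λ e′ → completions k (labels k e′)) (nexts (suc (length e)) (e ++ 0 ∷ []))
      ≡⟨ next-total k (completions k) (sub-alternating (pf Q) S (pf-alternating Q Q-skew))
           (λ a → sub-additive (pf Q) S (pf-additive Q Q-skew {lab a (suc k)} {lab a k} {lab (suc a) k} (Q-additive a k)))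
           e (Desc-snoc d) (λ a a≤ → inj₁ (s≤s a≤)) ⟩
    completions k L + completions k (L ++ lab 0 k ∷ [])
      ≡⟨ cong (λ x → completions k L + x) (sub-cong S (λ A → cong (pf Q) (++-assoc L (lab 0 k ∷ []) A))) ⟩
    completions (suc k) L ∎
    where
    S = starts k (inf ∷ [])
    L = labels (suc k) e

  paths-families : ∀ m → + length (paths m []) ≡ families m
  paths-families m = length-paths m [] []

-- Paths of rows as height functions of two coordinates.

module Rows where
  open import Data.Nat.Base as ℕ using (ℕ; zero; suc; z≤n; s≤s; _+_; _∸_; _≤_; _<_)
  open import Data.Nat.Properties
  open import Data.Integer.Base as ℤ using (+_)
  open import Data.Fin.Base using (zero; suc)
  open import Data.Fin.Subset using (Subset) renaming (_∈_ to _∈ˢ_)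
  open import Data.Fin.Subset.Properties using () renaming (_∈?_ to _∈ˢ?_)
  open Counting

  at : List ℕ → ℕ → ℕ
  at []      _       = 0
  at (x ∷ _) zero    = x
  at (_ ∷ e) (suc i) = at e i

  at-snoc : ∀ e i → at (e ++ 0 ∷ []) i ≡ at e i
  at-snoc []      zero    = refl
  at-snoc []      (suc i) = refl
  at-snoc (x ∷ e) zero    = refl
  at-snoc (x ∷ e) (suc i) = at-snoc e i

  at-injective : ∀ e e′ → length e ≡ length e′ → (∀ i → at e i ≡ at e′ i) → e ≡ e′
  at-injective []      []        _ _ = refl
  at-injective (x ∷ e) (x′ ∷ e′) l h = cong₂ _∷_ (h 0) (at-injective e e′ (suc-injective l) (λ i → h (suc i)))

  choose : ∀ {P A : Set} → Dec P → A → A → A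
  choose (yes _) x _ = x
  choose (no _)  _ y = y

  -- Row a of a path, counted from its end; the starting row is repeated above.
  slice : List ℕ → List (List ℕ) → ℕ → List ℕ
  slice e []       a = e
  slice e (e′ ∷ p) a = choose (a ≤? length p) (slice e′ p a) e

  slice-start : ∀ e p a → length p ≤ a → slice e p a ≡ e
  slice-start e []       a l = refl
  slice-start e (e′ ∷ p) a l with a ≤? length p
  ... | yes q = ⊥-elim (<-irrefl refl (≤-trans l q))
  ... | no _  = refl

  slice-tail : ∀ e e′ p a → a ≤ length p → slice e (e′ ∷ p) a ≡ slice e′ p a
  slice-tail e e′ p a l with a ≤? length p
  ... | yes _ = refl
  ... | no ¬q = ⊥-elim (¬q l)

  Path-length : ∀ {k e p} → Path k e p → length p ≡ k
  Path-length []      = refl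
  Path-length (_ ∷ p) = cong suc (Path-length p)

  -- The conditions imposed by v_r, v_o and v_s, in this order. Truncated subtraction in `strict`
  -- forces the columns behind an empty one to be empty.
  record Good (H : ℕ → ℕ → ℕ) : Set where
    field
      mono      : ∀ a b → H (suc a) b ≤ H a b
      lipschitz : ∀ a b → H a b ≤ suc (H (suc a) b)
      strict    : ∀ a b → H a (suc b) ≤ H a b ∸ 1

  Step-lower : ∀ {c e e′} → Step c e e′ → ∀ i → at e i ≤ at e′ i
  Step-lower []         i       = z≤n
  Step-lower (stay s)   zero    = ≤-refl
  Step-lower (stay s)   (suc i) = Step-lower s i
  Step-lower (rise _ s) zero    = n≤1+n _
  Step-lower (rise _ s) (suc i) = Step-lower s i

  Step-upper : ∀ {c e e′} → Step c e e′ → ∀ i → at e′ i ≤ suc (at e i)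
  Step-upper []         i       = z≤n
  Step-upper (stay s)   zero    = n≤1+n _
  Step-upper (stay s)   (suc i) = Step-upper s i
  Step-upper (rise _ s) zero    = ≤-refl
  Step-upper (rise _ s) (suc i) = Step-upper s i

  Desc-head : ∀ {c e} → Desc c e → at e 0 ≤ c
  Desc-head []      = z≤n
  Desc-head (p ∷ _) = p

  Desc-strict : ∀ {c e} → Desc c e → ∀ i → at e (suc i) ≤ at e i ∸ 1
  Desc-strict []      i       = z≤n
  Desc-strict (p ∷ d) zero    = Desc-head d
  Desc-strict (p ∷ d) (suc i) = Desc-strict d i

  Desc-bound : ∀ {c e} → Desc c e → ∀ i → at e i ≤ c ∸ i
  Desc-bound {c} d zero    = Desc-head d
  Desc-bound {c} {e} d (suc i) = ≤-trans (Desc-strict d i) (≤-trans (∸-monoˡ-≤ 1 (Desc-bound d i))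
    (≤-reflexive (trans (∸-+-assoc c i 1) (cong (c ∸_) (+-comm i 1)))))

  Path-good : ∀ {k e p} → Path k e p → Desc (length e) e → Good (λ a → at (slice e p a))
  Path-good [] d = record { mono = λ _ _ → ≤-refl ; lipschitz = λ _ _ → n≤1+n _ ; strict = λ _ → Desc-strict d }
  Path-good {suc k} {e} {e′ ∷ p} (s ∷ path) d = record { mono = mono′ ; lipschitz = lipschitz′ ; strict = strict′ }
    where
    open Good (Path-good path (Step-row d s))
    lower : ∀ b → at e b ≤ at e′ b
    lower b = subst (_≤ at e′ b) (at-snoc e b) (Step-lower s b)
    upper : ∀ b → at e′ b ≤ suc (at e b)
    upper b = subst (λ x → at e′ b ≤ suc x) (at-snoc e b) (Step-upper s b)
    below : ∀ a → a ≤ length p → slice e (e′ ∷ p) a ≡ slice e′ p a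
    below a = slice-tail e e′ p a
    above : ∀ a → length p < a → slice e (e′ ∷ p) a ≡ e
    above a = slice-start e (e′ ∷ p) a
    last : slice e (e′ ∷ p) (length p) ≡ e′
    last = trans (below (length p) ≤-refl) (slice-start e′ p (length p) ≤-refl)
    mono′ : ∀ a b → at (slice e (e′ ∷ p) (suc a)) b ≤ at (slice e (e′ ∷ p) a) b
    mono′ a b with <-cmp′ a (length p)
      where
      <-cmp′ : ∀ a l → (a < l) ⊎ (a ≡ l) ⊎ (l < a)
      <-cmp′ a l with a ≤? l
      ... | no a≰l = inj₂ (inj₂ (≰⇒> a≰l))
      ... | yes a≤l with m≤n⇒m<n∨m≡n a≤l
      ...   | inj₁ a<l = inj₁ a<l
      ...   | inj₂ a≡l = inj₂ (inj₁ a≡l)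
    ... | inj₁ a<l        rewrite below a (<⇒≤ a<l) | below (suc a) a<l = mono a b
    ... | inj₂ (inj₁ refl) rewrite last | above (suc a) ≤-refl = lower b
    ... | inj₂ (inj₂ l<a) rewrite above a l<a | above (suc a) (m≤n⇒m≤1+n l<a) = ≤-refl
    lipschitz′ : ∀ a b → at (slice e (e′ ∷ p) a) b ≤ suc (at (slice e (e′ ∷ p) (suc a)) b)
    lipschitz′ a b with suc a ≤? length p | a ≤? length p
    ... | yes q  | yes _ = lipschitz a b
    ... | yes q  | no ¬r = ⊥-elim (¬r (<⇒≤ q))
    ... | no ¬q  | yes r with ≤-antisym r (≤-pred (≰⇒> ¬q))
    ...   | refl rewrite slice-start e′ p (length p) ≤-refl = upper b
    lipschitz′ a b | no ¬q | no ¬r = n≤1+n _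
    strict′ : ∀ a b → at (slice e (e′ ∷ p) a) (suc b) ≤ at (slice e (e′ ∷ p) a) b ∸ 1
    strict′ a b with a ≤? length p
    ... | yes _ = strict a b
    ... | no _  = Desc-strict d b

  -- The cap on the first column and strict decrease bound column b by the number of columns minus
  -- b; this keeps all boxes in T_n.
  Path-bound : ∀ {k e p} → Path k e p → Desc (length e) e → ∀ a b c → a ≤ k → c < at (slice e p a) b → a + b + c < length e + k
  Path-bound {zero} {e} [] d zero b c z≤n l = ≤-trans (≤-reflexive (+-comm′ b c)) (≤-trans (≤-trans (+-monoˡ-≤ b (≤-trans l (Desc-bound d b))) (≤-reflexive (m∸n+n≡m b≤))) (m≤m+n (length e) 0))
    where
    +-comm′ : ∀ b c → suc (b + c) ≡ suc c + b
    +-comm′ b c = cong suc (+-comm b c)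
    b≤ : b ≤ length e
    b≤ = <⇒≤ (m∸n≢0⇒n<m {length e} {b} (λ z → n≮0 (≤-trans l (≤-trans (Desc-bound d b) (≤-reflexive z)))))
  Path-bound {suc k} {e} {e′ ∷ p} (s ∷ path) d a b c a≤ l with a ≤? length p
  ... | yes q = ≤-trans (Path-bound path (Step-row d s) a b c (subst (a ≤_) (Path-length path) q) l)
                  (≤-reflexive (trans (cong (_+ k) (trans (Step-length s) (length-snoc e))) (sym (+-suc (length e) k))))
  ... | no ¬q = subst (λ x → suc (a + b + c) ≤ length e + x) (trans a≡ (cong suc (Path-length path)))
                  (≤-trans (≤-reflexive (shuffle a b c)) (≤-trans (+-monoˡ-≤ a (≤-trans (+-monoˡ-≤ b (≤-trans l (Desc-bound d b))) (≤-reflexive (m∸n+n≡m b≤)))) ≤-refl))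
    where
    a≡ : a ≡ suc (length p)
    a≡ = ≤-antisym (≤-trans a≤ (≤-reflexive (cong suc (sym (Path-length path))))) (≰⇒> ¬q)
    shuffle : ∀ a b c → suc (a + b + c) ≡ suc c + b + a
    shuffle a b c = cong suc (trans (+-assoc a b c) (trans (+-comm a (b + c)) (cong (_+ a) (+-comm b c))))
    b≤ : b ≤ length e
    b≤ = <⇒≤ (m∸n≢0⇒n<m {length e} {b} (λ z → n≮0 (≤-trans l (≤-trans (Desc-bound d b) (≤-reflexive z)))))

  Path-injective : ∀ {k e p p′} → Path k e p → Path k e p′ → (∀ a b → at (slice e p a) b ≡ at (slice e p′ a) b) → p ≡ p′
  Path-injective [] [] h = refl
  Path-injective {suc k} {e} {x ∷ p} {x′ ∷ p′} (s ∷ path) (s′ ∷ path′) h with rows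
    where
    last : ∀ {x p} → Path k x p → slice e (x ∷ p) k ≡ x
    last {x} {p} path = trans (slice-tail e x p k (≤-reflexive (sym (Path-length path)))) (slice-start x p k (≤-reflexive (Path-length path)))
    rows : x ≡ x′
    rows = at-injective x x′ (trans (Step-length s) (sym (Step-length s′)))
      (λ i → trans (cong (λ r → at r i) (sym (last path))) (trans (h k i) (cong (λ r → at r i) (last path′))))
  ... | refl = cong (x ∷_) (Path-injective path path′ tails)
    where
    tails : ∀ a b → at (slice x p a) b ≡ at (slice x p′ a) b
    tails a b with a ≤? k
    ... | yes q = trans (cong (λ r → at r b) (sym (slice-tail e x p a (subst (a ≤_) (sym (Path-length path)) q))))
                  (trans (h a b) (cong (λ r → at r b) (slice-tail e x p′ a (subst (a ≤_) (sym (Path-length path′)) q))))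
    ... | no ¬q = cong (λ r → at r b) (trans (slice-start x p a (subst (_≤ a) (sym (Path-length path)) (<⇒≤ (≰⇒> ¬q))))
                                      (sym (slice-start x p′ a (subst (_≤ a) (sym (Path-length path′)) (<⇒≤ (≰⇒> ¬q))))))

  row : (ℕ → ℕ) → ℕ → List ℕ
  row f zero    = []
  row f (suc t) = f 0 ∷ row (λ i → f (suc i)) t

  length-row : ∀ f t → length (row f t) ≡ t
  length-row f zero    = refl
  length-row f (suc t) = cong suc (length-row (λ i → f (suc i)) t)

  row-snoc : ∀ f t → f t ≡ 0 → row f t ++ 0 ∷ [] ≡ row f (suc t)
  row-snoc f zero    z = cong (_∷ []) (sym z)
  row-snoc f (suc t) z = cong (f 0 ∷_) (row-snoc (λ i → f (suc i)) t z)

  at-row : ∀ f t → (∀ i → t ≤ i → f i ≡ 0) → ∀ i → at (row f t) i ≡ f i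
  at-row f zero    z i       = sym (z i z≤n)
  at-row f (suc t) z zero    = refl
  at-row f (suc t) z (suc i) = at-row (λ i → f (suc i)) t (λ i l → z (suc i) (s≤s l)) i

  row-step : ∀ f g t c → g 0 ≤ c → (∀ i → f i ≤ g i) → (∀ i → g i ≤ suc (f i)) → (∀ i → g (suc i) ≤ g i ∸ 1) →
             Step c (row f t) (row g t)
  row-step f g zero    c g≤c f≤g g≤f st = []
  row-step f g (suc t) c g≤c f≤g g≤f st with m≤n⇒m<n∨m≡n (f≤g 0)
  ... | inj₂ f≡g = subst (λ x → Step c (f 0 ∷ row (λ i → f (suc i)) t) (x ∷ row (λ i → g (suc i)) t)) f≡g
    (stay (row-step (λ i → f (suc i)) (λ i → g (suc i)) t (f 0 ∸ 1) (subst (λ x → g 1 ≤ x ∸ 1) (sym f≡g) (st 0))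
      (λ i → f≤g (suc i)) (λ i → g≤f (suc i)) (λ i → st (suc i))))
  ... | inj₁ f<g = subst (λ x → Step c (f 0 ∷ row (λ i → f (suc i)) t) (x ∷ row (λ i → g (suc i)) t)) (sym g≡)
    (rise (≤-trans f<g g≤c) (row-step (λ i → f (suc i)) (λ i → g (suc i)) t (f 0) (subst (λ x → g 1 ≤ x ∸ 1) g≡ (st 0))
      (λ i → f≤g (suc i)) (λ i → g≤f (suc i)) (λ i → st (suc i))))
    where
    g≡ : g 0 ≡ suc (f 0)
    g≡ = ≤-antisym (g≤f 0) f<g

  module _ (H : ℕ → ℕ → ℕ) where

    -- The rows k - 1, ..., 0, cut after t + 1, t + 2, ... columns. With t + k = m no nonzero height
    -- is cut off.
    pathOf : ℕ → ℕ → List (List ℕ)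
    pathOf zero    t = []
    pathOf (suc k) t = row (H k) (suc t) ∷ pathOf k (suc t)

    length-pathOf : ∀ k t → length (pathOf k t) ≡ k
    length-pathOf zero    t = refl
    length-pathOf (suc k) t = cong suc (length-pathOf k (suc t))

    module _ (m : ℕ) (good : Good H) (outside : ∀ a b → m ≤ a + b → H a b ≡ 0) (bounded : ∀ a → a ≤ m → H a 0 ≤ m ∸ a) where
      open Good good

      pathOf-Path : ∀ k t → t + k ≡ m → Path k (row (H k) t) (pathOf k t)
      pathOf-Path zero    t e = []
      pathOf-Path (suc k) t e = subst₂ (λ n r → Step (suc n) r (row (H k) (suc t)))
          (sym (length-row (H (suc k)) t))
          (sym (row-snoc (H (suc k)) t (outside (suc k) t (≤-reflexive (trans (sym e) (+-comm t (suc k)))))))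
          (row-step (H (suc k)) (H k) (suc t) (suc t)
            (≤-trans (bounded k (≤-trans (m≤n+m k (suc t)) (≤-reflexive e′))) (≤-reflexive (trans (cong (_∸ k) (sym e′)) (m+n∸n≡m (suc t) k))))
            (mono k) (lipschitz k) (strict k))
        ∷ pathOf-Path k (suc t) e′
        where
        e′ : suc t + k ≡ m
        e′ = trans (sym (+-suc t k)) e

      slice-pathOf : ∀ k t → t + k ≡ m → ∀ a b → a ≤ k → at (slice (row (H k) t) (pathOf k t) a) b ≡ H a b
      slice-pathOf k t e a b a≤k with m≤n⇒m<n∨m≡n a≤k
      slice-pathOf k t e a b a≤k | inj₂ refl = trans
        (cong (λ r → at r b) (slice-start (row (H k) t) (pathOf k t) a (≤-reflexive (length-pathOf k t))))
        (at-row (H k) t (λ i t≤i → outside k i (≤-trans (≤-reflexive (trans (sym e) (+-comm t k))) (+-monoʳ-≤ k t≤i))) b)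
      slice-pathOf (suc k) t e a b a≤k | inj₁ (s≤s a≤) = trans
        (cong (λ r → at r b) (slice-tail (row (H (suc k)) t) (row (H k) (suc t)) (pathOf k (suc t)) a (subst (a ≤_) (sym (length-pathOf k (suc t))) a≤)))
        (slice-pathOf k (suc t) (trans (sym (+-suc t k)) e) a b a≤)

-- The bijection between order ideals and paths.

module Ideals where
  open import Defs hiding (r; g; y; b; o; s)
  open import Data.Nat.Base as ℕ using (ℕ; zero; suc; z≤n; s≤s; _+_; _∸_; _≤_; _<_; _≤ᵇ_)
  open import Data.Nat.Properties
  open import Data.Integer.Base as ℤ using (ℤ; +_; -[1+_])
  import Data.Integer.Properties as ℤ
  open import Data.Bool.Properties using (T?)
  open import Data.Fin.Base using (zero; suc)
  open import Data.Fin.Properties using (any?)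
  open import Data.Fin.Subset using (Subset) renaming (_∈_ to _∈ˢ_)
  open import Data.Fin.Subset.Properties using () renaming (_∈?_ to _∈ˢ?_)
  import Data.Vec.Base as Vec
  open import Data.Vec.Properties using ([]=⇒lookup; lookup⇒[]=; tabulate∘lookup; lookup∘tabulate; tabulate-cong)
  open Counting
  open Rows

  lookup-injective : ∀ {A : Set} {xs : List A} → Unique xs → ∀ i j → lookup xs i ≡ lookup xs j → i ≡ j
  lookup-injective (p ∷ u) zero    zero    e = refl
  lookup-injective (p ∷ u) zero    (suc j) e = ⊥-elim (All.lookup p (∈-lookup j) e)
  lookup-injective (p ∷ u) (suc i) zero    e = ⊥-elim (All.lookup p (∈-lookup i) (sym e))
  lookup-injective (p ∷ u) (suc i) (suc j) e = cong suc (lookup-injective u i j e)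

  module Points (n : ℕ) where

    box : List Pt
    box = concatMap (λ a → concatMap (λ β → map (λ c → (a , β , c)) (upTo (suc n))) (upTo (suc n))) (upTo (suc n))

    box-unique : Unique box
    box-unique = concatMap-unique (λ a → concatMap (λ β → map (λ c → (a , β , c)) (upTo (suc n))) (upTo (suc n))) (upTo (suc n)) plane-unique (λ p q → trans (sym (first p)) (first q)) (Unique.upTo⁺ (suc n))
      where
      second : ∀ {a β p} → p ∈ map (λ c → (a , β , c)) (upTo (suc n)) → proj₁ (proj₂ p) ≡ β
      second {a} {β} p∈ with ∈-map⁻ (λ c → (a , β , c)) p∈
      ... | _ , _ , refl = refl
      plane-unique : ∀ a → Unique (concatMap (λ β → map (λ c → (a , β , c)) (upTo (suc n))) (upTo (suc n)))
      plane-unique a = concatMap-unique (λ β → map (λ c → (a , β , c)) (upTo (suc n))) (upTo (suc n))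
        (λ β → Unique.map⁺ (λ e → ,-injectiveʳ (,-injectiveʳ e)) (Unique.upTo⁺ (suc n)))
        (λ p q → trans (sym (second p)) (second q)) (Unique.upTo⁺ (suc n))
      first : ∀ {a p} → p ∈ concatMap (λ β → map (λ c → (a , β , c)) (upTo (suc n))) (upTo (suc n)) → proj₁ p ≡ a
      first {a} p∈ with Any.satisfied (∈-concatMap⁻ (λ β → map (λ c → (a , β , c)) (upTo (suc n))) {xs = upTo (suc n)} p∈)
      ... | β , q with ∈-map⁻ (λ c → (a , β , c)) q
      ...   | _ , _ , refl = refl

    inRange : Pt → Bool
    inRange (a , β , c) = (a + β + c) ≤ᵇ (n ∸ 2)

    pts-filter : pts n ≡ filterᵇ inRange box
    pts-filter = refl

    pt-injective : ∀ i j → pt n i ≡ pt n j → i ≡ j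
    pt-injective = lookup-injective (subst Unique (sym pts-filter) (Unique.filter⁺ (λ p → T? (inRange p)) box-unique))

    pt-bounded : ∀ i {a β c} → pt n i ≡ (a , β , c) → a + β + c ≤ n ∸ 2
    pt-bounded i {a} {β} {c} e = ≤ᵇ⇒≤ (a + β + c) (n ∸ 2)
      (proj₂ (∈-filter⁻ (λ p → T? (inRange p)) {xs = box} (subst ((a , β , c) ∈_) pts-filter (subst (_∈ pts n) e (∈-lookup {xs = pts n} i)))))

    pt-surjective : ∀ a β c → a + β + c ≤ n ∸ 2 → ∃ λ i → pt n i ≡ (a , β , c)
    pt-surjective a β c l = Any.index p∈ , sym (lookup-index p∈)
      where
      small : ∀ {x} → x ≤ a + β + c → x < suc n
      small q = s≤s (≤-trans q (≤-trans l (m∸n≤m n 2)))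
      U : List ℕ
      U = upTo (suc n)
      p∈ : (a , β , c) ∈ pts n
      p∈ = subst ((a , β , c) ∈_) (sym pts-filter) (∈-filter⁺ (λ p → T? (inRange p))
        (∈-concatMap⁺ (λ a → concatMap (λ β → map (λ c → (a , β , c)) U) U) (Any.map (λ { refl →
             ∈-concatMap⁺ (λ β → map (λ c → (a , β , c)) U) (Any.map (λ { refl →
               ∈-map⁺ (λ c → (a , β , c)) (∈-upTo⁺ (small (m≤n+m c (a + β)))) })
               (∈-upTo⁺ (small (≤-trans (m≤n+m β a) (m≤m+n (a + β) c))))) })
             (∈-upTo⁺ (small (≤-trans (m≤m+n a β) (m≤m+n (a + β) c))))))
           (≤⇒≤ᵇ l))

    inside : (ℕ → ℕ → ℕ) → Pt → Bool
    inside H (a , β , c) = does (c <? H a β)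

    ideal : (ℕ → ℕ → ℕ) → Subset (length (pts n))
    ideal H = Vec.tabulate (λ i → inside H (pt n i))

    does-true : ∀ {P : Set} (d : Dec P) → does d ≡ true → P
    does-true (yes p) _ = p

    ∈-ideal⁺ : ∀ H i {a β c} → pt n i ≡ (a , β , c) → c < H a β → i ∈ˢ ideal H
    ∈-ideal⁺ H i {a} {β} {c} e l = lookup⇒[]= i (ideal H)
      (trans (lookup∘tabulate (λ i → inside H (pt n i)) i) (trans (cong (inside H) e) (dec-true (c <? H a β) l)))

    ∈-ideal⁻ : ∀ H i {a β c} → pt n i ≡ (a , β , c) → i ∈ˢ ideal H → c < H a β
    ∈-ideal⁻ H i {a} {β} {c} e i∈ = does-true (c <? H a β)
      (trans (cong (inside H) (sym e)) (trans (sym (lookup∘tabulate (λ i → inside H (pt n i)) i)) ([]=⇒lookup i∈)))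

    plus-one : ∀ {x z} → + x ≡ + z ℤ.+ + 1 → x ≡ suc z
    plus-one {x} {z} e = trans (ℤ.+-injective e) (+-comm z 1)

    plus-zero : ∀ {x z} → + x ≡ + z ℤ.+ + 0 → x ≡ z
    plus-zero {x} {z} e = trans (ℤ.+-injective e) (+-identityʳ z)

    minus-one : ∀ {x} z → + x ≡ + z ℤ.+ -[1+ 0 ] → z ≡ suc x
    minus-one (suc z) e = cong suc (sym (ℤ.+-injective e))

    module _ {H : ℕ → ℕ → ℕ} (good : Good H) where
      open Good good

      -- The vectors v_g = v_y + v_s and v_b = v_o + v_s are sums, so their cases chain `strict`
      -- with another inequality.
      below : ∀ x a β c a′ β′ c′ → embed (a′ , β′ , c′) ≡ embed (a , β , c) ⊕ vec x → c′ < H a′ β′ → c < H a β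
      below Color.r a β c a′ β′ c′ e l with plus-one (,-injectiveˡ e) | plus-zero {β′} {β} (,-injectiveˡ (,-injectiveʳ e)) | plus-zero {c′} {c} (,-injectiveʳ (,-injectiveʳ e))
      ... | refl | refl | refl = ≤-trans l (mono a β)
      below Color.g a β c a′ β′ c′ e l with plus-zero {a′} {a} (,-injectiveˡ e) | plus-one {β′} {β} (,-injectiveˡ (,-injectiveʳ e)) | plus-zero {c′} {c} (,-injectiveʳ (,-injectiveʳ e))
      ... | refl | refl | refl = ≤-trans l (≤-trans (strict a β) (m∸n≤m (H a β) 1))
      below Color.y a β c a′ β′ c′ e l with plus-zero {a′} {a} (,-injectiveˡ e) | plus-zero {β′} {β} (,-injectiveˡ (,-injectiveʳ e)) | plus-one {c′} {c} (,-injectiveʳ (,-injectiveʳ e))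
      ... | refl | refl | refl = <⇒≤ l
      below Color.b a β c a′ β′ c′ e l with minus-one {a′} a (,-injectiveˡ e) | plus-one {β′} {β} (,-injectiveˡ (,-injectiveʳ e)) | plus-zero {c′} {c} (,-injectiveʳ (,-injectiveʳ e))
      ... | refl | refl | refl = ≤-trans l (≤-trans (strict a′ β) (∸-monoˡ-≤ 1 (lipschitz a′ β)))
      below Color.o a β c a′ β′ c′ e l with minus-one {a′} a (,-injectiveˡ e) | plus-zero {β′} {β} (,-injectiveˡ (,-injectiveʳ e)) | plus-one {c′} {c} (,-injectiveʳ (,-injectiveʳ e))
      ... | refl | refl | refl = ≤-pred (≤-trans l (lipschitz a′ β))
      below Color.s a β c a′ β′ c′ e l with plus-zero {a′} {a} (,-injectiveˡ e) | plus-one {β′} {β} (,-injectiveˡ (,-injectiveʳ e)) | minus-one {c′} c (,-injectiveʳ (,-injectiveʳ e))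
      ... | refl | refl | refl = raise (H a β) (≤-trans l (strict a β))
        where
        raise : ∀ h → c′ < h ∸ 1 → suc c′ < h
        raise (suc h) l = s≤s l

      ideal-isOrderIdeal : IsOrderIdeal allColors n (ideal H)
      ideal-isOrderIdeal i .i ε j∈ = j∈
      ideal-isOrderIdeal i j (_◅_ {j = k} (x , _ , e) path) j∈ =
        ∈-ideal⁺ H i refl (below x _ _ _ _ _ _ e (∈-ideal⁻ H k refl (ideal-isOrderIdeal k j path j∈)))

    -- The length of the initial run of `true`, at most k. For a column of an ideal, which is
    -- down-closed by v_y, this is its height.
    lead : (ℕ → Bool) → ℕ → ℕ
    lead f zero    = 0
    lead f (suc k) with f 0
    ... | true  = suc (lead (λ i → f (suc i)) k)
    ... | false = 0

    lead-⁻ : ∀ f k c → c < lead f k → f c ≡ true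
    lead-⁻ f (suc k) c l with f 0 in e
    lead-⁻ f (suc k) zero    l       | true = e
    lead-⁻ f (suc k) (suc c) (s≤s l) | true = lead-⁻ (λ i → f (suc i)) k c l

    lead-⁺ : ∀ f k → (∀ c → f (suc c) ≡ true → f c ≡ true) → ∀ c → c < k → f c ≡ true → c < lead f k
    lead-⁺ f (suc k) down c l e with f 0 in e₀
    lead-⁺ f (suc k) down zero    l       e | true = s≤s z≤n
    lead-⁺ f (suc k) down (suc c) (s≤s l) e | true = s≤s (lead-⁺ (λ i → f (suc i)) k (λ i → down (suc i)) c l e)
    lead-⁺ f (suc k) down c l e | false with trans (sym e₀) (descend c e)
      where
      descend : ∀ c → f c ≡ true → f 0 ≡ true
      descend zero    e = e
      descend (suc c) e = descend c (down c e)
    ... | ()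

    ≤-from-< : ∀ x z → (∀ c → c < x → c < z) → x ≤ z
    ≤-from-< zero    z h = z≤n
    ≤-from-< (suc x) z h = h x ≤-refl

    module FromIdeal (I : Subset (length (pts n))) (ideal-I : IsOrderIdeal allColors n I) where

      In : ℕ → ℕ → ℕ → Set
      In a β c = ∃ λ i → pt n i ≡ (a , β , c) × i ∈ˢ I

      In? : ∀ a β c → Dec (In a β c)
      In? a β c = any? (λ i → ≡-dec _≟_ (≡-dec _≟_ _≟_) (pt n i) (a , β , c) ×-dec (i ∈ˢ? I))

      In-bounded : ∀ {a β c} → In a β c → a + β + c ≤ n ∸ 2
      In-bounded (i , e , _) = pt-bounded i e

      In-cover : ∀ x → x ∈ allColors → ∀ {a β c a′ β′ c′} → a + β + c ≤ n ∸ 2 →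
                 embed (a′ , β′ , c′) ≡ embed (a , β , c) ⊕ vec x → In a′ β′ c′ → In a β c
      In-cover x x∈ {a} {β} {c} l e (j , ej , j∈) with pt-surjective a β c l
      ... | i , ei = i , ei , ideal-I i j ((x , x∈ , trans (cong embed ej) (trans e (cong (λ p → embed p ⊕ vec x) (sym ei)))) ◅ ε) j∈

      embed-cong : ∀ {a β c a′ β′ c′} → a ≡ a′ → β ≡ β′ → c ≡ c′ → embed (a , β , c) ≡ embed (a′ , β′ , c′)
      embed-cong refl refl refl = refl

      In-y : ∀ a β c → In a β (suc c) → In a β c
      In-y a β c i = In-cover Color.y (there (there (there (there (here refl))))) (≤-trans (+-monoʳ-≤ (a + β) (n≤1+n c)) (In-bounded i))
        (embed-cong (sym (+-identityʳ a)) (sym (+-identityʳ β)) (+-comm 1 c)) i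

      In-r : ∀ a β c → In (suc a) β c → In a β c
      In-r a β c i = In-cover Color.r (here refl) (≤-trans (n≤1+n (a + β + c)) (In-bounded i))
        (embed-cong (+-comm 1 a) (sym (+-identityʳ β)) (sym (+-identityʳ c))) i

      In-o : ∀ a β c → In a β (suc c) → In (suc a) β c
      In-o a β c i = In-cover Color.o (there (there (there (here refl)))) (≤-trans (≤-reflexive (sym (+-suc (a + β) c))) (In-bounded i))
        (embed-cong {a} {β} {suc c} {a} refl (sym (+-identityʳ β)) (+-comm 1 c)) i

      In-s : ∀ a β c → In a (suc β) c → In a β (suc c)
      In-s a β c i = In-cover Color.s (there (there (there (there (there (here refl))))))
        (≤-trans (≤-reflexive (trans (+-suc (a + β) c) (cong (_+ c) (sym (+-suc a β))))) (In-bounded i))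
        (embed-cong {c′ = c} (sym (+-identityʳ a)) (+-comm 1 β) refl) i

      H : ℕ → ℕ → ℕ
      H a β = lead (λ c → does (In? a β c)) (suc (n ∸ 2))

      H⁻ : ∀ a β c → c < H a β → In a β c
      H⁻ a β c l = does-true (In? a β c) (lead-⁻ (λ c → does (In? a β c)) (suc (n ∸ 2)) c l)

      H⁺ : ∀ a β c → In a β c → c < H a β
      H⁺ a β c i = lead-⁺ (λ c → does (In? a β c)) (suc (n ∸ 2))
        (λ c e → dec-true (In? a β c) (In-y a β c (does-true (In? a β (suc c)) e))) c
        (s≤s (≤-trans (m≤n+m c (a + β)) (In-bounded i))) (dec-true (In? a β c) i)

      H-good : Good H
      H-good = record
        { mono      = λ a β → ≤-from-< (H (suc a) β) (H a β) (λ c l → H⁺ a β c (In-r a β c (H⁻ (suc a) β c l)))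
        ; lipschitz = λ a β → ≤-from-< (H a β) (suc (H (suc a) β)) (lip a β)
        ; strict    = λ a β → ≤-from-< (H a (suc β)) (H a β ∸ 1) (λ c l → lower (H a β) (H⁺ a β (suc c) (In-s a β c (H⁻ a (suc β) c l))))
        }
        where
        lip : ∀ a β c → c < H a β → c < suc (H (suc a) β)
        lip a β zero    l = s≤s z≤n
        lip a β (suc c) l = s≤s (H⁺ (suc a) β c (In-o a β c (H⁻ a β (suc c) l)))
        lower : ∀ h {c} → suc c < h → c < h ∸ 1
        lower (suc h) (s≤s l) = l

      H-range : ∀ a β c → c < H a β → a + β + c < suc (n ∸ 2)
      H-range a β c l = s≤s (In-bounded (H⁻ a β c l))

      H-outside : ∀ a β → suc (n ∸ 2) ≤ a + β → H a β ≡ 0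
      H-outside a β l = n≤0⇒n≡0 (≤-from-< (H a β) 0 (λ c q → ⊥-elim (<-irrefl refl (≤-trans (H-range a β c q) (≤-trans l (m≤m+n (a + β) c))))))

      H-bounded : ∀ a → a ≤ suc (n ∸ 2) → H a 0 ≤ suc (n ∸ 2) ∸ a
      H-bounded a _ = ≤-from-< (H a 0) (suc (n ∸ 2) ∸ a) (λ c l → m+n≤o⇒m≤o∸n (suc c) (≤-trans (≤-reflexive (cong suc (trans (+-comm c a) (cong (_+ c) (sym (+-identityʳ a)))))) (H-range a 0 c l)))

      ideal-H : ideal H ≡ I
      ideal-H = trans (tabulate-cong pointwise) (tabulate∘lookup I)
        where
        pointwise : ∀ i → inside H (pt n i) ≡ Vec.lookup I i
        pointwise i = compare (pt n i) refl (Vec.lookup I i) refl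
          where
          compare : ∀ p → pt n i ≡ p → ∀ v → Vec.lookup I i ≡ v → inside H p ≡ v
          compare (a , β , c) ep true  ev = dec-true (c <? H a β) (H⁺ a β c (i , ep , lookup⇒[]= i I ev))
          compare (a , β , c) ep false ev = dec-false (c <? H a β) λ l → contradict (H⁻ a β c l)
            where
            contradict : In a β c → ⊥
            contradict (j , ej , j∈) with pt-injective j i (trans ej (sym ep))
            ... | refl with trans (sym ev) ([]=⇒lookup j∈)
            ...   | ()

    -- The number of slices, n - 1 for n ≥ 2.
    m : ℕ
    m = suc (n ∸ 2)

    height : List (List ℕ) → ℕ → ℕ → ℕ
    height p a = at (slice [] p a)

    pathIdeal : List (List ℕ) → Subset (length (pts n))
    pathIdeal p = ideal (height p)

    ideal-cong : ∀ {H H′} → (∀ a β → a ≤ m → H a β ≡ H′ a β) → ideal H ≡ ideal H′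
    ideal-cong {H} {H′} h = tabulate-cong (λ i → compare i (pt n i) refl)
      where
      compare : ∀ i p → pt n i ≡ p → inside H p ≡ inside H′ p
      compare i (a , β , c) e = cong (λ x → does (c <? x))
        (h a β (≤-trans (≤-trans (m≤m+n a β) (m≤m+n (a + β) c)) (≤-trans (pt-bounded i e) (n≤1+n (n ∸ 2)))))

    -- By `Path-bound` every box below a height is a point of T_n, so the ideal determines the
    -- heights; from slice m on both paths show the empty starting row.
    pathIdeal-≤ : ∀ {p p′} → Path m [] p → pathIdeal p ≡ pathIdeal p′ → ∀ a β → height p a β ≤ height p′ a β
    pathIdeal-≤ {p} {p′} path e a β with a ≤? m
    ... | no ¬q = ≤-trans (≤-reflexive (cong (λ x → at x β) (slice-start [] p a (≤-trans (≤-reflexive (Path-length path)) (<⇒≤ (≰⇒> ¬q)))))) z≤n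
    ... | yes q = ≤-from-< _ _ (λ c l → let i , ei = pt-surjective a β c (≤-pred (Path-bound path [] a β c q l)) in
            ∈-ideal⁻ (height p′) i ei (subst (i ∈ˢ_) e (∈-ideal⁺ (height p) i ei l)))

    pathIdeal-injective : ∀ {p p′} → Path m [] p → Path m [] p′ → pathIdeal p ≡ pathIdeal p′ → p ≡ p′
    pathIdeal-injective {p} {p′} path path′ e = Path-injective path path′
      (λ a β → ≤-antisym (pathIdeal-≤ {p} {p′} path e a β) (pathIdeal-≤ {p′} {p} path′ (sym e) a β))

    map-unique : ∀ {A C : Set} (f : A → C) xs → (∀ {x z} → x ∈ xs → z ∈ xs → f x ≡ f z → x ≡ z) → Unique xs → Unique (map f xs)
    map-unique f []       inj []      = []
    map-unique f (x ∷ xs) inj (p ∷ u) = All.tabulate distinct ∷ map-unique f xs (λ i j → inj (there i) (there j)) u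
      where
      distinct : ∀ {z} → z ∈ map f xs → f x ≢ z
      distinct z∈ e with ∈-map⁻ f z∈
      ... | w , w∈ , refl = All.lookup p w∈ (inj (here refl) (there w∈) e)

    numIdeals : NumIdeals allColors n (length (paths m []))
    numIdeals = map pathIdeal (paths m []) ,
      map-unique pathIdeal (paths m []) (λ p∈ p′∈ → pathIdeal-injective (∈-paths⁻ m [] p∈) (∈-paths⁻ m [] p′∈)) (paths-unique m []) ,
      (λ I → mk⇔ (sound I) (complete I)) ,
      length-map pathIdeal (paths m [])
      where
      sound : ∀ I → I ∈ map pathIdeal (paths m []) → IsOrderIdeal allColors n I
      sound I I∈ with ∈-map⁻ pathIdeal I∈
      ... | p , p∈ , refl = ideal-isOrderIdeal (Path-good (∈-paths⁻ m [] p∈) [])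
      complete : ∀ I → IsOrderIdeal allColors n I → I ∈ map pathIdeal (paths m [])
      complete I ideal-I = subst (_∈ map pathIdeal (paths m [])) (trans (ideal-cong same) ideal-H)
          (∈-map⁺ pathIdeal (∈-paths⁺ (pathOf-Path H m H-good H-outside H-bounded m 0 refl)))
        where
        open FromIdeal I ideal-I
        same : ∀ a β → a ≤ m → height (pathOf H m 0) a β ≡ H a β
        same a β = slice-pathOf H m H-good H-outside H-bounded m 0 refl a β

-- From the recurrence to the product formulas.

module Product where
  open import Defs hiding (r; g; y; b; o; s)
  open import Data.Nat.Base as ℕ using (ℕ; zero; suc; _+_; _*_; _∸_; NonZero)
  open import Data.Nat.Properties
  open import Data.Nat.Tactic.RingSolver using (solve-∀)
  open import Data.Nat.ListAction using (product)
  open import Data.Nat.ListAction.Properties using (product-++)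
  open import Data.Integer.Base as ℤ using (ℤ; +_)
  import Data.Integer.Properties as ℤ
  open Certificate using (growth₁; growth₂)
  open Counting using (paths; paths-families)
  open EvenElimination using (families-growth)

  ∏ : ℕ → (ℕ → ℕ) → ℕ
  ∏ zero    f = 1
  ∏ (suc m) f = ∏ m f * f (suc m)

  ∏-cong : ∀ m {f h} → (∀ i → f (suc i) ≡ h (suc i)) → ∏ m f ≡ ∏ m h
  ∏-cong zero    e = refl
  ∏-cong (suc m) e = cong₂ _*_ (∏-cong m e) (e m)

  ∏-* : ∀ m f h → ∏ m (λ i → f i * h i) ≡ ∏ m f * ∏ m h
  ∏-* zero    f h = refl
  ∏-* (suc m) f h = trans (cong (_* (f (suc m) * h (suc m))) (∏-* m f h)) (regroup (∏ m f) (∏ m h) (f (suc m)) (h (suc m)))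
    where
    regroup : ∀ a b c d → a * b * (c * d) ≡ a * c * (b * d)
    regroup = solve-∀

  ∏-nonZero : ∀ m f → (∀ i → NonZero (f (suc i))) → NonZero (∏ m f)
  ∏-nonZero zero    f p = _
  ∏-nonZero (suc m) f p = m*n≢0 (∏ m f) (f (suc m)) {{∏-nonZero m f p}} {{p m}}

  range1-suc : ∀ m → range1 (suc m) ≡ range1 m ++ suc m ∷ []
  range1-suc m = trans (cong (map suc) (sym (upTo-∷ʳ m))) (map-++ suc (upTo m) (m ∷ []))

  product-concatMap : ∀ m (f : ℕ → List ℕ) → product (concatMap f (range1 m)) ≡ ∏ m (λ i → product (f i))
  product-concatMap zero    f = refl
  product-concatMap (suc m) f = begin
    product (concatMap f (range1 (suc m)))                 ≡⟨ cong (λ l → product (concatMap f l)) (range1-suc m) ⟩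
    product (concatMap f (range1 m ++ suc m ∷ []))         ≡⟨ cong product (concatMap-++ f (range1 m) (suc m ∷ [])) ⟩
    product (concatMap f (range1 m) ++ (f (suc m) ++ []))  ≡⟨ product-++ (concatMap f (range1 m)) (f (suc m) ++ []) ⟩
    product (concatMap f (range1 m)) * product (f (suc m) ++ [])
      ≡⟨ cong₂ _*_ (product-concatMap m f) (trans (product-++ (f (suc m)) []) (*-identityʳ (product (f (suc m))))) ⟩
    ∏ m (λ i → product (f i)) * product (f (suc m)) ∎

  product-map : ∀ m f → product (map f (range1 m)) ≡ ∏ m f
  product-map zero    f = refl
  product-map (suc m) f = begin
    product (map f (range1 (suc m)))          ≡⟨ cong (λ l → product (map f l)) (range1-suc m) ⟩
    product (map f (range1 m ++ suc m ∷ []))  ≡⟨ cong product (map-++ f (range1 m) (suc m ∷ [])) ⟩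
    product (map f (range1 m) ++ f (suc m) ∷ []) ≡⟨ product-++ (map f (range1 m)) (f (suc m) ∷ []) ⟩
    product (map f (range1 m)) * (f (suc m) * 1) ≡⟨ cong₂ _*_ (product-map m f) (*-identityʳ (f (suc m))) ⟩
    ∏ m f * f (suc m) ∎

  prod2-∏ : ∀ m f → prod2 m f ≡ ∏ m (λ j → ∏ j (λ i → f i j))
  prod2-∏ m f = trans (product-concatMap m (λ j → map (λ i → f i j) (range1 j))) (∏-cong m (λ j → product-map (suc j) (λ i → f i (suc j))))

  prod3-∏ : ∀ m f → prod3 m f ≡ ∏ m (λ k → ∏ k (λ j → ∏ j (λ i → f i j k)))
  prod3-∏ m f = trans (product-concatMap m (λ k → concatMap (λ j → map (λ i → f i j k) (range1 j)) (range1 k)))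
    (∏-cong m (λ k → prod2-∏ (suc k) (λ i j → f i j (suc k))))

  rise rise₂ : ℕ → ℕ → ℕ
  rise c J = ∏ J (λ i → i + c)
  rise₂ c J = ∏ J (λ i → 2 * i + c)

  rise-shift : ∀ c J → rise (suc c) J * suc c ≡ rise c J * (J + suc c)
  rise-shift c zero    = refl
  rise-shift c (suc J) = begin
    rise (suc c) J * (suc J + suc c) * suc c   ≡⟨ swap (rise (suc c) J) (suc J + suc c) (suc c) ⟩
    rise (suc c) J * suc c * (suc J + suc c)   ≡⟨ cong (_* (suc J + suc c)) (rise-shift c J) ⟩
    rise c J * (J + suc c) * (suc J + suc c)   ≡⟨ cong (λ x → rise c J * x * (suc J + suc c)) (+-suc J c) ⟩
    rise c J * (suc J + c) * (suc J + suc c) ∎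
    where
    swap : ∀ a b c → a * b * c ≡ a * c * b
    swap = solve-∀

  rise₂-shift : ∀ c J → rise₂ (2 + c) J * (2 + c) ≡ rise₂ c J * (2 * J + (2 + c))
  rise₂-shift c zero    = refl
  rise₂-shift c (suc J) = begin
    rise₂ (2 + c) J * (2 * suc J + (2 + c)) * (2 + c)         ≡⟨ swap (rise₂ (2 + c) J) (2 * suc J + (2 + c)) (2 + c) ⟩
    rise₂ (2 + c) J * (2 + c) * (2 * suc J + (2 + c))         ≡⟨ cong (_* (2 * suc J + (2 + c))) (rise₂-shift c J) ⟩
    rise₂ c J * (2 * J + (2 + c)) * (2 * suc J + (2 + c))     ≡⟨ cong (λ x → rise₂ c J * x * (2 * suc J + (2 + c))) (shift J c) ⟩
    rise₂ c J * (2 * suc J + c) * (2 * suc J + (2 + c)) ∎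
    where
    swap : ∀ a b c → a * b * c ≡ a * c * b
    swap = solve-∀
    shift : ∀ J c → 2 * J + (2 + c) ≡ 2 * suc J + c
    shift = solve-∀

  -- The denominator and the numerator of the quotient of consecutive terms.
  den num : ℕ → ℕ
  den m = rise m (suc m)
  num m = rise₂ m (suc m)

  -- The factor is `growth₁` at m + 1, and in `num-step` it is `growth₂`. Hence num / den satisfies
  -- the recurrence of the quotients N_{m+1} / N_m.
  den-step : ∀ m → den (2 + m) ≡ 4 * (2 * suc m + 1) * (2 * suc m + 3) * den m
  den-step m = *-cancelʳ-≡ _ _ (suc (suc m) * suc m) (begin
    rise (2 + m) (suc m) * (2 + m + (2 + m)) * (3 + m + (2 + m)) * (suc (suc m) * suc m)
      ≡⟨ regroup₁ (rise (2 + m) (suc m)) m ⟩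
    rise (2 + m) (suc m) * suc (suc m) * (suc m * (2 + m + (2 + m)) * (3 + m + (2 + m)))
      ≡⟨ cong (_* (suc m * (2 + m + (2 + m)) * (3 + m + (2 + m)))) (rise-shift (suc m) (suc m)) ⟩
    rise (suc m) (suc m) * (suc m + suc (suc m)) * (suc m * (2 + m + (2 + m)) * (3 + m + (2 + m)))
      ≡⟨ regroup₂ (rise (suc m) (suc m)) m ⟩
    rise (suc m) (suc m) * suc m * ((suc m + suc (suc m)) * (2 + m + (2 + m)) * (3 + m + (2 + m)))
      ≡⟨ cong (_* ((suc m + suc (suc m)) * (2 + m + (2 + m)) * (3 + m + (2 + m)))) (rise-shift m (suc m)) ⟩
    rise m (suc m) * (suc m + suc m) * ((suc m + suc (suc m)) * (2 + m + (2 + m)) * (3 + m + (2 + m)))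
      ≡⟨ regroup₃ (rise m (suc m)) m ⟩
    4 * (2 * suc m + 1) * (2 * suc m + 3) * rise m (suc m) * (suc (suc m) * suc m) ∎)
    where
    regroup₁ : ∀ R m → R * (2 + m + (2 + m)) * (3 + m + (2 + m)) * ((2 + m) * (1 + m)) ≡ R * (2 + m) * ((1 + m) * (2 + m + (2 + m)) * (3 + m + (2 + m)))
    regroup₁ = solve-∀
    regroup₂ : ∀ R m → R * (1 + m + (2 + m)) * ((1 + m) * (2 + m + (2 + m)) * (3 + m + (2 + m))) ≡ R * (1 + m) * ((1 + m + (2 + m)) * (2 + m + (2 + m)) * (3 + m + (2 + m)))
    regroup₂ = solve-∀
    regroup₃ : ∀ R m → R * (1 + m + (1 + m)) * ((1 + m + (2 + m)) * (2 + m + (2 + m)) * (3 + m + (2 + m))) ≡ 4 * (2 * (1 + m) + 1) * (2 * (1 + m) + 3) * R * ((2 + m) * (1 + m))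
    regroup₃ = solve-∀

  num-step : ∀ m → num (2 + m) ≡ 3 * (3 * suc m + 1) * (3 * suc m + 5) * num m
  num-step m = *-cancelʳ-≡ _ _ (2 + m) (begin
    rise₂ (2 + m) (suc m) * (2 * (2 + m) + (2 + m)) * (2 * (3 + m) + (2 + m)) * (2 + m)
      ≡⟨ regroup₁ (rise₂ (2 + m) (suc m)) m ⟩
    rise₂ (2 + m) (suc m) * (2 + m) * ((2 * (2 + m) + (2 + m)) * (2 * (3 + m) + (2 + m)))
      ≡⟨ cong (_* ((2 * (2 + m) + (2 + m)) * (2 * (3 + m) + (2 + m)))) (rise₂-shift m (suc m)) ⟩
    rise₂ m (suc m) * (2 * suc m + (2 + m)) * ((2 * (2 + m) + (2 + m)) * (2 * (3 + m) + (2 + m)))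
      ≡⟨ regroup₂ (rise₂ m (suc m)) m ⟩
    3 * (3 * suc m + 1) * (3 * suc m + 5) * rise₂ m (suc m) * (2 + m) ∎)
    where
    regroup₁ : ∀ R m → R * (2 * (2 + m) + (2 + m)) * (2 * (3 + m) + (2 + m)) * (2 + m) ≡ R * (2 + m) * ((2 * (2 + m) + (2 + m)) * (2 * (3 + m) + (2 + m)))
    regroup₁ = solve-∀
    regroup₂ : ∀ R m → R * (2 * (1 + m) + (2 + m)) * ((2 * (2 + m) + (2 + m)) * (2 * (3 + m) + (2 + m))) ≡ 3 * (3 * (1 + m) + 1) * (3 * (1 + m) + 5) * R * (2 + m)
    regroup₂ = solve-∀

  rise-nonZero : ∀ c J → NonZero (rise c J)
  rise-nonZero c J = ∏-nonZero J (λ i → i + c) (λ _ → _)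

  N : ℕ → ℕ
  N m = length (paths m [])

  N-growth : ∀ m → 4 * (2 * suc m + 1) * (2 * suc m + 3) * (N (3 + m) * N m) ≡ 3 * (3 * suc m + 1) * (3 * suc m + 5) * (N (2 + m) * N (suc m))
  N-growth m = ℤ.+-injective (begin
    + (4 * (2 * suc m + 1) * (2 * suc m + 3) * (N (3 + m) * N m))
      ≡⟨ trans (ℤ.pos-* (4 * (2 * suc m + 1) * (2 * suc m + 3)) (N (3 + m) * N m)) (cong₂ ℤ._*_ (cast 4 2 1 2 3 (suc m)) (ℤ.pos-* (N (3 + m)) (N m))) ⟩
    growth₁ (+ suc m) ℤ.* (+ N (3 + m) ℤ.* + N m)
      ≡⟨ cong₂ (λ a b → growth₁ (+ suc m) ℤ.* (a ℤ.* b)) (paths-families (3 + m)) (paths-families m) ⟩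
    _ ≡⟨ families-growth m ⟩
    _ ≡⟨ sym (cong₂ (λ a b → growth₂ (+ suc m) ℤ.* (a ℤ.* b)) (paths-families (2 + m)) (paths-families (suc m))) ⟩
    growth₂ (+ suc m) ℤ.* (+ N (2 + m) ℤ.* + N (suc m))
      ≡⟨ sym (trans (ℤ.pos-* (3 * (3 * suc m + 1) * (3 * suc m + 5)) (N (2 + m) * N (suc m))) (cong₂ ℤ._*_ (cast 3 3 1 3 5 (suc m)) (ℤ.pos-* (N (2 + m)) (N (suc m))))) ⟩
    + (3 * (3 * suc m + 1) * (3 * suc m + 5) * (N (2 + m) * N (suc m))) ∎)
    where
    cast : ∀ k a b c d x → + (k * (a * x + b) * (c * x + d)) ≡ + k ℤ.* (+ a ℤ.* + x ℤ.+ + b) ℤ.* (+ c ℤ.* + x ℤ.+ + d)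
    cast k a b c d x = trans (ℤ.pos-* (k * (a * x + b)) (c * x + d))
      (cong₂ ℤ._*_ (trans (ℤ.pos-* k (a * x + b)) (cong (λ z → + k ℤ.* (z ℤ.+ + b)) (ℤ.pos-* a x))) (cong (ℤ._+ + d) (ℤ.pos-* c x)))

  -- Proved together with `N-ratio`: that step cancels N_m, and the ratio at m shows that N_{m+1} is
  -- nonzero.
  N-nonZero : ∀ m → NonZero (N m)
  N-ratio : ∀ m → N (suc m) * den m ≡ N m * num m

  N-nonZero zero    = _
  N-nonZero (suc m) = m*n≢0⇒m≢0 (N (suc m)) {den m} {{subst NonZero (sym (N-ratio m)) (m*n≢0 (N m) (num m) {{N-nonZero m}} {{∏-nonZero (suc m) (λ i → 2 * i + m) (λ _ → _)}})}}

  -- The recurrence links the ratios at m and m + 2, so two cases are evaluated.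
  N-ratio zero          = refl
  N-ratio (suc zero)    = refl
  N-ratio (suc (suc m)) = *-cancelʳ-≡ _ _ (N m) {{N-nonZero m}} (begin
    N (3 + m) * den (2 + m) * N m
      ≡⟨ cong (λ d → N (3 + m) * d * N m) (den-step m) ⟩
    N (3 + m) * (4 * (2 * suc m + 1) * (2 * suc m + 3) * den m) * N m
      ≡⟨ regroup₁ (N (3 + m)) (4 * (2 * suc m + 1) * (2 * suc m + 3)) (den m) (N m) ⟩
    4 * (2 * suc m + 1) * (2 * suc m + 3) * (N (3 + m) * N m) * den m
      ≡⟨ cong (_* den m) (N-growth m) ⟩
    3 * (3 * suc m + 1) * (3 * suc m + 5) * (N (2 + m) * N (suc m)) * den m
      ≡⟨ regroup₂ (3 * (3 * suc m + 1) * (3 * suc m + 5)) (N (2 + m)) (N (suc m)) (den m) ⟩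
    3 * (3 * suc m + 1) * (3 * suc m + 5) * N (2 + m) * (N (suc m) * den m)
      ≡⟨ cong (3 * (3 * suc m + 1) * (3 * suc m + 5) * N (2 + m) *_) (N-ratio m) ⟩
    3 * (3 * suc m + 1) * (3 * suc m + 5) * N (2 + m) * (N m * num m)
      ≡⟨ regroup₃ (3 * (3 * suc m + 1) * (3 * suc m + 5)) (N (2 + m)) (N m) (num m) ⟩
    N (2 + m) * (3 * (3 * suc m + 1) * (3 * suc m + 5) * num m) * N m
      ≡⟨ cong (λ d → N (2 + m) * d * N m) (sym (num-step m)) ⟩
    N (2 + m) * num (2 + m) * N m ∎)
    where
    regroup₁ : ∀ n₃ k d n₀ → n₃ * (k * d) * n₀ ≡ k * (n₃ * n₀) * d
    regroup₁ = solve-∀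
    regroup₂ : ∀ k n₂ n₁ d → k * (n₂ * n₁) * d ≡ k * n₂ * (n₁ * d)
    regroup₂ = solve-∀
    regroup₃ : ∀ k n₂ n₀ e → k * n₂ * (n₀ * e) ≡ n₂ * (k * e) * n₀
    regroup₃ = solve-∀

  -- The factors i + j + k - 2 and i + j + k - 1 of the triple product with k = m + 1.
  layer layer′ : ℕ → ℕ
  layer  m = ∏ (suc m) (λ j → rise (ℕ.pred j + m) j)
  layer′ m = ∏ (suc m) (λ j → rise (j + m) j)

  -- For fixed j both layers are runs of j consecutive integers, shifted by one; their quotient is
  -- (2j + m) / (j + m).
  layer-shift : ∀ m → layer′ m * den m ≡ layer m * num m
  layer-shift m = begin
    ∏ (suc m) (λ j → rise (j + m) j) * ∏ (suc m) (λ j → j + m)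
      ≡⟨ sym (∏-* (suc m) (λ j → rise (j + m) j) (λ j → j + m)) ⟩
    ∏ (suc m) (λ j → rise (j + m) j * (j + m))
      ≡⟨ ∏-cong (suc m) (λ j → trans (rise-shift (j + m) (suc j)) (cong (rise (j + m) (suc j) *_) (collect (suc j) m))) ⟩
    ∏ (suc m) (λ j → rise (ℕ.pred j + m) j * (2 * j + m))
      ≡⟨ ∏-* (suc m) (λ j → rise (ℕ.pred j + m) j) (λ j → 2 * j + m) ⟩
    layer m * num m ∎
    where
    collect : ∀ j m → j + (j + m) ≡ 2 * j + m
    collect = solve-∀

  module _ (denominator numerator : ℕ → ℕ) (start : denominator 0 ≡ numerator 0)
           (R : ℕ → ℕ) (denominator-step : ∀ m → denominator (suc m) ≡ denominator m * R m)
           (numerator-step : ∀ m → numerator (suc m) * den m ≡ numerator m * (R m * num m)) where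

    -- The induction behind both formulas. `R` is the growth common to numerator and denominator;
    -- what is left is num / den, the ratio of the counts.
    N-formula : ∀ m → N m * denominator m ≡ numerator m
    N-formula zero    = trans (+-identityʳ (denominator 0)) start
    N-formula (suc m) = *-cancelʳ-≡ _ _ (den m) {{rise-nonZero m (suc m)}} (begin
      N (suc m) * denominator (suc m) * den m     ≡⟨ cong (λ d → N (suc m) * d * den m) (denominator-step m) ⟩
      N (suc m) * (denominator m * R m) * den m   ≡⟨ regroup (N (suc m)) (denominator m) (R m) (den m) ⟩
      N (suc m) * den m * (denominator m * R m)   ≡⟨ cong (_* (denominator m * R m)) (N-ratio m) ⟩
      N m * num m * (denominator m * R m)         ≡⟨ regroup′ (N m) (num m) (denominator m) (R m) ⟩
      N m * denominator m * (R m * num m)         ≡⟨ cong (_* (R m * num m)) (N-formula m) ⟩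
      numerator m * (R m * num m)                 ≡⟨ sym (numerator-step m) ⟩
      numerator (suc m) * den m ∎)
      where
      regroup : ∀ n a r d → n * (a * r) * d ≡ n * d * (a * r)
      regroup = solve-∀
      regroup′ : ∀ n e a r → n * e * (a * r) ≡ n * a * (r * e)
      regroup′ = solve-∀

  drop-one : ∀ i j m → i + j + suc m ∸ 1 ≡ i + (j + m)
  drop-one i j m = trans (cong (_∸ 1) (+-suc (i + j) m)) (+-assoc i j m)

  drop-two : ∀ i j m → i + suc j + suc m ∸ 2 ≡ i + (j + m)
  drop-two i j m = trans (cong (_∸ 2) (trans (+-suc (i + suc j) m) (cong (λ x → suc (x + m)) (+-suc i j)))) (+-assoc i j m)

  formula₂ : ∀ m → N m * prod2 m (λ i j → i + 2 * j ∸ 2) ≡ prod2 m (λ i j → i + j + suc m ∸ 2)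
  formula₂ m = trans (cong (N m *_) (prod2-∏ m _))
    (trans (N-formula (λ m → ∏ m (λ j → ∏ j (λ i → i + 2 * j ∸ 2))) (λ m → ∏ m (λ j → rise (ℕ.pred j + m) j)) refl
             -- The new denominators, those with j = m + 1. All numerators change with m: the old
             -- ones times this same run form `layer m`, the new ones form `layer′ m`.
             (λ m → rise (m + m) (suc m))
             (λ m → cong (∏ m (λ j → ∏ j (λ i → i + 2 * j ∸ 2)) *_) (∏-cong (suc m) (λ i → double (suc i) m)))
             (λ m → trans (cong (_* den m) (∏-cong (suc m) (λ j → cong (λ c → rise c (suc j)) (+-suc j m))))
                    (trans (layer-shift m) (*-assoc (∏ m (λ j → rise (ℕ.pred j + m) j)) (rise (m + m) (suc m)) (num m))))
             m)
           (sym (trans (prod2-∏ m _) (∏-cong m (λ j → ∏-cong (suc j) (λ i → drop-two (suc i) j m))))))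
    where
    double : ∀ i m → i + 2 * suc m ∸ 2 ≡ i + (m + m)
    double i m = cong (_∸ 2) (shift i m)
      where
      shift : ∀ i m → i + 2 * suc m ≡ 2 + (i + (m + m))
      shift = solve-∀

  formula₃ : ∀ m → N m * prod3 m (λ i j k → i + j + k ∸ 2) ≡ prod3 m (λ i j k → i + j + k ∸ 1)
  formula₃ m = trans (cong (N m *_) (prod3-∏ m _))
    (trans (N-formula (λ m → ∏ m (λ k → ∏ k (λ j → ∏ j (λ i → i + j + k ∸ 2)))) (λ m → ∏ m (λ k → ∏ k (λ j → ∏ j (λ i → i + j + k ∸ 1)))) refl
             layer
             (λ m → cong (∏ m (λ k → ∏ k (λ j → ∏ j (λ i → i + j + k ∸ 2))) *_)
                      (∏-cong (suc m) (λ j → ∏-cong (suc j) (λ i → drop-two (suc i) j m))))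
             (λ m → trans (cong (λ x → ∏ m (λ k → ∏ k (λ j → ∏ j (λ i → i + j + k ∸ 1))) * x * den m)
                             (∏-cong (suc m) (λ j → ∏-cong (suc j) (λ i → drop-one (suc i) (suc j) m))))
                    (trans (*-assoc (∏ m (λ k → ∏ k (λ j → ∏ j (λ i → i + j + k ∸ 1)))) (layer′ m) (den m))
                           (cong (∏ m (λ k → ∏ k (λ j → ∏ j (λ i → i + j + k ∸ 1))) *_) (layer-shift m))))
             m)
           (sym (prod3-∏ m _)))

open import Defs
open import Data.Nat using (ℕ; _+_; _*_; _∸_; _≤_)
open import Data.Nat.Base using (suc; zero; s≤s)

theorem14 : ∀ (n : ℕ) → 2 ≤ n →
    ∃ λ N → NumIdeals allColors n N
    × N * prod2 (n ∸ 1) (λ i j → i + 2 * j ∸ 2) ≡ prod2 (n ∸ 1) (λ i j → i + j + n ∸ 2)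
    × N * prod3 (n ∸ 1) (λ i j k → i + j + k ∸ 2) ≡ prod3 (n ∸ 1) (λ i j k → i + j + k ∸ 1)
theorem14 (suc zero) (s≤s ())
theorem14 (suc (suc n)) _ =
  Product.N (suc n) , Ideals.Points.numIdeals (suc (suc n)) , Product.formula₂ (suc n) , Product.formula₃ (suc n)
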